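{- Let $\nu$ be a partition and let $r, m \in \mathbf{N}$ be positive integers. Then, in the ring of symmetric functions, \[ s_\nu \,(p_r \circ h_m) = \sum_{\lambda \,\vdash\, rm + |\nu|} \operatorname{sgn}_r(\lambda/\nu)\, s_\lambda . \]
   Context: $s_\lambda$ is the Schur function of the partition $\lambda$, $p_r$ is the power-sum symmetric function of degree $r$, $h_m = s_{(m)}$ is the complete homogeneous symmetric function of degree $m$, and $f\circ g$ denotes plethysm of symmetric functions (so $p_r \circ h_m$ is obtained from $h_m$ by replacing every variable $x_i$ with $x_i^r$). The Young diagram of $\lambda$ is $[\lambda]=\{(i,j): 1\le i\le p,\ 1\le j\le \lambda_i\}$, where $p$ is the number of parts, drawn in the English convention. The rim of $\lambda$ consists of the boxes $(i,j)\in[\lambda]$ with $(i+1,j+1)\notin[\lambda]$. A border-strip of length $s$ (an $s$-border-strip) in $\lambda$ consists of $s$ adjacent boxes in the rim of $\lambda$ whose removal from $[\lambda]$ leaves the Young diagram of a partition $\mu$; we then say $\lambda/\mu$ is an $s$-border-strip. Its height is $i-i'$, where $(i,j)$ is its bottom-left box and $(i',j')$ is its top-right box. If $\lambda/\mu$ is a border-strip of height $\ell$ then $\operatorname{sgn}(\lambda/\mu)=(-1)^\ell$. Let $\lambda/\nu$ be a skew-partition and let $d$ be minimal such that $\lambda_d>\nu_d$. An $r$-border-strip $\lambda/\mu$ is the final $r$-border-strip in $\lambda/\nu$ if $\mu/\nu$ is a skew-partition (i.e. $[\nu]\subseteq[\mu]$) and $\lambda_d>\mu_d$; it is unique if it exists.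 The skew-partition $\lambda/\nu$ is $r$-decomposable if there exist partitions $\lambda=\mu^{(0)}\supset\mu^{(1)}\supset\cdots\supset\mu^{(m)}=\nu$ such that $\mu^{(i)}/\mu^{(i+1)}$ is the final $r$-border-strip in $\mu^{(i)}/\nu$ for each $i\in\{0,\ldots,m-1\}$. In this case $\operatorname{sgn}_r(\lambda/\nu)=\operatorname{sgn}(\mu^{(0)}/\mu^{(1)})\cdots\operatorname{sgn}(\mu^{(m-1)}/\mu^{(m)})$. In all other cases (including when $[\nu]\not\subseteq[\lambda]$), $\operatorname{sgn}_r(\lambda/\nu)=0$. -}

module Defs where

open import Data.Bool.Base using (if_then_else_)
open import Data.Integer.Base using (ℤ; +_; 0ℤ; 1ℤ; -1ℤ)
import Data.Integer.Base as ℤ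
open import Data.List.Base
  using (List; []; _∷_; map; foldr; filter; length; concat; concatMap; zip;
         upTo; downFrom; replicate; cartesianProductWith)
open import Data.List.Membership.Propositional using (_∈_; lose; find)
open import Data.List.Membership.Propositional.Properties
  using (∈-filter⁺; ∈-map⁺; ∈-++⁺ˡ; ∈-++⁺ʳ)
import Data.List.Properties as List
open import Data.List.Relation.Unary.All using (All; []; _∷_; all?)
open import Data.List.Relation.Unary.Any using (here; there; any?)
open import Data.List.Relation.Unary.Linked using (Linked; linked?)
open import Data.Nat.Base
  using (ℕ; zero; suc; _+_; _∸_; _≤_; _<_; _≥_; _/_; NonZero; z<s; s<s; >-nonZero⁻¹)
open import Data.Nat.Divisibility using (_∣_; _∣?_)
open import Data.Nat.Induction using (<-wellFounded)
open import Data.Nat.ListAction using (sum)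
open import Data.Nat.Properties
  using (_≟_; _≤?_; _<?_; _≥?_; anyUpTo?; allUpTo?; m+n∸m≡n; m<n+m; suc-injective)
open import Data.Product.Base using (_×_; _,_; ∃-syntax; proj₁; proj₂; uncurry)
open import Data.Product.Properties using (≡-dec)
open import Data.Sum.Base using (_⊎_)
open import Induction.WellFounded using (Acc; acc)
open import Relation.Binary.PropositionalEquality
  using (_≡_; refl; sym; trans; cong; subst)
open import Relation.Nullary using (¬_; Dec; yes; no; does)
open import Relation.Nullary.Decidable using (_×-dec_; _⊎-dec_; ¬?)
open import Relation.Unary using (Decidable)

private
  variable
    A : Set

_≟ᴸ_ : (κ ν : List ℕ) → Dec (κ ≡ ν)
_≟ᴸ_ = List.≡-dec _≟_

------------------------------------------------------------------------
-- Partitions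

IsPartition : List ℕ → Set
IsPartition κ = Linked _≥_ κ × All (0 <_) κ

isPartition? : Decidable IsPartition
isPartition? κ = linked? _≥?_ κ ×-dec all? (0 <?_) κ

-- A composition of n + 1 either starts with 1, or is obtained from a nonempty
-- composition of n by increasing the first part.
compositions : ℕ → List (List ℕ)
compositions zero    = [] ∷ []
compositions (suc n) = concatMap extend (compositions n)
  where
  extend : List ℕ → List (List ℕ)
  extend []      = (1 ∷ []) ∷ []
  extend (a ∷ c) = (1 ∷ a ∷ c) ∷ (suc a ∷ c) ∷ []

partitions : ℕ → List (List ℕ)
partitions n = filter isPartition? (compositions n)

------------------------------------------------------------------------
-- Young diagrams

-- Boxes are indexed from 0: (i , j) is the box in row i + 1, column j + 1.
Box : Set
Box = ℕ × ℕ

part : List ℕ → ℕ → ℕ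
part []      _       = 0
part (a ∷ _) zero    = a
part (_ ∷ κ) (suc i) = part κ i

_∈[_] : Box → List ℕ → Set
(i , j) ∈[ κ ] = j < part κ i

_∈[_]? : (b : Box) (κ : List ℕ) → Dec (b ∈[ κ ])
(i , j) ∈[ κ ]? = j <? part κ i

-- The rows are read from bottom to top, each from left to right, so that the
-- boxes of a border-strip are met in order from its bottom-left box to its
-- top-right box.
boxes : List ℕ → List Box
boxes κ = concatMap (λ i → map (i ,_) (upTo (part κ i))) (downFrom (length κ))

_⊑_ : List ℕ → List ℕ → Set
μ ⊑ κ = All (_∈[ κ ]) (boxes μ)

_⊑?_ : (μ κ : List ℕ) → Dec (μ ⊑ κ)
μ ⊑? κ = all? (_∈[ κ ]?) (boxes μ)

skewBoxes : List ℕ → List ℕ → List Box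
skewBoxes κ μ = filter (λ b → ¬? (b ∈[ μ ]?)) (boxes κ)

------------------------------------------------------------------------
-- Border-strips

InRim : List ℕ → Box → Set
InRim κ (i , j) = (i , j) ∈[ κ ] × ¬ ((suc i , suc j) ∈[ κ ])

inRim? : (κ : List ℕ) → Decidable (InRim κ)
inRim? κ (i , j) = ((i , j) ∈[ κ ]?) ×-dec ¬? ((suc i , suc j) ∈[ κ ]?)

-- The second box is immediately to the right of, or immediately above, the
-- first; these are the two ways to move along the rim towards the top right.
Next : Box → Box → Set
Next (i , j) b = b ≡ (i , suc j) ⊎ (suc (proj₁ b) , proj₂ b) ≡ (i , j)

next? : (b c : Box) → Dec (Next b c)
next? (i , j) b =
  ≡-dec _≟_ _≟_ b (i , suc j) ⊎-dec ≡-dec _≟_ _≟_ (suc (proj₁ b) , proj₂ b) (i , j)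

-- κ/μ is an s-border-strip.
record BorderStrip (s : ℕ) (κ μ : List ℕ) : Set where
  constructor borderStrip
  field
    isPartition : IsPartition μ
    contained   : μ ⊑ κ
    size        : sum κ ≡ s + sum μ
    inRim       : All (InRim κ) (skewBoxes κ μ)
    adjacent    : Linked Next (skewBoxes κ μ)

borderStrip? : ∀ s κ μ → Dec (BorderStrip s κ μ)
borderStrip? s κ μ
  with isPartition? μ ×-dec (μ ⊑? κ) ×-dec (sum κ ≟ s + sum μ) ×-dec
       all? (inRim? κ) (skewBoxes κ μ) ×-dec linked? next? (skewBoxes κ μ)
... | yes (p , c , e , i , a) = yes (borderStrip p c e i a)
... | no ¬bs = no λ (borderStrip p c e i a) → ¬bs (p , c , e , i , a)

height : List Box → ℕ
height []       = 0
height (b ∷ bs) = proj₁ b ∸ proj₁ (lastOf b bs)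
  where
  lastOf : Box → List Box → Box
  lastOf c []       = c
  lastOf _ (c ∷ cs) = lastOf c cs

sgn : List ℕ → List ℕ → ℤ
sgn κ μ = -1ℤ ℤ.^ height (skewBoxes κ μ)

------------------------------------------------------------------------
-- r-decomposable skew-partitions

-- d is minimal such that part ν d < part κ d.
FirstExcess : List ℕ → List ℕ → ℕ → Set
FirstExcess κ ν d = part ν d < part κ d × (∀ {e} → e < d → ¬ (part ν e < part κ e))

-- κ/μ is the final r-border-strip in κ/ν. The bound d < length κ follows from
-- part ν d < part κ d; it is stated only for decidability.
record FinalStrip (r : ℕ) (κ ν μ : List ℕ) : Set where
  constructor finalStrip
  field
    strip     : BorderStrip r κ μ
    contains  : ν ⊑ μ
    meetsTop  : ∃[ d ] d < length κ × FirstExcess κ ν d × part μ d < part κ d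

finalStrip? : ∀ r κ ν μ → Dec (FinalStrip r κ ν μ)
finalStrip? r κ ν μ
  with borderStrip? r κ μ ×-dec (ν ⊑? μ) ×-dec
       anyUpTo? (λ d → ((part ν d <? part κ d) ×-dec
                        allUpTo? (λ e → ¬? (part ν e <? part κ e)) d) ×-dec
                       (part μ d <? part κ d))
                (length κ)
... | yes (b , c , t) = yes (finalStrip b c t)
... | no ¬fs = no λ (finalStrip b c t) → ¬fs (b , c , t)

data Decomposition (r : ℕ) (ν : List ℕ) : List ℕ → Set where
  done : Decomposition r ν ν
  step : ∀ {κ μ} → FinalStrip r κ ν μ → Decomposition r ν μ → Decomposition r ν κ

sign : ∀ {r ν κ} → Decomposition r ν κ → ℤ
sign done                      = 1ℤ
sign (step {κ = κ} {μ = μ} _ D) = sgn κ μ ℤ.* sign D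

∈-concatMap : {B : Set} (f : A → List B) {x : A} {y : B} {xs : List A} →
              x ∈ xs → y ∈ f x → y ∈ concatMap f xs
∈-concatMap f {xs = x ∷ xs} (here refl) q = ∈-++⁺ˡ q
∈-concatMap f {xs = x ∷ xs} (there p) q = ∈-++⁺ʳ (f x) (∈-concatMap f p q)

∈-compositions : ∀ n κ → All (0 <_) κ → sum κ ≡ n → κ ∈ compositions n
∈-compositions zero    []      _ _ = here refl
∈-compositions zero    (zero ∷ κ) (() ∷ _) _
∈-compositions (suc n) (suc zero ∷ []) _ e =
  ∈-concatMap _ (∈-compositions n [] [] (suc-injective e)) (here refl)
∈-compositions (suc n) (suc zero ∷ b ∷ κ) (_ ∷ ps) e =
  ∈-concatMap _ (∈-compositions n (b ∷ κ) ps (suc-injective e)) (here refl)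
∈-compositions (suc n) (suc (suc a) ∷ κ) (_ ∷ ps) e =
  ∈-concatMap _ (∈-compositions n (suc a ∷ κ) (z<s ∷ ps) (suc-injective e))
    (there (here refl))

∈-partitions : ∀ {n κ} → IsPartition κ → sum κ ≡ n → κ ∈ partitions n
∈-partitions p@(_ , ps) e = ∈-filter⁺ isPartition? (∈-compositions _ _ ps e) p

private
  decomposable?′ : ∀ r .{{_ : NonZero r}} ν κ → Acc _<_ (sum κ) → Dec (Decomposition r ν κ)
  decomposable?′ r ν κ (acc rec) with κ ≟ᴸ ν
  ... | yes refl = yes done
  ... | no κ≢ν with any? first? (partitions (sum κ ∸ r))
    where
    First : List ℕ → Set
    First μ = FinalStrip r κ ν μ × Decomposition r ν μ

    first? : Decidable First
    first? μ with finalStrip? r κ ν μ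
    ... | no ¬fs = no λ (fs , _) → ¬fs fs
    ... | yes fs with decomposable?′ r ν μ (rec smaller)
      where
      smaller : sum μ < sum κ
      smaller = subst (sum μ <_) (sym (BorderStrip.size (FinalStrip.strip fs)))
                      (m<n+m (sum μ) (>-nonZero⁻¹ r))
    ... | yes D = yes (fs , D)
    ... | no ¬D = no λ (_ , D) → ¬D D
  ... | yes found = let _ , _ , fs , D = find found in yes (step fs D)
  ... | no none = no λ where
    done → κ≢ν refl
    (step {μ = μ} fs D) →
      let open BorderStrip (FinalStrip.strip fs)
          e = sym (trans (cong (_∸ r) size) (m+n∸m≡n r (sum μ)))
      in none (lose (∈-partitions isPartition e) (fs , D))

decomposable? : ∀ r .{{_ : NonZero r}} ν κ → Dec (Decomposition r ν κ)
decomposable? r ν κ = decomposable?′ r ν κ (<-wellFounded (sum κ))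

-- sgn_r(κ/ν). The final r-border-strip is unique if it exists, so the value
-- does not depend on which decomposition is found.
sgnʳ : (r : ℕ) .{{_ : NonZero r}} → List ℕ → List ℕ → ℤ
sgnʳ r κ ν with decomposable? r ν κ
... | yes D = sign D
... | no  _ = 0ℤ

------------------------------------------------------------------------
-- Symmetric functions

-- The ring of symmetric functions is a subring of the ring of formal power
-- series over ℤ in x₁, x₂, …, where the computations below take place. A series
-- is given by its coefficients: the list α = a₁ ∷ … ∷ aₙ ∷ []
-- stands for the monomial x₁^a₁ ⋯ xₙ^aₙ. Lists differing by trailing zeros stand
-- for the same monomial.
Series : Set
Series = List ℕ → ℤ

infix 4 _≈_
_≈_ : Series → Series → Set
f ≈ g = ∀ α → f α ≡ g α

∑ : List A → (A → ℤ) → ℤ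
∑ xs f = foldr ℤ._+_ 0ℤ (map f xs)

splittings : List ℕ → List (List ℕ × List ℕ)
splittings []      = ([] , []) ∷ []
splittings (a ∷ α) =
  cartesianProductWith (λ k (β , γ) → (k ∷ β) , (a ∸ k ∷ γ)) (upTo (suc a)) (splittings α)

infixl 7 _⊛_ _·_
_⊛_ : Series → Series → Series
(f ⊛ g) α = ∑ (splittings α) λ (β , γ) → f β ℤ.* g γ

_·_ : ℤ → Series → Series
(c · f) α = c ℤ.* f α

∑ˢ : List A → (A → Series) → Series
∑ˢ xs f α = ∑ xs λ x → f x α

infix 5 ∑ˢ
syntax ∑ˢ xs (λ x → f) = ∑[ x ∈ xs ] f

-- The plethysm p_r ∘ f, in which every variable xᵢ of f is replaced by xᵢ^r.
p[_]∘_ : (r : ℕ) .{{_ : NonZero r}} → Series → Series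
(p[ r ]∘ f) α = if does (all? (r ∣?_) α) then f (map (_/ r) α) else 0ℤ

------------------------------------------------------------------------
-- Schur functions

choices : List (List A) → List (List A)
choices = foldr (cartesianProductWith _∷_) ([] ∷ [])

-- All fillings of [κ] with entries from 0, …, n - 1, as lists of rows; the
-- entry k contributes the variable x_{k+1}.
fillings : ℕ → List ℕ → List (List (List ℕ))
fillings n κ = choices (map (λ a → choices (replicate a (upTo n))) κ)

Semistandard : List (List ℕ) → Set
Semistandard T = All (Linked _≤_) T × Linked (λ R S → All (uncurry _<_) (zip R S)) T

semistandard? : Decidable Semistandard
semistandard? T =
  all? (linked? _≤?_) T ×-dec
  linked? (λ R S → all? (λ (a , b) → a <? b) (zip R S)) T

content : ℕ → List (List ℕ) → List ℕ
content n T = map (λ k → length (filter (k ≟_) (concat T))) (upTo n)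

-- s_κ is the sum of x^T over all semistandard tableaux T of shape κ.
s : List ℕ → Series
s κ α = + length (filter (λ T → semistandard? T ×-dec (content n T ≟ᴸ α)) (fillings n κ))
  where
  n = length α

h : (m : ℕ) → Series
h m = s (m ∷ [])

{-# OPTIONS --safe #-}

module Submission where

-- In n variables, encode a partition κ by the strictly decreasing list b of its
-- bead positions κ_i + n - i. The branching rule for tableaux is a sum over
-- interlacing lists, and writing it with oriented interval sums extends s to a
-- function S b of arbitrary lists b, which is alternating in b. By induction on
-- the number of variables, multiplying S b by p_r ∘ h_m amounts to summing S
-- over all ways to move the entries of b up by multiples of r, m multiples in
-- total: the unwanted terms cancel because S is alternating. Sorting the moved
-- lists turns this into a sum over strictly decreasing x of S x times the
-- determinant of the matrix with entries [b_i ≤ x_j and r ∣ x_j - b_i], where b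
-- now belongs to ν and x to κ. If x_d is the first entry above b_d, replacing it
-- by x_d - r does not change its column of the matrix, and sorting afterwards
-- removes the final r-border-strip from κ, with the sign of its height. So the
-- determinant satisfies the recursion of sgn_r(κ/ν).

open import Defs
import Algebra.Properties.CommutativeSemigroup as CommutativeSemigroupProperties
open import Data.Bool.Base using (if_then_else_; true; false)
open import Data.Integer.Base using (ℤ; +_; -_; 0ℤ; 1ℤ; -1ℤ)
  renaming (_+_ to infixl 6 _⊕_; _*_ to infixl 7 _⊗_; _-_ to infixl 6 _⊝_)
import Data.Integer.Base as ℤ
import Data.Integer.Properties as ℤ
open import Data.Integer.Tactic.RingSolver using (solve-∀)
open import Data.List.Base
  using (List; []; _∷_; _++_; _∷ʳ_; map; concat; concatMap; cartesianProductWith; filter;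
         length; reverse; replicate; upTo; downFrom; applyUpTo; zip)
open import Data.List.Membership.Propositional using (_∈_; _∉_)
open import Data.List.Membership.Propositional.Properties
  using (∈-map⁺; ∈-upTo⁺; ∈-downFrom⁺; ∈-filter⁻)
import Data.List.Properties as List
open import Data.List.Relation.Unary.All using (All; []; _∷_; all?)
import Data.List.Relation.Unary.All as All
import Data.List.Relation.Unary.All.Properties as All⁺
open import Data.List.Relation.Unary.AllPairs using (AllPairs; []; _∷_)
open import Data.List.Relation.Unary.Any using (Any; here; there; any?)
import Data.List.Relation.Unary.Any as Any
import Data.List.Relation.Unary.Any.Properties as Any⁺
open import Data.List.Relation.Unary.Linked using (Linked; []; [-]; _∷_; linked?)
open import Data.Nat.Base
  using (ℕ; zero; suc; pred; _+_; _*_; _∸_; _/_; _≤_; _<_; _≥_; _>_; z≤n; s≤s; z<s; s<s; s≤s⁻¹;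
         NonZero; >-nonZero; >-nonZero⁻¹)
open import Data.Nat.Divisibility
  using (_∣_; _∣?_; divides; ∣m+n∣m⇒∣n; ∣m∣n⇒∣m+n; ∣-refl; ∣⇒≤; _∣0)
open import Data.Nat.DivMod using (m*n/n≡m)
open import Data.Nat.Induction using (<-wellFounded)
open import Data.Nat.ListAction using (sum)
import Data.Nat.Properties as ℕ
import Data.Nat.Tactic.RingSolver as ℕS
open import Data.Product.Base using (_×_; _,_; proj₁; proj₂; ∃-syntax; uncurry)
open import Data.Sum.Base using (_⊎_; inj₁; inj₂; [_,_]′)
open import Function.Base using (_∘_; id; _$_; flip)
open import Induction.WellFounded using (Acc; acc)
open import Relation.Binary.Definitions using (tri<; tri≈; tri>)
open import Relation.Binary.PropositionalEquality
  using (_≡_; _≢_; refl; sym; trans; cong; cong₂; subst; subst₂; module ≡-Reasoning)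
open import Relation.Nullary using (¬_; Dec; yes; no; does; contradiction)
open import Relation.Nullary.Decidable using (_×-dec_; ¬?; toSum)
open import Relation.Unary using (Decidable; Pred)

open import Algebra.Properties.AbelianGroup ℤ.+-0-abelianGroup
  using () renaming (∙-cancelʳ to ⊕-cancelʳ)
open CommutativeSemigroupProperties ℤ.+-commutativeSemigroup
  using () renaming (interchange to ⊕-interchange)
open CommutativeSemigroupProperties ℤ.*-commutativeSemigroup
  using () renaming (x∙yz≈y∙xz to ⊗-exchange)
open CommutativeSemigroupProperties ℕ.+-commutativeSemigroup
  using () renaming (x∙yz≈y∙xz to +-exchange)

-- The sum coming from `p[ r ]∘ h m` moves every exponent independently of the others, so the moved
-- bead lists are in general neither decreasing nor free of repetitions. This is why `S` has to make
-- sense, and be alternating, on all lists: alternation removes the lists with repetitions and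
-- supplies the sign of sorting the others, and the independence of the moves is what turns the
-- collected signs into a determinant. The second concern is finiteness. Beads and exponents are
-- moved through the same cube of shifts, each below a fixed bound; without such a common range the
-- induction could not trade one kind of shift for the other. The price is that exponents may drop
-- below zero, hence contents are lists of integers, and the surplus terms have to be shown to
-- vanish for strictly decreasing beads. The determinant also settles which value `sgnʳ` takes:
-- every decomposition has the same determinant as its sign, so the one that the search happens to
-- find can be used.

private
  variable
    A B : Set
    P Q : Set

-- Integer arithmetic and indicators of decidable propositions

⊕-congˡ : ∀ x {y z} → y ≡ z → x ⊕ y ≡ x ⊕ z
⊕-congˡ x = cong (x ⊕_)

⊕-congʳ : ∀ x {y z} → y ≡ z → y ⊕ x ≡ z ⊕ x
⊕-congʳ x = cong (_⊕ x)

𝟙 : Dec P → ℤ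
𝟙 d = if does d then 1ℤ else 0ℤ

𝟙-yes : (d : Dec P) → P → 𝟙 d ≡ 1ℤ
𝟙-yes (yes _) _ = refl
𝟙-yes (no ¬p) p = contradiction p ¬p

𝟙-no : (d : Dec P) → ¬ P → 𝟙 d ≡ 0ℤ
𝟙-no (yes p) ¬p = contradiction p ¬p
𝟙-no (no _) _ = refl

𝟙-cong : (d : Dec P) (e : Dec Q) → (P → Q) → (Q → P) → 𝟙 d ≡ 𝟙 e
𝟙-cong (yes p) e f _ = sym (𝟙-yes e (f p))
𝟙-cong (no ¬p) e _ g = sym (𝟙-no e (¬p ∘ g))

𝟙-× : (d : Dec P) (e : Dec Q) → 𝟙 (d ×-dec e) ≡ 𝟙 d ⊗ 𝟙 e
𝟙-× (yes _) (yes _) = refl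
𝟙-× (yes _) (no _)  = refl
𝟙-× (no _)  _       = refl

𝟙-⊗-yes : (d : Dec P) {x : ℤ} → P → 𝟙 d ⊗ x ≡ x
𝟙-⊗-yes d {x} p = trans (cong (_⊗ x) (𝟙-yes d p)) (ℤ.*-identityˡ x)

𝟙-⊗-no : (d : Dec P) {x : ℤ} → ¬ P → 𝟙 d ⊗ x ≡ 0ℤ
𝟙-⊗-no d {x} ¬p = cong (_⊗ x) (𝟙-no d ¬p)

𝟙-⊗-cong : (d : Dec P) {x y : ℤ} → (P → x ≡ y) → 𝟙 d ⊗ x ≡ 𝟙 d ⊗ y
𝟙-⊗-cong (yes p) f = cong (1ℤ ⊗_) (f p)
𝟙-⊗-cong (no _)  _ = refl

self-negative⇒0 : ∀ x → x ≡ - x → x ≡ 0ℤ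
self-negative⇒0 (+ zero) _ = refl

-- Linear functionals

record Linear (L : (A → ℤ) → ℤ) : Set where
  field
    cong-≗ : ∀ {f g} → (∀ a → f a ≡ g a) → L f ≡ L g
    add    : ∀ f g → L (λ a → f a ⊕ g a) ≡ L f ⊕ L g
    scale  : ∀ c f → L (λ a → c ⊗ f a) ≡ c ⊗ L f

  vanish : ∀ {f} → (∀ a → f a ≡ 0ℤ) → L f ≡ 0ℤ
  vanish {f} f≡0 = trans (cong-≗ {g = λ a → 0ℤ ⊗ f a} f≡0) (scale 0ℤ f)

  scaleʳ : ∀ c f → L (λ a → f a ⊗ c) ≡ L f ⊗ c
  scaleʳ c f = trans (cong-≗ (λ a → ℤ.*-comm (f a) c)) (trans (scale c f) (ℤ.*-comm c (L f)))

  neg : ∀ f → L (λ a → - f a) ≡ - L f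
  neg f = trans (cong-≗ (λ a → sym (ℤ.-1*i≡-i (f a)))) (trans (scale -1ℤ f) (ℤ.-1*i≡-i (L f)))

  sub : ∀ f g → L (λ a → f a ⊝ g a) ≡ L f ⊝ L g
  sub f g = trans (add f (λ a → - g a)) (cong (L f ⊕_) (neg g))

open Linear public

-- Sums over lists

∑-cong-∈ : (xs : List A) {f g : A → ℤ} → (∀ {x} → x ∈ xs → f x ≡ g x) → ∑ xs f ≡ ∑ xs g
∑-cong-∈ []       _ = refl
∑-cong-∈ (x ∷ xs) e = cong₂ _⊕_ (e (here refl)) (∑-cong-∈ xs (e ∘ there))

∑-linear : (xs : List A) → Linear (∑ xs)
∑-linear xs .cong-≗ e = ∑-cong-∈ xs (λ {x} _ → e x)
∑-linear [] .add f g = refl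
∑-linear (x ∷ xs) .add f g =
  trans (⊕-congˡ (f x ⊕ g x) (∑-linear xs .add f g)) (⊕-interchange (f x) (g x) (∑ xs f) (∑ xs g))
∑-linear [] .scale c f = sym (ℤ.*-zeroʳ c)
∑-linear (x ∷ xs) .scale c f =
  trans (⊕-congˡ (c ⊗ f x) (∑-linear xs .scale c f)) (sym (ℤ.*-distribˡ-+ c (f x) (∑ xs f)))

∑-zero : (xs : List A) {f : A → ℤ} → (∀ {x} → x ∈ xs → f x ≡ 0ℤ) → ∑ xs f ≡ 0ℤ
∑-zero xs e = trans (∑-cong-∈ xs e) (vanish (∑-linear xs) (λ _ → refl))

∑-++ : (xs ys : List A) (f : A → ℤ) → ∑ (xs ++ ys) f ≡ ∑ xs f ⊕ ∑ ys f
∑-++ []       ys f = sym (ℤ.+-identityˡ _)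
∑-++ (x ∷ xs) ys f = trans (cong (f x ⊕_) (∑-++ xs ys f)) (sym (ℤ.+-assoc (f x) _ _))

∑-map : (g : A → B) (xs : List A) (f : B → ℤ) → ∑ (map g xs) f ≡ ∑ xs (f ∘ g)
∑-map g []       f = refl
∑-map g (x ∷ xs) f = ⊕-congˡ (f (g x)) (∑-map g xs f)

∑-concatMap : (g : A → List B) (xs : List A) (f : B → ℤ) →
              ∑ (concatMap g xs) f ≡ ∑ xs (λ x → ∑ (g x) f)
∑-concatMap g []       f = refl
∑-concatMap g (x ∷ xs) f =
  trans (∑-++ (g x) (concatMap g xs) f) (⊕-congˡ (∑ (g x) f) (∑-concatMap g xs f))

∑-cartesianProductWith :
  {C : Set} (g : A → B → C) (xs : List A) (ys : List B) (f : C → ℤ) →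
  ∑ (cartesianProductWith g xs ys) f ≡ ∑ xs λ x → ∑ ys λ y → f (g x y)
∑-cartesianProductWith g []       ys f = refl
∑-cartesianProductWith g (x ∷ xs) ys f =
  trans (∑-++ (map (g x) ys) _ f)
        (cong₂ _⊕_ (∑-map (g x) ys f) (∑-cartesianProductWith g xs ys f))

∑-filter : {R : Pred A _} (R? : Decidable R) (xs : List A) (f : A → ℤ) →
           ∑ (filter R? xs) f ≡ ∑ xs λ x → 𝟙 (R? x) ⊗ f x
∑-filter R? [] f = refl
∑-filter R? (x ∷ xs) f with R? x
... | yes _ = cong₂ _⊕_ (sym (ℤ.*-identityˡ (f x))) (∑-filter R? xs f)
... | no _  = trans (∑-filter R? xs f) (sym (ℤ.+-identityˡ _))

length-as-∑ : (xs : List A) → + length xs ≡ ∑ xs λ _ → 1ℤ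
length-as-∑ []       = refl
length-as-∑ (x ∷ xs) = trans (ℤ.pos-+ 1 (length xs)) (cong (1ℤ ⊕_) (length-as-∑ xs))

∑-swap : {L : (B → ℤ) → ℤ} → Linear L → (xs : List A) (f : A → B → ℤ) →
         L (λ b → ∑ xs λ a → f a b) ≡ ∑ xs λ a → L (f a)
∑-swap lin []       f = vanish lin (λ _ → refl)
∑-swap {L = L} lin (x ∷ xs) f = trans (lin .add (f x) _) (⊕-congˡ (L (f x)) (∑-swap lin xs f))

-- Sums over initial segments of ℕ

Σ< : ℕ → (ℕ → ℤ) → ℤ
Σ< zero    f = 0ℤ
Σ< (suc n) f = Σ< n f ⊕ f n

Σ<-cong : ∀ n {f g : ℕ → ℤ} → (∀ {i} → i < n → f i ≡ g i) → Σ< n f ≡ Σ< n g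
Σ<-cong zero    e = refl
Σ<-cong (suc n) e = cong₂ _⊕_ (Σ<-cong n (λ i<n → e (ℕ.m<n⇒m<1+n i<n))) (e (ℕ.n<1+n n))

Σ<-linear : ∀ n → Linear (Σ< n)
Σ<-linear n .cong-≗ e = Σ<-cong n (λ {i} _ → e i)
Σ<-linear zero .add f g = refl
Σ<-linear (suc n) .add f g =
  trans (⊕-congʳ _ (Σ<-linear n .add f g)) (⊕-interchange (Σ< n f) (Σ< n g) (f n) (g n))
Σ<-linear zero .scale c f = sym (ℤ.*-zeroʳ c)
Σ<-linear (suc n) .scale c f =
  trans (⊕-congʳ _ (Σ<-linear n .scale c f)) (sym (ℤ.*-distribˡ-+ c (Σ< n f) (f n)))

Σ<-zero : ∀ n {f : ℕ → ℤ} → (∀ {i} → i < n → f i ≡ 0ℤ) → Σ< n f ≡ 0ℤ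
Σ<-zero n e = trans (Σ<-cong n e) (vanish (Σ<-linear n) (λ _ → refl))

Σ<-swap : {L : (B → ℤ) → ℤ} → Linear L → ∀ n (f : ℕ → B → ℤ) →
          L (λ b → Σ< n λ i → f i b) ≡ Σ< n λ i → L (f i)
Σ<-swap lin zero    f = vanish lin (λ _ → refl)
Σ<-swap lin (suc n) f = trans (lin .add _ (f n)) (⊕-congʳ _ (Σ<-swap lin n f))

Σ<-+ : ∀ m n (f : ℕ → ℤ) → Σ< (m + n) f ≡ Σ< m f ⊕ Σ< n (λ i → f (m + i))
Σ<-+ m zero f rewrite ℕ.+-identityʳ m = sym (ℤ.+-identityʳ _)
Σ<-+ m (suc n) f rewrite ℕ.+-suc m n =
  trans (cong (_⊕ f (m + n)) (Σ<-+ m n f)) (ℤ.+-assoc (Σ< m f) _ _)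

Σ<-head : ∀ n (f : ℕ → ℤ) → Σ< (suc n) f ≡ f 0 ⊕ Σ< n (f ∘ suc)
Σ<-head n f = trans (Σ<-+ 1 n f) (cong (_⊕ Σ< n (f ∘ suc)) (ℤ.+-identityˡ (f 0)))

Σ<-reverse : ∀ n (f : ℕ → ℤ) → Σ< (suc n) (λ i → f (n ∸ i)) ≡ Σ< (suc n) f
Σ<-reverse zero    f = refl
Σ<-reverse (suc n) f = begin
  Σ< (suc (suc n)) (λ i → f (suc n ∸ i))       ≡⟨ Σ<-head (suc n) _ ⟩
  f (suc n) ⊕ Σ< (suc n) (λ i → f (n ∸ i))     ≡⟨ ℤ.+-comm (f (suc n)) _ ⟩
  Σ< (suc n) (λ i → f (n ∸ i)) ⊕ f (suc n)     ≡⟨ cong (_⊕ f (suc n)) (Σ<-reverse n f) ⟩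
  Σ< (suc (suc n)) f                           ∎
  where open ≡-Reasoning

∑-applyUpTo : (g : ℕ → A) (n : ℕ) (f : A → ℤ) → ∑ (applyUpTo g n) f ≡ Σ< n (f ∘ g)
∑-applyUpTo g zero    f = refl
∑-applyUpTo g (suc n) f =
  trans (cong (f (g 0) ⊕_) (∑-applyUpTo (g ∘ suc) n f)) (sym (Σ<-head n (f ∘ g)))

Σ<-𝟙≟ : ∀ n k (f : ℕ → ℤ) → (n ≤ k → f k ≡ 0ℤ) → Σ< n (λ i → 𝟙 (i ℕ.≟ k) ⊗ f i) ≡ f k
Σ<-𝟙≟ zero    k f z = sym (z z≤n)
Σ<-𝟙≟ (suc n) k f z = [ last , earlier ]′ (toSum (n ℕ.≟ k))
  where
  last : n ≡ k → _
  last refl = trans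
    (cong₂ _⊕_ (Σ<-zero n (λ {i} i<n → 𝟙-⊗-no (i ℕ.≟ n) (ℕ.<⇒≢ i<n))) (𝟙-⊗-yes (n ℕ.≟ n) refl))
    (ℤ.+-identityˡ (f n))
  earlier : n ≢ k → _
  earlier n≢k = trans
    (cong₂ _⊕_ (Σ<-𝟙≟ n k f (λ n≤k → z (ℕ.≤∧≢⇒< n≤k n≢k))) (𝟙-⊗-no (n ℕ.≟ k) n≢k))
    (ℤ.+-identityʳ (f k))

-- Alternating functions

record Alternating (φ : List ℕ → ℤ) : Set where
  field
    transpose : ∀ ws x y zs → φ (ws ++ x ∷ y ∷ zs) ≡ - φ (ws ++ y ∷ x ∷ zs)

open Alternating public

alternating-∷ : ∀ {φ} → Alternating φ → ∀ c → Alternating (λ cs → φ (c ∷ cs))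
alternating-∷ alt c .transpose ws = alt .transpose (c ∷ ws)

-- Oriented interval sums

-- For `x ≤ y` this sums `f` over `x ≤ i < y`; otherwise it is minus the sum over `y ≤ i < x`. With
-- this sign `I-chain` and `I-flip` hold whatever the order of the end points, and so `J` can be
-- alternating on unsorted lists.
I : ℕ → ℕ → (ℕ → ℤ) → ℤ
I x y f = Σ< y f ⊝ Σ< x f

I-linear : ∀ x y → Linear (I x y)
I-linear x y .cong-≗ e = cong₂ _⊝_ (Σ<-linear y .cong-≗ e) (Σ<-linear x .cong-≗ e)
I-linear x y .add f g =
  trans (cong₂ _⊝_ (Σ<-linear y .add f g) (Σ<-linear x .add f g))
        (lemma (Σ< y f) (Σ< y g) (Σ< x f) (Σ< x g))
  where
  lemma : ∀ a b c d → (a ⊕ b) ⊝ (c ⊕ d) ≡ (a ⊝ c) ⊕ (b ⊝ d)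
  lemma = solve-∀
I-linear x y .scale c f =
  trans (cong₂ _⊝_ (Σ<-linear y .scale c f) (Σ<-linear x .scale c f))
        (lemma c (Σ< y f) (Σ< x f))
  where
  lemma : ∀ c a b → c ⊗ a ⊝ c ⊗ b ≡ c ⊗ (a ⊝ b)
  lemma = solve-∀

I-flip : ∀ x y f → I x y f ≡ - I y x f
I-flip x y f = lemma (Σ< y f) (Σ< x f)
  where
  lemma : ∀ a b → a ⊝ b ≡ - (b ⊝ a)
  lemma = solve-∀

I-chain : ∀ x y z f → I x z f ≡ I y z f ⊕ I x y f
I-chain x y z f = lemma (Σ< x f) (Σ< y f) (Σ< z f)
  where
  lemma : ∀ a b c → c ⊝ a ≡ (c ⊝ b) ⊕ (b ⊝ a)
  lemma = solve-∀

I-translate : ∀ x y k f → I (x + k) (y + k) f ≡ I x y (λ c → f (c + k))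
I-translate x y k f =
  trans (cong₂ _⊝_ (Σ<-translate y) (Σ<-translate x))
        (lemma (Σ< k f) (Σ< y (λ c → f (c + k))) (Σ< x (λ c → f (c + k))))
  where
  Σ<-translate : ∀ n → Σ< (n + k) f ≡ Σ< k f ⊕ Σ< n (λ c → f (c + k))
  Σ<-translate n = trans (cong (λ j → Σ< j f) (ℕ.+-comm n k))
    (trans (Σ<-+ k n f) (⊕-congˡ (Σ< k f) (Σ<-cong n (λ {i} _ → cong f (ℕ.+-comm k i)))))
  lemma : ∀ a b c → (a ⊕ b) ⊝ (a ⊕ c) ≡ b ⊝ c
  lemma = solve-∀

I-segment : ∀ x k f → I x (x + k) f ≡ Σ< k (λ i → f (x + i))
I-segment x k f = trans (cong (_⊝ Σ< x f) (Σ<-+ x k f)) (lemma (Σ< x f) _)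
  where
  lemma : ∀ a b → (a ⊕ b) ⊝ a ≡ b
  lemma = solve-∀

I-swap : {L : (B → ℤ) → ℤ} → Linear L → ∀ x y (f : ℕ → B → ℤ) →
         L (λ b → I x y λ i → f i b) ≡ I x y λ i → L (f i)
I-swap lin x y f = trans (sub lin _ _) (cong₂ _⊝_ (Σ<-swap lin y f) (Σ<-swap lin x f))

-- Both variables range over the same interval, so exchanging the two sums turns the total into its
-- own negative.
I-antisymmetric : ∀ x y (f : ℕ → ℕ → ℤ) → (∀ c d → f c d ≡ - f d c) →
                  I x y (λ c → I x y (f c)) ≡ 0ℤ
I-antisymmetric x y f anti = self-negative⇒0 _ (begin
  I x y (λ c → I x y (f c))             ≡⟨ lin .cong-≗ (λ c → trans (lin .cong-≗ (anti c)) (neg lin (λ d → f d c))) ⟩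
  I x y (λ c → - I x y (λ d → f d c))   ≡⟨ neg lin (λ c → I x y (λ d → f d c)) ⟩
  - I x y (λ c → I x y (λ d → f d c))   ≡⟨ cong -_ (I-swap lin x y f) ⟩
  - I x y (λ c → I x y (f c))           ∎)
  where
  open ≡-Reasoning
  lin = I-linear x y

-- For a strictly decreasing list, the sum over all interlacing lists.
J : List ℕ → (List ℕ → ℤ) → ℤ
J []           φ = 0ℤ
J (b ∷ [])     φ = φ []
J (b ∷ c ∷ bs) φ = I c b λ d → J (c ∷ bs) λ ds → φ (d ∷ ds)

J-linear : ∀ b → Linear (J b)
J-linear []           .cong-≗ e = refl
J-linear []           .add f g = refl
J-linear []           .scale c f = sym (ℤ.*-zeroʳ c)
J-linear (b ∷ [])     .cong-≗ e = e []
J-linear (b ∷ [])     .add f g = refl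
J-linear (b ∷ [])     .scale c f = refl
J-linear (b ∷ c ∷ bs) .cong-≗ e =
  I-linear c b .cong-≗ (λ d → J-linear (c ∷ bs) .cong-≗ (λ ds → e (d ∷ ds)))
J-linear (b ∷ c ∷ bs) .add f g =
  trans (I-linear c b .cong-≗ (λ d → J-linear (c ∷ bs) .add (f ∘ (d ∷_)) (g ∘ (d ∷_))))
        (I-linear c b .add _ _)
J-linear (b ∷ c ∷ bs) .scale k f =
  trans (I-linear c b .cong-≗ (λ d → J-linear (c ∷ bs) .scale k (f ∘ (d ∷_))))
        (I-linear c b .scale k _)

-- The swap reverses the first interval, which gives the sign, and moves the upper end of the second
-- from `y` to `x`. The second change costs nothing: the difference lets the first two entries of
-- the interlacing list range over the same interval, where an alternating function sums to zero.
J-swap-head : ∀ x y zs {φ} → Alternating φ → J (x ∷ y ∷ zs) φ ≡ - J (y ∷ x ∷ zs) φ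
J-swap-head x y [] alt = I-flip y x _
J-swap-head x y (z ∷ zs) {φ} alt = begin
  I y x (λ c → I z y (f c))
    ≡⟨ I-linear y x .cong-≗ (λ c → split c) ⟩
  I y x (λ c → I z x (f c) ⊝ I y x (f c))
    ≡⟨ sub (I-linear y x) (λ c → I z x (f c)) (λ c → I y x (f c)) ⟩
  I y x (λ c → I z x (f c)) ⊝ I y x (λ c → I y x (f c))
    ≡⟨ cong (I y x (λ c → I z x (f c)) ⊝_) (I-antisymmetric y x f anti) ⟩
  I y x (λ c → I z x (f c)) ⊝ 0ℤ
    ≡⟨ ℤ.+-identityʳ _ ⟩
  I y x (λ c → I z x (f c))
    ≡⟨ I-flip y x (λ c → I z x (f c)) ⟩
  - I x y (λ c → I z x (f c)) ∎
  where
  open ≡-Reasoning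
  f : ℕ → ℕ → ℤ
  f c d = J (z ∷ zs) (λ cs → φ (c ∷ d ∷ cs))
  anti : ∀ c d → f c d ≡ - f d c
  anti c d = trans (J-linear (z ∷ zs) .cong-≗ (λ cs → alt .transpose [] c d cs)) (neg (J-linear (z ∷ zs)) _)
  split : ∀ c → I z y (f c) ≡ I z x (f c) ⊝ I y x (f c)
  split c = lemma (Σ< x (f c)) (Σ< y (f c)) (Σ< z (f c))
    where
    lemma : ∀ a b e → b ⊝ e ≡ (a ⊝ e) ⊝ (a ⊝ b)
    lemma = solve-∀

-- With a single `w` in front, the swap also moves the lower end of the interval below `w` from `x`
-- to `y`. The added piece again has two neighbouring entries ranging over one interval and
-- vanishes. Entries further to the left do not bound an interval together with `x` or `y`.
J-swap : ∀ ws x y zs {φ} → Alternating φ → J (ws ++ x ∷ y ∷ zs) φ ≡ - J (ws ++ y ∷ x ∷ zs) φ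
J-swap [] x y zs alt = J-swap-head x y zs alt
J-swap (w ∷ []) x y zs {φ} alt = begin
  I x w f
    ≡⟨ ℤ.+-identityʳ _ ⟨
  I x w f ⊕ 0ℤ
    ≡⟨ cong (I x w f ⊕_) (I-antisymmetric y x f′ anti) ⟨
  I x w f ⊕ I y x f
    ≡⟨ I-chain y x w f ⟨
  I y w f
    ≡⟨ I-linear y w .cong-≗ (λ c → J-swap-head x y zs (alternating-∷ alt c)) ⟩
  I y w (λ c → - J (y ∷ x ∷ zs) (φ ∘ (c ∷_)))
    ≡⟨ neg (I-linear y w) _ ⟩
  - I y w (λ c → J (y ∷ x ∷ zs) (φ ∘ (c ∷_))) ∎
  where
  open ≡-Reasoning
  f : ℕ → ℤ
  f c = J (x ∷ y ∷ zs) (φ ∘ (c ∷_))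
  f′ : ℕ → ℕ → ℤ
  f′ c d = J (y ∷ zs) (λ cs → φ (c ∷ d ∷ cs))
  anti : ∀ c d → f′ c d ≡ - f′ d c
  anti c d = trans (J-linear (y ∷ zs) .cong-≗ (λ cs → alt .transpose [] c d cs)) (neg (J-linear (y ∷ zs)) _)
J-swap (v ∷ w ∷ ws) x y zs {φ} alt =
  trans (I-linear w v .cong-≗ (λ c → J-swap (w ∷ ws) x y zs (alternating-∷ alt c)))
        (neg (I-linear w v) _)

-- S b α extends s κ to arbitrary lists b in place of the strictly decreasing
-- list of the κ_i + n - i; the content α is read from the last variable to the
-- first, and its entries may be negative.
S : List ℕ → List ℤ → ℤ
S []      []      = 1ℤ
S (_ ∷ _) []      = 0ℤ
S b       (a ∷ α) = J b λ c → 𝟙 (+ sum b ℤ.≟ + (sum c + length c) ⊕ a) ⊗ S c α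

sum-swap : ∀ ws x y zs → sum (ws ++ x ∷ y ∷ zs) ≡ sum (ws ++ y ∷ x ∷ zs)
sum-swap []       x y zs = +-exchange x y (sum zs)
sum-swap (w ∷ ws) x y zs = cong (_+_ w) (sum-swap ws x y zs)

length-swap : ∀ ws x y (zs : List ℕ) → length (ws ++ x ∷ y ∷ zs) ≡ length (ws ++ y ∷ x ∷ zs)
length-swap []       x y zs = refl
length-swap (w ∷ ws) x y zs = cong suc (length-swap ws x y zs)

alternating-⊗ : ∀ {φ : List ℕ → ℤ} (k : List ℕ → ℤ) →
                (∀ ws x y zs → k (ws ++ x ∷ y ∷ zs) ≡ k (ws ++ y ∷ x ∷ zs)) →
                Alternating φ → Alternating (λ xs → k xs ⊗ φ xs)
alternating-⊗ k k-sym alt .transpose ws x y zs =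
  trans (cong₂ _⊗_ (k-sym ws x y zs) (alt .transpose ws x y zs)) (sym (ℤ.neg-distribʳ-* (k _) _))

S-∷ : ∀ b a α → S b (a ∷ α) ≡ J b λ c → 𝟙 (+ sum b ℤ.≟ + (sum c + length c) ⊕ a) ⊗ S c α
S-∷ []      a α = refl
S-∷ (_ ∷ _) a α = refl

-- The degree condition sees a list only through its sum and length, which a swap preserves. The
-- summand is therefore alternating by induction on the content, and `J-swap` carries this over to
-- `J`.
S-alternating : ∀ α → Alternating (λ b → S b α)
weighted-alternating : ∀ m a α →
  Alternating (λ c → 𝟙 (+ m ℤ.≟ + (sum c + length c) ⊕ a) ⊗ S c α)

S-alternating [] .transpose []      x y zs = refl
S-alternating [] .transpose (_ ∷ _) x y zs = refl
S-alternating (a ∷ α) .transpose ws x y zs =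
  trans (S-∷ (ws ++ x ∷ y ∷ zs) a α)
 (trans (cong (λ m → J (ws ++ x ∷ y ∷ zs) (λ c → 𝟙 (+ m ℤ.≟ + (sum c + length c) ⊕ a) ⊗ S c α))
              (sum-swap ws x y zs))
 (trans (J-swap ws x y zs (weighted-alternating (sum (ws ++ y ∷ x ∷ zs)) a α))
        (cong -_ (sym (S-∷ (ws ++ y ∷ x ∷ zs) a α)))))

weighted-alternating m a α = alternating-⊗ (λ c → 𝟙 (+ m ℤ.≟ + (sum c + length c) ⊕ a))
  (λ ws x y zs → cong₂ (λ p q → 𝟙 (+ m ℤ.≟ + (p + q) ⊕ a)) (sum-swap ws x y zs) (length-swap ws x y zs))
  (S-alternating α)

-- Sums over all ways of moving the entries of a list

-- `F` receives the moved list and the total number of steps. The bound `M` on the steps of a single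
-- entry keeps the sum finite; it is later taken so large that all terms beyond it vanish.
shifts : (A → ℕ → A) → ℕ → List A → (List A → ℕ → ℤ) → ℤ
shifts _◃_ M []       F = F [] 0
shifts _◃_ M (x ∷ xs) F = Σ< M λ g → shifts _◃_ M xs λ ys t → F (x ◃ g ∷ ys) (g + t)

shifts-cong : (_◃_ : A → ℕ → A) (M : ℕ) (xs : List A) {F G : List A → ℕ → ℤ} →
              (∀ ys t → F ys t ≡ G ys t) → shifts _◃_ M xs F ≡ shifts _◃_ M xs G
shifts-cong _◃_ M []       e = e [] 0
shifts-cong _◃_ M (x ∷ xs) e =
  Σ<-cong M (λ {g} _ → shifts-cong _◃_ M xs (λ ys t → e (x ◃ g ∷ ys) (g + t)))

shifts-swap : {L : (B → ℤ) → ℤ} → Linear L → (_◃_ : A → ℕ → A) (M : ℕ) (xs : List A)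
              (F : List A → ℕ → B → ℤ) →
              L (λ b → shifts _◃_ M xs λ ys t → F ys t b) ≡ shifts _◃_ M xs λ ys t → L (F ys t)
shifts-swap lin _◃_ M []       F = refl
shifts-swap lin _◃_ M (x ∷ xs) F =
  trans (Σ<-swap lin M _)
        (Σ<-cong M (λ {g} _ → shifts-swap lin _◃_ M xs (λ ys t → F (x ◃ g ∷ ys) (g + t))))

shifts-linear : (_◃_ : A → ℕ → A) (M : ℕ) (xs : List A) →
                Linear (λ (F : List A × ℕ → ℤ) → shifts _◃_ M xs λ ys t → F (ys , t))
shifts-linear _◃_ M xs .cong-≗ e = shifts-cong _◃_ M xs (λ ys t → e (ys , t))
shifts-linear _◃_ M [] .add F G = refl
shifts-linear _◃_ M (x ∷ xs) .add F G =
  trans (Σ<-cong M (λ {g} _ → shifts-linear _◃_ M xs .add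
           (λ (ys , t) → F (x ◃ g ∷ ys , g + t)) (λ (ys , t) → G (x ◃ g ∷ ys , g + t))))
        (Σ<-linear M .add _ _)
shifts-linear _◃_ M [] .scale c F = refl
shifts-linear _◃_ M (x ∷ xs) .scale c F =
  trans (Σ<-cong M (λ {g} _ → shifts-linear _◃_ M xs .scale c
           (λ (ys , t) → F (x ◃ g ∷ ys , g + t))))
        (Σ<-linear M .scale c _)

module _ (r : ℕ) where

  up : ℕ → ℕ → ℕ
  up b g = b + r * g

  down : ℤ → ℕ → ℤ
  down a g = a ⊝ + (r * g)

  -- The comparison may use that `t` steps in total raise the sum by `r * t`. This is how conditions
  -- on the degree and conditions on `t` are converted into each other.
  shifts-up-cong : (M : ℕ) (xs : List ℕ) {F G : List ℕ → ℕ → ℤ} →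
    (∀ ys t → sum ys ≡ sum xs + r * t → length ys ≡ length xs → F ys t ≡ G ys t) →
    shifts up M xs F ≡ shifts up M xs G
  shifts-up-cong M []       e = e [] 0 (sym (ℕ.*-zeroʳ r)) refl
  shifts-up-cong M (x ∷ xs) e = Σ<-cong M (λ {g} _ → shifts-up-cong M xs (λ ys t p q →
    e (up x g ∷ ys) (g + t)
      (trans (cong (_+_ (up x g)) p) (lemma r x g (sum xs) t)) (cong suc q)))
    where
    lemma : ∀ r x g s t → (x + r * g) + (s + r * t) ≡ (x + s) + r * (g + t)
    lemma = ℕS.solve-∀

  -- The terms in which the first interval is moved by both of its ends cancel
  -- in pairs, by exchanging the first two shifts.
  J-shifts : ∀ M b bs (φ : ℕ → List ℕ → ℤ) → (∀ t → Alternating (φ t)) →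
    shifts up M (b ∷ bs) (λ ys t → J ys (φ t)) ≡
    Σ< M (λ g → J (b ∷ bs) (λ c → shifts up M c (λ ys t → φ (g + t) ys)))
  J-shifts M b []        φ alt = refl
  J-shifts M b (b′ ∷ bs) φ alt = begin
    Σ< M (λ g → Σ< M λ g′ → shifts up M bs λ ys t → J (up b g ∷ up b′ g′ ∷ ys) (φ (g + (g′ + t))))
      ≡⟨ Σ<-cong M (λ {g} _ → split g) ⟩
    Σ< M (λ g → shifts up M (b′ ∷ bs) (main g) ⊕ shifts up M (b′ ∷ bs) (rest g))
      ≡⟨ Σ<-linear M .add _ _ ⟩
    Σ< M (λ g → shifts up M (b′ ∷ bs) (main g)) ⊕ Σ< M (λ g → shifts up M (b′ ∷ bs) (rest g))
      ≡⟨ cong₂ _⊕_ (Σ<-cong M (λ {g} _ → main-eq g)) rest-eq ⟩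
    Σ< M (λ g → Σ< M λ g′ → target g′ g) ⊕ 0ℤ
      ≡⟨ ℤ.+-identityʳ _ ⟩
    Σ< M (λ g → Σ< M λ g′ → target g′ g)
      ≡⟨ Σ<-swap (Σ<-linear M) M target ⟩
    Σ< M (λ g′ → Σ< M (target g′))
      ≡⟨ Σ<-cong M (λ {g′} _ → target-eq g′) ⟩
    Σ< M (λ g → J (b ∷ b′ ∷ bs) (λ c → shifts up M c (λ ys t → φ (g + t) ys))) ∎
    where
    open ≡-Reasoning
    -- The first interval, from `up b′ g′` to `up b g`, is cut at `up b′ g`. The piece `main` is the
    -- unmoved interval translated by `r * g`. The piece `rest` is the `J` of a list starting with
    -- `up b′ g` and `up b′ g′`, which is antisymmetric in `g` and `g′`.
    main rest : ℕ → List ℕ → ℕ → ℤ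
    main g ys t = I (up b′ g) (up b g) (λ c → J ys (φ (g + t) ∘ (c ∷_)))
    rest g ys t = J (up b′ g ∷ ys) (φ (g + t))
    target : ℕ → ℕ → ℤ
    target g′ g = I b′ b λ c → J (b′ ∷ bs) λ cs → shifts up M cs λ ys t → φ (g′ + (g + t)) (up c g ∷ ys)

    split : ∀ g → shifts up M (b′ ∷ bs) (λ ys t → J (up b g ∷ ys) (φ (g + t))) ≡
                  shifts up M (b′ ∷ bs) (main g) ⊕ shifts up M (b′ ∷ bs) (rest g)
    split g = trans
      (Σ<-cong M (λ {g′} _ → shifts-cong up M bs (λ ys t → I-chain (up b′ g′) (up b′ g) (up b g) _)))
      (shifts-linear up M (b′ ∷ bs) .add (λ (ys , t) → main g ys t) (λ (ys , t) → rest g ys t))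

    exchanged : ℕ → ℕ → ℤ
    exchanged g g′ = shifts up M bs λ ys t → J (up b′ g ∷ up b′ g′ ∷ ys) (φ (g + (g′ + t)))

    exchanged-anti : ∀ g g′ → exchanged g g′ ≡ - exchanged g′ g
    exchanged-anti g g′ = trans
      (shifts-cong up M bs (λ ys t →
        trans (J-swap-head (up b′ g) (up b′ g′) ys (alt (g + (g′ + t))))
              (cong (λ u → - J (up b′ g′ ∷ up b′ g ∷ ys) (φ u)) (+-exchange g g′ t))))
      (neg (shifts-linear up M bs) (λ (ys , t) → J (up b′ g′ ∷ up b′ g ∷ ys) (φ (g′ + (g + t)))))

    rest-eq : Σ< M (λ g → shifts up M (b′ ∷ bs) (rest g)) ≡ 0ℤ
    rest-eq = self-negative⇒0 _ (begin
      Σ< M (λ g → Σ< M (exchanged g))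
        ≡⟨ Σ<-cong M (λ {g} _ → trans (Σ<-cong M (λ {g′} _ → exchanged-anti g g′)) (neg (Σ<-linear M) _)) ⟩
      Σ< M (λ g → - Σ< M (λ g′ → exchanged g′ g))
        ≡⟨ neg (Σ<-linear M) _ ⟩
      - Σ< M (λ g → Σ< M (λ g′ → exchanged g′ g))
        ≡⟨ cong -_ (Σ<-swap (Σ<-linear M) M exchanged) ⟩
      - Σ< M (λ g → Σ< M (exchanged g)) ∎)

    main-eq : ∀ g → shifts up M (b′ ∷ bs) (main g) ≡ Σ< M (λ g′ → target g′ g)
    main-eq g = begin
      shifts up M (b′ ∷ bs) (main g)
        ≡⟨ shifts-cong up M (b′ ∷ bs) (λ ys t → I-translate b′ b (r * g) (λ c → J ys (φ (g + t) ∘ (c ∷_)))) ⟩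
      shifts up M (b′ ∷ bs) (λ ys t → I b′ b (λ c → J ys (φ (g + t) ∘ (up c g ∷_))))
        ≡⟨ I-swap (shifts-linear up M (b′ ∷ bs)) b′ b (λ c (ys , t) → J ys (φ (g + t) ∘ (up c g ∷_))) ⟩
      I b′ b (λ c → shifts up M (b′ ∷ bs) (λ ys t → J ys (φ (g + t) ∘ (up c g ∷_))))
        ≡⟨ I-linear b′ b .cong-≗ (λ c → J-shifts M b′ bs (λ t → φ (g + t) ∘ (up c g ∷_))
             (λ t → alternating-∷ (alt (g + t)) (up c g))) ⟩
      I b′ b (λ c → Σ< M (λ g′ → J (b′ ∷ bs) λ cs → shifts up M cs λ ys t → φ (g + (g′ + t)) (up c g ∷ ys)))
        ≡⟨ I-linear b′ b .cong-≗ (λ c → Σ<-cong M (λ {g′} _ → J-linear (b′ ∷ bs) .cong-≗ (λ cs →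
             shifts-cong up M cs (λ ys t → cong (λ u → φ u (up c g ∷ ys)) (+-exchange g g′ t))))) ⟩
      I b′ b (λ c → Σ< M (λ g′ → J (b′ ∷ bs) λ cs → shifts up M cs λ ys t → φ (g′ + (g + t)) (up c g ∷ ys)))
        ≡⟨ Σ<-swap (I-linear b′ b) M _ ⟩
      Σ< M (λ g′ → target g′ g) ∎

    target-eq : ∀ g′ → Σ< M (target g′) ≡ J (b ∷ b′ ∷ bs) (λ c → shifts up M c (λ ys t → φ (g′ + t) ys))
    target-eq g′ = sym (trans
      (I-linear b′ b .cong-≗ (λ c → Σ<-swap (J-linear (b′ ∷ bs)) M _))
      (Σ<-swap (I-linear b′ b) M _))

  -- This exchanges moves of the beads for moves of the exponents, one variable at a time:
  -- `J-shifts` passes all shifts but one to the interlacing list, and the remaining shift is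
  -- charged to the exponent `a`. The weight is arbitrary because fixing the first shift `g`
  -- replaces `w` by `w (g + _)` in the induction.
  shifts-S : ∀ M α b (w : ℕ → ℤ) →
             shifts up M b (λ b′ t → w t ⊗ S b′ α) ≡ shifts down M α (λ α′ t → w t ⊗ S b α′)
  shifts-S M [] [] w = refl
  shifts-S M [] (b ∷ bs) w = trans
    (Σ<-zero M (λ {g} _ → vanish (shifts-linear up M bs)
      {f = λ (ys , t) → w (g + t) ⊗ S (up b g ∷ ys) []} (λ (_ , t) → ℤ.*-zeroʳ (w (g + t)))))
    (sym (ℤ.*-zeroʳ (w 0)))
  shifts-S M (a ∷ α) [] w = begin
    w 0 ⊗ 0ℤ   ≡⟨ ℤ.*-zeroʳ (w 0) ⟩
    0ℤ         ≡⟨ Σ<-zero M (λ {g} _ → vanish (shifts-linear down M α)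
                     {f = λ (α′ , t) → w (g + t) ⊗ S [] (down a g ∷ α′)} (λ (_ , t) → ℤ.*-zeroʳ (w (g + t)))) ⟨
    shifts down M (a ∷ α) (λ α′ t → w t ⊗ S [] α′) ∎
    where open ≡-Reasoning
  shifts-S M (a ∷ α) (b ∷ bs) w = begin
    shifts up M (b ∷ bs) (λ ys t → w t ⊗ S ys (a ∷ α))
      ≡⟨ shifts-up-cong M (b ∷ bs) unfold ⟩
    shifts up M (b ∷ bs) (λ ys t → J ys (φ t))
      ≡⟨ J-shifts M b bs φ φ-alt ⟩
    Σ< M (λ g → J (b ∷ bs) (λ c → shifts up M c (λ ys t → φ (g + t) ys)))
      ≡⟨ Σ<-cong M (λ {g} _ → trans (J-linear (b ∷ bs) .cong-≗ (inner g))
           (shifts-swap (J-linear (b ∷ bs)) down M α _)) ⟩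
    Σ< M (λ g → shifts down M α (λ α′ t → J (b ∷ bs) (λ c → w (g + t) ⊗ (κ g c ⊗ S c α′))))
      ≡⟨ Σ<-cong M (λ {g} _ → shifts-cong down M α (λ α′ t → J-linear (b ∷ bs) .scale (w (g + t)) _)) ⟩
    shifts down M (a ∷ α) (λ α′ t → w t ⊗ S (b ∷ bs) α′) ∎
    where
    open ≡-Reasoning
    m = sum (b ∷ bs)
    φ : ℕ → List ℕ → ℤ
    φ t c = w t ⊗ (𝟙 (+ (m + r * t) ℤ.≟ + (sum c + length c) ⊕ a) ⊗ S c α)
    κ : ℕ → List ℕ → ℤ
    κ g c = 𝟙 (+ m ℤ.≟ + (sum c + length c) ⊕ down a g)
    φ-alt : ∀ t → Alternating (φ t)
    φ-alt t = alternating-⊗ (λ _ → w t) (λ _ _ _ _ → refl) (weighted-alternating (m + r * t) a α)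
    unfold : ∀ ys t → sum ys ≡ sum (b ∷ bs) + r * t → length ys ≡ length (b ∷ bs) →
             w t ⊗ S ys (a ∷ α) ≡ J ys (φ t)
    unfold ys t p _ = trans (cong (w t ⊗_)
      (trans (S-∷ ys a α) (cong (λ m → J ys (λ c → 𝟙 (+ m ℤ.≟ + (sum c + length c) ⊕ a) ⊗ S c α)) p)))
      (sym (J-linear ys .scale (w t) _))
    inner : ∀ g c → shifts up M c (λ ys t → φ (g + t) ys) ≡
                    shifts down M α (λ α′ t → w (g + t) ⊗ (κ g c ⊗ S c α′))
    inner g c = begin
      shifts up M c (λ ys t → φ (g + t) ys)
        ≡⟨ shifts-up-cong M c (λ ys t p q → trans
             (cong (λ k → w (g + t) ⊗ (k ⊗ S ys α)) (shifted t ys p q)) (⊗-exchange (w (g + t)) (κ g c) _)) ⟩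
      shifts up M c (λ ys t → κ g c ⊗ (w (g + t) ⊗ S ys α))
        ≡⟨ shifts-linear up M c .scale (κ g c) (λ (ys , t) → w (g + t) ⊗ S ys α) ⟩
      κ g c ⊗ shifts up M c (λ ys t → w (g + t) ⊗ S ys α)
        ≡⟨ cong (κ g c ⊗_) (shifts-S M α c (λ t → w (g + t))) ⟩
      κ g c ⊗ shifts down M α (λ α′ t → w (g + t) ⊗ S c α′)
        ≡⟨ shifts-linear down M α .scale (κ g c) (λ (α′ , t) → w (g + t) ⊗ S c α′) ⟨
      shifts down M α (λ α′ t → κ g c ⊗ (w (g + t) ⊗ S c α′))
        ≡⟨ shifts-cong down M α (λ α′ t → ⊗-exchange (κ g c) (w (g + t)) (S c α′)) ⟩
      shifts down M α (λ α′ t → w (g + t) ⊗ (κ g c ⊗ S c α′)) ∎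
      where
      -- The `t` steps of the interlacing list raise both sides of the degree condition by `r * t`
      -- and cancel. What is left over is `r * g`, which is taken from `a`.
      shifted : ∀ t ys → sum ys ≡ sum c + r * t → length ys ≡ length c →
                𝟙 (+ (m + r * (g + t)) ℤ.≟ + (sum ys + length ys) ⊕ a) ≡ κ g c
      shifted t ys p q rewrite p | q =
        𝟙-cong (_ ℤ.≟ _) (+ m ℤ.≟ + (sum c + length c) ⊕ down a g)
          (λ e → ⊕-cancelʳ k (+ m) (+ (sum c + length c) ⊕ down a g) (trans (sym eqˡ) (trans e eqʳ)))
          (λ e → trans eqˡ (trans (cong (_⊕ k) e) (sym eqʳ)))
        where
        k = + (r * g + r * t)
        eqˡ : + (m + r * (g + t)) ≡ + m ⊕ k
        eqˡ = cong (λ u → + (m + u)) (ℕ.*-distribˡ-+ r g t)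
        rearrange : ∀ s l a u v → ((s ⊕ v) ⊕ l) ⊕ a ≡ ((s ⊕ l) ⊕ (a ⊝ u)) ⊕ (u ⊕ v)
        rearrange = solve-∀
        eqʳ : + ((sum c + r * t) + length c) ⊕ a ≡ (+ (sum c + length c) ⊕ down a g) ⊕ k
        eqʳ = rearrange (+ sum c) (+ length c) a (+ (r * g)) (+ (r * t))

-- Strictly decreasing lists and determinants

alternating-repeat : ∀ {φ} → Alternating φ → ∀ {x xs} → x ∈ xs → φ (x ∷ xs) ≡ 0ℤ
alternating-repeat alt {x} {_ ∷ ys} (here refl) = self-negative⇒0 _ (alt .transpose [] x x ys)
alternating-repeat alt {x} {y ∷ ys} (there x∈ys) =
  trans (alt .transpose [] x y ys) (cong -_ (alternating-repeat (alternating-∷ alt y) x∈ys))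

decreasing : ℕ → ℕ → List (List ℕ)
decreasing zero    _       = [] ∷ []
decreasing (suc n) zero    = []
decreasing (suc n) (suc Y) = map (Y ∷_) (decreasing n Y) ++ decreasing (suc n) Y

pick : List ℕ → (ℕ → List ℕ → ℤ) → ℤ
pick []       G = 0ℤ
pick (y ∷ ys) G = G y ys ⊕ pick ys λ z zs → G z (y ∷ zs)

signedPick : List ℕ → (ℕ → List ℕ → ℤ) → ℤ
signedPick []       G = 0ℤ
signedPick (y ∷ ys) G = G y ys ⊝ signedPick ys λ z zs → G z (y ∷ zs)

-- Laplace expansion along the first row of the matrix with entries `f x`. The columns are indexed
-- by values rather than positions, so changing one entry of the list changes exactly one column.
det : List (ℕ → ℤ) → List ℕ → ℤ
det []       []      = 1ℤ
det []       (_ ∷ _) = 0ℤ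
det (f ∷ fs) xs      = signedPick xs λ y ys → f y ⊗ det fs ys

pick-cong : ∀ ys {G H : ℕ → List ℕ → ℤ} → (∀ z zs → G z zs ≡ H z zs) → pick ys G ≡ pick ys H
pick-cong []       e = refl
pick-cong (y ∷ ys) e = cong₂ _⊕_ (e y ys) (pick-cong ys (λ z zs → e z (y ∷ zs)))

pick-neg : ∀ ys (G : ℕ → List ℕ → ℤ) → pick ys (λ z zs → - G z zs) ≡ - pick ys G
pick-neg []       G = refl
pick-neg (y ∷ ys) G =
  trans (⊕-congˡ (- G y ys) (pick-neg ys (λ z zs → G z (y ∷ zs))))
        (sym (ℤ.neg-distrib-+ (G y ys) _))

-- Moving the picked entry to the front of the argument of `φ` passes the entries before it, one
-- sign each, and these are the signs in `signedPick`.
signedPick-alternating : ∀ ys G {φ} → Alternating φ →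
  signedPick ys G ⊗ φ ys ≡ pick ys λ z zs → G z zs ⊗ φ (z ∷ zs)
signedPick-alternating [] G alt = refl
signedPick-alternating (y ∷ ys) G {φ} alt = begin
  (G y ys ⊝ signedPick ys G′) ⊗ φ (y ∷ ys)
    ≡⟨ distrib (G y ys) (signedPick ys G′) (φ (y ∷ ys)) ⟩
  G y ys ⊗ φ (y ∷ ys) ⊕ - (signedPick ys G′ ⊗ φ (y ∷ ys))
    ≡⟨ cong (λ u → G y ys ⊗ φ (y ∷ ys) ⊕ - u) (signedPick-alternating ys G′ (alternating-∷ alt y)) ⟩
  G y ys ⊗ φ (y ∷ ys) ⊕ - pick ys (λ z zs → G z (y ∷ zs) ⊗ φ (y ∷ z ∷ zs))
    ≡⟨ cong (G y ys ⊗ φ (y ∷ ys) ⊕_) (pick-neg ys _) ⟨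
  G y ys ⊗ φ (y ∷ ys) ⊕ pick ys (λ z zs → - (G z (y ∷ zs) ⊗ φ (y ∷ z ∷ zs)))
    ≡⟨ cong (G y ys ⊗ φ (y ∷ ys) ⊕_) (pick-cong ys (λ z zs →
         trans (ℤ.neg-distribʳ-* (G z (y ∷ zs)) (φ (y ∷ z ∷ zs)))
               (cong (G z (y ∷ zs) ⊗_) (sym (alt .transpose [] z y zs))))) ⟩
  G y ys ⊗ φ (y ∷ ys) ⊕ pick ys (λ z zs → G z (y ∷ zs) ⊗ φ (z ∷ y ∷ zs)) ∎
  where
  open ≡-Reasoning
  G′ : ℕ → List ℕ → ℤ
  G′ z zs = G z (y ∷ zs)
  distrib : ∀ a b c → (a ⊝ b) ⊗ c ≡ a ⊗ c ⊕ - (b ⊗ c)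
  distrib = solve-∀

-- An entry x together with a strictly decreasing list not containing x is the
-- same as a strictly decreasing list with a distinguished entry.
∑-decreasing-pick : ∀ Y n (G : ℕ → List ℕ → ℤ) → (∀ {x xs} → x ∈ xs → G x xs ≡ 0ℤ) →
  Σ< Y (λ x → ∑ (decreasing n Y) (G x)) ≡ ∑ (decreasing (suc n) Y) λ ys → pick ys G
∑-decreasing-pick zero    n       G z = refl
∑-decreasing-pick (suc Y) zero    G z = begin
  Σ< Y (λ x → G x [] ⊕ 0ℤ) ⊕ (G Y [] ⊕ 0ℤ)
    ≡⟨ ℤ.+-comm _ (G Y [] ⊕ 0ℤ) ⟩
  (G Y [] ⊕ 0ℤ) ⊕ Σ< Y (λ x → G x [] ⊕ 0ℤ)
    ≡⟨ ⊕-congˡ (G Y [] ⊕ 0ℤ) (∑-decreasing-pick Y zero G z) ⟩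
  (G Y [] ⊕ 0ℤ) ⊕ ∑ (decreasing 1 Y) (λ ys → pick ys G) ∎
  where open ≡-Reasoning
∑-decreasing-pick (suc Y) (suc n) G z = begin
  Σ< Y (λ x → ∑ (map (Y ∷_) (decreasing n Y) ++ decreasing (suc n) Y) (G x)) ⊕
    ∑ (map (Y ∷_) (decreasing n Y) ++ decreasing (suc n) Y) (G Y)
    ≡⟨ cong₂ _⊕_ (Σ<-cong Y (λ {x} _ → split (G x))) (split (G Y)) ⟩
  Σ< Y (λ x → ∑ (decreasing n Y) (λ xs → G x (Y ∷ xs)) ⊕ ∑ (decreasing (suc n) Y) (G x)) ⊕
    (∑ (decreasing n Y) (λ xs → G Y (Y ∷ xs)) ⊕ ∑ (decreasing (suc n) Y) (G Y))
    ≡⟨ cong₂ _⊕_ (Σ<-linear Y .add _ _)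
         (⊕-congʳ (∑ (decreasing (suc n) Y) (G Y)) (∑-zero (decreasing n Y) (λ _ → z (here refl)))) ⟩
  (Σ< Y (λ x → ∑ (decreasing n Y) (λ xs → G x (Y ∷ xs))) ⊕ Σ< Y (λ x → ∑ (decreasing (suc n) Y) (G x))) ⊕
    (0ℤ ⊕ ∑ (decreasing (suc n) Y) (G Y))
    ≡⟨ cong₂ (λ u v → (u ⊕ v) ⊕ (0ℤ ⊕ ∑ (decreasing (suc n) Y) (G Y)))
         (∑-decreasing-pick Y n (λ x xs → G x (Y ∷ xs)) (λ x∈xs → z (there x∈xs)))
         (∑-decreasing-pick Y (suc n) G z) ⟩
  (∑ (decreasing (suc n) Y) (λ ys → pick ys G′) ⊕ ∑ (decreasing (suc (suc n)) Y) (λ ys → pick ys G)) ⊕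
    (0ℤ ⊕ ∑ (decreasing (suc n) Y) (G Y))
    ≡⟨ rearrange (∑ (decreasing (suc n) Y) (λ ys → pick ys G′)) _ (∑ (decreasing (suc n) Y) (G Y)) ⟩
  (∑ (decreasing (suc n) Y) (G Y) ⊕ ∑ (decreasing (suc n) Y) (λ ys → pick ys G′)) ⊕
    ∑ (decreasing (suc (suc n)) Y) (λ ys → pick ys G)
    ≡⟨ ⊕-congʳ _ (∑-linear (decreasing (suc n) Y) .add (G Y) (λ ys → pick ys G′)) ⟨
  ∑ (decreasing (suc n) Y) (λ ys → pick (Y ∷ ys) G) ⊕ ∑ (decreasing (suc (suc n)) Y) (λ ys → pick ys G)
    ≡⟨ ⊕-congʳ _ (∑-map (Y ∷_) (decreasing (suc n) Y) (λ ys → pick ys G)) ⟨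
  ∑ (map (Y ∷_) (decreasing (suc n) Y)) (λ ys → pick ys G) ⊕ ∑ (decreasing (suc (suc n)) Y) (λ ys → pick ys G)
    ≡⟨ ∑-++ (map (Y ∷_) (decreasing (suc n) Y)) _ _ ⟨
  ∑ (decreasing (suc (suc n)) (suc Y)) (λ ys → pick ys G) ∎
  where
  open ≡-Reasoning
  G′ : ℕ → List ℕ → ℤ
  G′ z zs = G z (Y ∷ zs)
  split : ∀ g → ∑ (map (Y ∷_) (decreasing n Y) ++ decreasing (suc n) Y) g ≡
                ∑ (decreasing n Y) (λ xs → g (Y ∷ xs)) ⊕ ∑ (decreasing (suc n) Y) g
  split g = trans (∑-++ (map (Y ∷_) (decreasing n Y)) _ g) (⊕-congʳ _ (∑-map (Y ∷_) (decreasing n Y) g))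
  rearrange : ∀ a b c → (a ⊕ b) ⊕ (0ℤ ⊕ c) ≡ (c ⊕ a) ⊕ b
  rearrange = solve-∀

weightedSum : List (ℕ → ℤ) → ℕ → (List ℕ → ℤ) → ℤ
weightedSum []       Y φ = φ []
weightedSum (f ∷ fs) Y φ = Σ< Y λ x → f x ⊗ weightedSum fs Y λ xs → φ (x ∷ xs)

weightedSum-zero : ∀ fs Y {φ} → (∀ xs → φ xs ≡ 0ℤ) → weightedSum fs Y φ ≡ 0ℤ
weightedSum-zero []       Y z = z []
weightedSum-zero (f ∷ fs) Y z = Σ<-zero Y (λ {x} _ →
  trans (cong (f x ⊗_) (weightedSum-zero fs Y (λ xs → z (x ∷ xs)))) (ℤ.*-zeroʳ (f x)))

-- Lists with a repeated entry contribute zero and every other list is a rearrangement of one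
-- strictly decreasing list. The signs of the rearrangements, weighted by the `f x`, add up to the
-- determinant. In the induction only the first entry remains to be sorted in.
weightedSum-alternating : ∀ fs Y {φ} → Alternating φ →
  weightedSum fs Y φ ≡ ∑ (decreasing (length fs) Y) λ xs → det fs xs ⊗ φ xs
weightedSum-alternating [] Y {φ} alt = lemma (φ [])
  where
  lemma : ∀ x → x ≡ 1ℤ ⊗ x ⊕ 0ℤ
  lemma = solve-∀
weightedSum-alternating (f ∷ fs) Y {φ} alt = begin
  Σ< Y (λ x → f x ⊗ weightedSum fs Y (φ ∘ (x ∷_)))
    ≡⟨ Σ<-cong Y (λ {x} _ → trans (cong (f x ⊗_) (weightedSum-alternating fs Y (alternating-∷ alt x)))
         (trans (sym (∑-linear (decreasing (length fs) Y) .scale (f x) _))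
                (∑-cong-∈ (decreasing (length fs) Y) (λ {xs} _ → sym (ℤ.*-assoc (f x) (det fs xs) (φ (x ∷ xs))))))) ⟩
  Σ< Y (λ x → ∑ (decreasing (length fs) Y) (G x))
    ≡⟨ ∑-decreasing-pick Y (length fs) G (λ {x} {xs} x∈xs →
         trans (cong (f x ⊗ det fs xs ⊗_) (alternating-repeat alt x∈xs)) (ℤ.*-zeroʳ (f x ⊗ det fs xs))) ⟩
  ∑ (decreasing (suc (length fs)) Y) (λ ys → pick ys G)
    ≡⟨ ∑-cong-∈ (decreasing (suc (length fs)) Y) (λ {ys} _ → signedPick-alternating ys (λ x xs → f x ⊗ det fs xs) alt) ⟨
  ∑ (decreasing (suc (length fs)) Y) (λ xs → det (f ∷ fs) xs ⊗ φ xs) ∎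
  where
  open ≡-Reasoning
  G : ℕ → List ℕ → ℤ
  G x xs = f x ⊗ det fs xs ⊗ φ (x ∷ xs)

-- Moves by multiples of r as a determinant

reach : ℕ → ℕ → ℕ → ℤ
reach r b x = 𝟙 (b ℕ.≤? x ×-dec r ∣? (x ∸ b))

entry≤sum : ∀ {Y xs} → Any (Y ≤_) xs → Y ≤ sum xs
entry≤sum {xs = x ∷ xs} (here Y≤x) = ℕ.m≤n⇒m≤n+o (sum xs) Y≤x
entry≤sum {xs = x ∷ xs} (there p)  = ℕ.m≤n⇒m≤o+n x (entry≤sum p)

module _ (r : ℕ) .{{_ : NonZero r}} where

  -- The same bound serves for steps and for targets: since `r` is positive, a target `x < Y` is
  -- reached in at most `x` steps, and targets from `Y` on contribute nothing by the hypothesis on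
  -- `F`.
  Σ<-reach : ∀ Y b (F : ℕ → ℤ) → (∀ x → Y ≤ x → F x ≡ 0ℤ) →
             Σ< Y (λ g → F (up r b g)) ≡ Σ< Y (λ x → reach r b x ⊗ F x)
  Σ<-reach Y b F z = begin
    Σ< Y (λ g → F (up r b g))
      ≡⟨ Σ<-cong Y (λ {g} _ → sym (Σ<-𝟙≟ Y (up r b g) F (z _))) ⟩
    Σ< Y (λ g → Σ< Y λ x → 𝟙 (x ℕ.≟ up r b g) ⊗ F x)
      ≡⟨ Σ<-swap (Σ<-linear Y) Y (λ x g → 𝟙 (x ℕ.≟ up r b g) ⊗ F x) ⟩
    Σ< Y (λ x → Σ< Y λ g → 𝟙 (x ℕ.≟ up r b g) ⊗ F x)
      ≡⟨ Σ<-cong Y (λ {x} x<Y → trans (scaleʳ (Σ<-linear Y) (F x) _) (cong (_⊗ F x) (count x x<Y))) ⟩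
    Σ< Y (λ x → reach r b x ⊗ F x) ∎
    where
    open ≡-Reasoning
    count : ∀ x → x < Y → Σ< Y (λ g → 𝟙 (x ℕ.≟ up r b g)) ≡ reach r b x
    count x x<Y with b ℕ.≤? x ×-dec r ∣? (x ∸ b) in eq
    ... | no ¬reach = flip trans (cong (λ d → if does d then 1ℤ else 0ℤ) (sym eq)) $ Σ<-zero Y (λ {g} _ → 𝟙-no (x ℕ.≟ up r b g) (λ e →
            ¬reach (subst (b ≤_) (sym e) (ℕ.m≤m+n b (r * g)) ,
                    divides g (trans (cong (_∸ b) e) (trans (ℕ.m+n∸m≡n b (r * g)) (ℕ.*-comm r g))))))
    ... | yes (b≤x , divides q x∸b≡q*r) = flip trans (cong (λ d → if does d then 1ℤ else 0ℤ) (sym eq)) $ begin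
      Σ< Y (λ g → 𝟙 (x ℕ.≟ up r b g))
        ≡⟨ Σ<-cong Y (λ {g} _ → trans (𝟙-cong (x ℕ.≟ up r b g) (g ℕ.≟ q) (to g) (from g)) (sym (ℤ.*-identityʳ _))) ⟩
      Σ< Y (λ g → 𝟙 (g ℕ.≟ q) ⊗ 1ℤ)
        ≡⟨ Σ<-𝟙≟ Y q (λ _ → 1ℤ) (λ Y≤q → contradiction x<Y (ℕ.≤⇒≯ (ℕ.≤-trans Y≤q q≤x))) ⟩
      1ℤ ∎
      where
      x≡ : x ≡ up r b q
      x≡ = trans (sym (ℕ.m+[n∸m]≡n b≤x)) (cong (_+_ b) (trans x∸b≡q*r (ℕ.*-comm q r)))
      to : ∀ g → x ≡ up r b g → g ≡ q
      to g e = ℕ.*-cancelˡ-≡ g q r (ℕ.+-cancelˡ-≡ b _ _ (trans (sym e) x≡))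
      from : ∀ g → g ≡ q → x ≡ up r b g
      from g refl = x≡
      q≤x : q ≤ x
      q≤x = ℕ.≤-trans (ℕ.m≤n*m q r) (ℕ.≤-trans (ℕ.m≤n+m (r * q) b) (ℕ.≤-reflexive (sym x≡)))

  shifts-weightedSum : ∀ Y b {φ : List ℕ → ℤ} → (∀ {xs} → Any (Y ≤_) xs → φ xs ≡ 0ℤ) →
    shifts (up r) Y b (λ ys _ → φ ys) ≡ weightedSum (map (reach r) b) Y φ
  shifts-weightedSum Y []       z = refl
  shifts-weightedSum Y (b ∷ bs) {φ} z = trans
    (Σ<-cong Y (λ {g} _ → shifts-weightedSum Y bs (λ big → z (there big))))
    (Σ<-reach Y b (λ x → weightedSum (map (reach r) bs) Y (φ ∘ (x ∷_)))
      (λ x Y≤x → weightedSum-zero (map (reach r) bs) Y (λ _ → z (here Y≤x))))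

  -- A condition on the number of steps makes no sense after sorting, so it is first rewritten as a
  -- condition on the sum of the moved list, which is symmetric and hence compatible with
  -- alternation. The sum also bounds every entry, so that all surviving lists lie below `Y`.
  shifts-det : ∀ Y m b {φ} → Alternating φ → let N = sum b + r * m in N < Y →
    shifts (up r) Y b (λ ys t → 𝟙 (t ℕ.≟ m) ⊗ φ ys) ≡
    ∑ (decreasing (length b) Y) λ xs → det (map (reach r) b) xs ⊗ (𝟙 (sum xs ℕ.≟ N) ⊗ φ xs)
  shifts-det Y m b {φ} alt N<Y = begin
    shifts (up r) Y b (λ ys t → 𝟙 (t ℕ.≟ m) ⊗ φ ys)
      ≡⟨ shifts-up-cong r Y b (λ ys t e _ → cong (_⊗ φ ys)
           (𝟙-cong (t ℕ.≟ m) (sum ys ℕ.≟ N)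
             (λ t≡m → trans e (cong (λ u → sum b + r * u) t≡m))
             (λ e′ → ℕ.*-cancelˡ-≡ t m r (ℕ.+-cancelˡ-≡ (sum b) _ _ (trans (sym e) e′))))) ⟩
    shifts (up r) Y b (λ ys _ → 𝟙 (sum ys ℕ.≟ N) ⊗ φ ys)
      ≡⟨ shifts-weightedSum Y b (λ {xs} big → 𝟙-⊗-no (sum xs ℕ.≟ N)
           (λ e → ℕ.<⇒≱ N<Y (subst (Y ≤_) e (entry≤sum big)))) ⟩
    weightedSum (map (reach r) b) Y (λ xs → 𝟙 (sum xs ℕ.≟ N) ⊗ φ xs)
      ≡⟨ weightedSum-alternating (map (reach r) b) Y
           (alternating-⊗ (λ xs → 𝟙 (sum xs ℕ.≟ N))
             (λ ws x y zs → cong (λ u → 𝟙 (u ℕ.≟ N)) (sum-swap ws x y zs)) alt) ⟩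
    ∑ (decreasing (length (map (reach r) b)) Y) (λ xs → det (map (reach r) b) xs ⊗ (𝟙 (sum xs ℕ.≟ N) ⊗ φ xs))
      ≡⟨ cong (λ n → ∑ (decreasing n Y) (λ xs → det (map (reach r) b) xs ⊗ (𝟙 (sum xs ℕ.≟ N) ⊗ φ xs)))
           (List.length-map (reach r) b) ⟩
    ∑ (decreasing (length b) Y) (λ xs → det (map (reach r) b) xs ⊗ (𝟙 (sum xs ℕ.≟ N) ⊗ φ xs)) ∎
    where
    open ≡-Reasoning
    N = sum b + r * m

-- Column operations and vanishing of determinants

signedPick-cong : ∀ ys {G H : ℕ → List ℕ → ℤ} → (∀ z zs → G z zs ≡ H z zs) →
                  signedPick ys G ≡ signedPick ys H
signedPick-cong []       e = refl
signedPick-cong (y ∷ ys) e = cong₂ _⊝_ (e y ys) (signedPick-cong ys (λ z zs → e z (y ∷ zs)))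

signedPick-neg : ∀ ys (G : ℕ → List ℕ → ℤ) → signedPick ys (λ z zs → - G z zs) ≡ - signedPick ys G
signedPick-neg []       G = refl
signedPick-neg (y ∷ ys) G =
  trans (cong (λ u → - G y ys ⊝ u) (signedPick-neg ys (λ z zs → G z (y ∷ zs))))
        (lemma (G y ys) _)
  where
  lemma : ∀ a b → - a ⊝ - b ≡ - (a ⊝ b)
  lemma = solve-∀

signedPick-swap : ∀ ws x y zs {G : ℕ → List ℕ → ℤ} → (∀ z → Alternating (G z)) →
  signedPick (ws ++ x ∷ y ∷ zs) G ≡ - signedPick (ws ++ y ∷ x ∷ zs) G
signedPick-swap [] x y zs {G} alt =
  trans (cong (λ u → G x (y ∷ zs) ⊝ (G y (x ∷ zs) ⊝ u))
          (trans (signedPick-cong zs (λ z zs → alt z .transpose [] x y zs)) (signedPick-neg zs _)))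
        (lemma (G x (y ∷ zs)) (G y (x ∷ zs)) _)
  where
  lemma : ∀ a b c → a ⊝ (b ⊝ - c) ≡ - (b ⊝ (a ⊝ c))
  lemma = solve-∀
signedPick-swap (w ∷ ws) x y zs {G} alt =
  trans (cong₂ _⊝_ (alt w .transpose ws x y zs)
                   (signedPick-swap ws x y zs (λ z → alternating-∷ (alt z) w)))
        (lemma (G w (ws ++ y ∷ x ∷ zs)) _)
  where
  lemma : ∀ a b → - a ⊝ - b ≡ - (a ⊝ b)
  lemma = solve-∀

det-alternating : ∀ fs → Alternating (det fs)
det-alternating []       .transpose []      x y zs = refl
det-alternating []       .transpose (_ ∷ _) x y zs = refl
det-alternating (f ∷ fs) .transpose ws x y zs =
  signedPick-swap ws x y zs (λ z → alternating-⊗ (λ _ → f z) (λ _ _ _ _ → refl) (det-alternating fs))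

signedPick-replace : ∀ ws x y zs {G : ℕ → List ℕ → ℤ} →
  (∀ zs → G x zs ≡ G y zs) → (∀ z ws zs → G z (ws ++ x ∷ zs) ≡ G z (ws ++ y ∷ zs)) →
  signedPick (ws ++ x ∷ zs) G ≡ signedPick (ws ++ y ∷ zs) G
signedPick-replace []       x y zs e e′ = cong₂ _⊝_ (e zs) (signedPick-cong zs (λ z zs → e′ z [] zs))
signedPick-replace (w ∷ ws) x y zs e e′ =
  cong₂ _⊝_ (e′ w ws zs)
    (signedPick-replace ws x y zs (λ zs → e (w ∷ zs)) (λ z ws zs → e′ z (w ∷ ws) zs))

det-replace : ∀ fs ws x y zs → All (λ f → f x ≡ f y) fs →
              det fs (ws ++ x ∷ zs) ≡ det fs (ws ++ y ∷ zs)
det-replace []       []      x y zs []       = refl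
det-replace []       (_ ∷ _) x y zs []       = refl
det-replace (f ∷ fs) ws      x y zs (e ∷ es) =
  signedPick-replace ws x y zs (λ zs → cong (_⊗ det fs zs) e)
    (λ z ws zs → cong (f z ⊗_) (det-replace fs ws x y zs es))

data Picked : List ℕ → ℕ → List ℕ → Set where
  here  : ∀ {y ys} → Picked (y ∷ ys) y ys
  there : ∀ {y ys z zs} → Picked ys z zs → Picked (y ∷ ys) z (y ∷ zs)

signedPick-zero : ∀ ys {G : ℕ → List ℕ → ℤ} → (∀ {z zs} → Picked ys z zs → G z zs ≡ 0ℤ) →
                  signedPick ys G ≡ 0ℤ
signedPick-zero []       e = refl
signedPick-zero (y ∷ ys) e = cong₂ _⊝_ (e here) (signedPick-zero ys (λ p → e (there p)))

picked-column : ∀ ws x zs {y ys} → Picked (ws ++ x ∷ zs) y ys →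
                y ≡ x ⊎ ∃[ ws′ ] ∃[ zs′ ] ys ≡ ws′ ++ x ∷ zs′
picked-column []       x zs here      = inj₁ refl
picked-column []       x zs (there {zs = ys} p) = inj₂ ([] , ys , refl)
picked-column (w ∷ ws) x zs here      = inj₂ (ws , zs , refl)
picked-column (w ∷ ws) x zs (there p) with picked-column ws x zs p
... | inj₁ e               = inj₁ e
... | inj₂ (ws′ , zs′ , e) = inj₂ (w ∷ ws′ , zs′ , cong (w ∷_) e)

det-zero-column : ∀ fs ws x zs → All (λ f → f x ≡ 0ℤ) fs → det fs (ws ++ x ∷ zs) ≡ 0ℤ
det-zero-column []       []      x zs [] = refl
det-zero-column []       (_ ∷ _) x zs [] = refl
det-zero-column (f ∷ fs) ws      x zs (e ∷ es) = signedPick-zero (ws ++ x ∷ zs) zero-term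
  where
  zero-term : ∀ {y ys} → Picked (ws ++ x ∷ zs) y ys → f y ⊗ det fs ys ≡ 0ℤ
  zero-term {y} {ys} p with picked-column ws x zs p
  ... | inj₁ refl               = cong (_⊗ det fs ys) e
  ... | inj₂ (ws′ , zs′ , refl) = trans (cong (f y ⊗_) (det-zero-column fs ws′ x zs′ es)) (ℤ.*-zeroʳ (f y))

picked-All : ∀ {ys z zs} {R : ℕ → Set} → Picked ys z zs → All R ys → R z × All R zs
picked-All here      (r ∷ rs) = r , rs
picked-All (there p) (r ∷ rs) = let r′ , rs′ = picked-All p rs in r′ , r ∷ rs′

Decreasing : List ℕ → Set
Decreasing = AllPairs _>_

picked-Decreasing : ∀ {ys z zs} → Picked ys z zs → Decreasing ys → Decreasing zs
picked-Decreasing here      (_ ∷ ds) = ds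
picked-Decreasing (there p) (d ∷ ds) = proj₂ (picked-All p d) ∷ picked-Decreasing p ds

data Exceeds : List ℕ → List ℕ → Set where
  here  : ∀ {b bs x xs} → x < b → Exceeds (b ∷ bs) (x ∷ xs)
  there : ∀ {b bs x xs} → Exceeds bs xs → Exceeds (b ∷ bs) (x ∷ xs)

-- Let the excess be at position i. An entry picked at or after position i is at most the i-th entry
-- of `xs`, hence below the i-th entry of `b ∷ bs` and so below `b`. If the pick is before position
-- i, deleting it and deleting `b` shifts the excess by one in both lists.
picked-Exceeds : ∀ {b bs xs z zs} → Decreasing (b ∷ bs) → Decreasing xs →
                 Exceeds (b ∷ bs) xs → Picked xs z zs → z < b ⊎ Exceeds bs zs
picked-Exceeds db (d ∷ dx) (here x<b) here      = inj₁ x<b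
picked-Exceeds db (d ∷ dx) (here x<b) (there p) = inj₁ (ℕ.<-trans (proj₁ (picked-All p d)) x<b)
picked-Exceeds db dx (there e) here = inj₂ e
picked-Exceeds {bs = _ ∷ _} ((b′<b ∷ _) ∷ db) (d ∷ dx) (there e) (there p) with picked-Exceeds db dx e p
... | inj₁ z<b′ = inj₁ (ℕ.<-trans z<b′ b′<b)
... | inj₂ e′   = inj₂ (there e′)

module _ (r : ℕ) .{{_ : NonZero r}} where

  reach-< : ∀ {b x} → x < b → reach r b x ≡ 0ℤ
  reach-< {b} {x} x<b = 𝟙-no (b ℕ.≤? x ×-dec r ∣? (x ∸ b)) (λ (b≤x , _) → ℕ.<⇒≱ x<b b≤x)

  reach-≡ : ∀ b → reach r b b ≡ 1ℤ
  reach-≡ b = 𝟙-yes (b ℕ.≤? b ×-dec r ∣? (b ∸ b)) (ℕ.≤-refl , subst (r ∣_) (sym (ℕ.n∸n≡0 b)) (r ∣0))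

  small-multiple : ∀ {k} → k < r → r ∣ k → k ≡ 0
  small-multiple {zero}  _   _   = refl
  small-multiple {suc k} k<r r∣k = contradiction (∣⇒≤ r∣k) (ℕ.<⇒≱ k<r)

  reach-small : ∀ {b x} → x < r → b ≢ x → reach r b x ≡ 0ℤ
  reach-small {b} {x} x<r b≢x = 𝟙-no (b ℕ.≤? x ×-dec r ∣? (x ∸ b)) (λ (b≤x , r∣) →
    b≢x (ℕ.≤-antisym b≤x (ℕ.m∸n≡0⇒m≤n (small-multiple (ℕ.≤-<-trans (ℕ.m∸n≤m x b) x<r) r∣))))

  -- The two sides could differ only for `y < b ≤ r + y`. Then `r + y ∸ b` is below `r`, so it is a
  -- multiple of `r` only when `b` equals `r + y`.
  reach-+ : ∀ b y → b ≢ r + y → reach r b (r + y) ≡ reach r b y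
  reach-+ b y b≢ = 𝟙-cong (b ℕ.≤? r + y ×-dec r ∣? (r + y ∸ b)) (b ℕ.≤? y ×-dec r ∣? (y ∸ b)) to from
    where
    to : b ≤ r + y × r ∣ r + y ∸ b → b ≤ y × r ∣ y ∸ b
    to (b≤r+y , r∣) with b ℕ.≤? y
    ... | yes b≤y = b≤y , ∣m+n∣m⇒∣n (subst (r ∣_) (ℕ.+-∸-assoc r b≤y) r∣) ∣-refl
    ... | no  b≰y = contradiction (ℕ.≤-antisym b≤r+y (ℕ.m∸n≡0⇒m≤n (small-multiple small r∣))) b≢
      where
      small : r + y ∸ b < r
      small = ℕ.m<n+o⇒m∸n<o (r + y) b (subst (r + y <_) (ℕ.+-comm r b) (ℕ.+-monoʳ-< r (ℕ.≰⇒> b≰y)))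
    from : b ≤ y × r ∣ y ∸ b → b ≤ r + y × r ∣ r + y ∸ b
    from (b≤y , r∣) = ℕ.m≤n⇒m≤o+n r b≤y , subst (r ∣_) (sym (ℕ.+-∸-assoc r b≤y)) (∣m∣n⇒∣m+n ∣-refl r∣)

  -- All columns after the first belong to values below the leading bead, which it cannot reach; the
  -- matrix is triangular with ones on the diagonal.
  det-diagonal : ∀ {b} → Decreasing b → det (map (reach r) b) b ≡ 1ℤ
  det-diagonal {[]}     _        = refl
  det-diagonal {b ∷ bs} (d ∷ ds) = cong₂ _⊝_
    (cong₂ _⊗_ (reach-≡ b) (det-diagonal ds))
    (signedPick-zero bs (λ {z} {zs} p →
      cong (_⊗ det (map (reach r) bs) (b ∷ zs)) (reach-< (proj₁ (picked-All p d)))))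

  det-Exceeds : ∀ {b x} → Decreasing b → Decreasing x → Exceeds b x → det (map (reach r) b) x ≡ 0ℤ
  det-Exceeds {b ∷ bs} {x} db@(_ ∷ dbs) dx e = signedPick-zero x zero-term
    where
    zero-term : ∀ {z zs} → Picked x z zs → reach r b z ⊗ det (map (reach r) bs) zs ≡ 0ℤ
    zero-term {z} {zs} p with picked-Exceeds db dx e p
    ... | inj₁ z<b = cong (_⊗ det (map (reach r) bs) zs) (reach-< z<b)
    ... | inj₂ e′  = trans (cong (reach r b z ⊗_) (det-Exceeds dbs (picked-Decreasing p dx) e′))
                           (ℤ.*-zeroʳ (reach r b z))

  det-lower : ∀ bs ws y zs → All (_≢ r + y) bs →
              det (map (reach r) bs) (ws ++ r + y ∷ zs) ≡ det (map (reach r) bs) (ws ++ y ∷ zs)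
  det-lower bs ws y zs ≢s = det-replace (map (reach r) bs) ws (r + y) y zs
    (All⁺.map⁺ (All.map (λ {b} → reach-+ b y) ≢s))

  det-small : ∀ bs ws x zs → x < r → All (_≢ x) bs → det (map (reach r) bs) (ws ++ x ∷ zs) ≡ 0ℤ
  det-small bs ws x zs x<r ≢s = det-zero-column (map (reach r) bs) ws x zs
    (All⁺.map⁺ (All.map (reach-small x<r) ≢s))

alternating-++ : ∀ {φ} ws → Alternating φ → Alternating (λ xs → φ (ws ++ xs))
alternating-++ []       alt = alt
alternating-++ (w ∷ ws) alt = alternating-++ ws (alternating-∷ alt w)

alternating-move : ∀ {φ} → Alternating φ → ∀ y ws zs →
                   φ (y ∷ ws ++ zs) ≡ -1ℤ ℤ.^ length ws ⊗ φ (ws ++ y ∷ zs)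
alternating-move {φ} alt y []       zs = sym (ℤ.*-identityˡ (φ (y ∷ zs)))
alternating-move {φ} alt y (w ∷ ws) zs = begin
  φ (y ∷ w ∷ ws ++ zs)                            ≡⟨ alt .transpose [] y w (ws ++ zs) ⟩
  - φ (w ∷ y ∷ ws ++ zs)                          ≡⟨ cong -_ (alternating-move (alternating-∷ alt w) y ws zs) ⟩
  - (-1ℤ ℤ.^ length ws ⊗ φ (w ∷ ws ++ y ∷ zs))    ≡⟨ ℤ.neg-distribˡ-* (-1ℤ ℤ.^ length ws) _ ⟩
  - (-1ℤ ℤ.^ length ws) ⊗ φ (w ∷ ws ++ y ∷ zs)    ≡⟨ cong (_⊗ φ (w ∷ ws ++ y ∷ zs)) (ℤ.-1*i≡-i (-1ℤ ℤ.^ length ws)) ⟨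
  -1ℤ ⊗ -1ℤ ℤ.^ length ws ⊗ φ (w ∷ ws ++ y ∷ zs)  ∎
  where open ≡-Reasoning

-- Beads

-- The first n parts of a partition, given as a function, made strictly
-- decreasing by adding n - 1, …, 1, 0.
beads : ℕ → (ℕ → ℕ) → List ℕ
beads zero    p = []
beads (suc n) p = p 0 + n ∷ beads n (p ∘ suc)

WeaklyDecreasing : (ℕ → ℕ) → Set
WeaklyDecreasing p = ∀ i → p (suc i) ≤ p i

weaklyDecreasing-≤ : ∀ {p} → WeaklyDecreasing p → ∀ {i j} → i ≤ j → p j ≤ p i
weaklyDecreasing-≤ {p} w {i} {j} i≤j = subst (λ k → p k ≤ p i) (ℕ.m∸n+n≡m i≤j) (go (j ∸ i))
  where
  go : ∀ k → p (k + i) ≤ p i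
  go zero    = ℕ.≤-refl
  go (suc k) = ℕ.≤-trans (w (k + i)) (go k)

length-beads : ∀ n p → length (beads n p) ≡ n
length-beads zero    p = refl
length-beads (suc n) p = cong suc (length-beads n (p ∘ suc))

beads-cong : ∀ n {p q} → (∀ {i} → i < n → p i ≡ q i) → beads n p ≡ beads n q
beads-cong zero    e = refl
beads-cong (suc n) e = cong₂ (λ a bs → a + n ∷ bs) (e z<s) (beads-cong n (λ i<n → e (s<s i<n)))

beads-∈ : ∀ n p {b} → b ∈ beads n p → ∃[ i ] i < n × b ≡ p i + (n ∸ suc i)
beads-∈ (suc n) p (here refl) = 0 , z<s , refl
beads-∈ (suc n) p (there b∈)  = let i , i<n , e = beads-∈ n (p ∘ suc) b∈ in suc i , s<s i<n , e

beads-Decreasing : ∀ n {p} → WeaklyDecreasing p → Decreasing (beads n p)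
beads-Decreasing zero    w = []
beads-Decreasing (suc n) {p} w = All.tabulate smaller ∷ beads-Decreasing n (w ∘ suc)
  where
  smaller : ∀ {b} → b ∈ beads n (p ∘ suc) → b < p 0 + n
  smaller b∈ with beads-∈ n (p ∘ suc) b∈
  ... | i , i<n , refl = ℕ.+-mono-≤-< (weaklyDecreasing-≤ {p} w z≤n)
                           (ℕ.∸-monoʳ-< {n} z<s i<n)

beads-Exceeds : ∀ {n p q i} → i < n → p i < q i → Exceeds (beads n q) (beads n p)
beads-Exceeds {suc n} {i = zero}  _         p<q = here (ℕ.+-monoˡ-< n p<q)
beads-Exceeds {suc n} {i = suc i} (s<s i<n) p<q = there (beads-Exceeds i<n p<q)

beads-split : ∀ n p d → d < n → ∃[ ws ]
              beads n p ≡ ws ++ p d + (n ∸ suc d) ∷ beads (n ∸ suc d) (λ i → p (suc d + i))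
beads-split (suc n) p zero    _         = [] , refl
beads-split (suc n) p (suc d) (s<s d<n) =
  let ws , e = beads-split n (p ∘ suc) d d<n in p 0 + n ∷ ws , cong (p 0 + n ∷_) e

-- The rows d, …, e of q are obtained from those of p by removing a border-strip.
record Strip (p q : ℕ → ℕ) (d e : ℕ) : Set where
  constructor strip
  field
    d≤e   : d ≤ e
    above : ∀ {i} → i < d → q i ≡ p i
    along : ∀ {i} → d ≤ i → i < e → suc (q i) ≡ p (suc i)
    end   : q e < p e
    below : ∀ {i} → e < i → q i ≡ p i

open Strip public

strip-< : ∀ {p q d e} → WeaklyDecreasing p → Strip p q d e → ∀ {i} → d ≤ i → i ≤ e → q i < p i
strip-< {p} w st {i} d≤i i≤e with ℕ.m≤n⇒m<n∨m≡n i≤e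
... | inj₁ i<e  = ℕ.≤-trans (ℕ.≤-reflexive (st .along d≤i i<e)) (w i)
... | inj₂ refl = st .end

strip-≤ : ∀ {p q d e} → WeaklyDecreasing p → Strip p q d e → ∀ i → q i ≤ p i
strip-≤ {d = d} {e} w st i with i ℕ.<? d | e ℕ.<? i
... | yes i<d | _       = ℕ.≤-reflexive (st .above i<d)
... | no _    | yes e<i = ℕ.≤-reflexive (st .below e<i)
... | no i≮d  | no e≮i  = ℕ.<⇒≤ (strip-< w st (ℕ.≮⇒≥ i≮d) (ℕ.≮⇒≥ e≮i))

-- A removed box of row `i` has column at least `q i`, so this inequality puts its lower right
-- neighbour outside the diagram: removed boxes lie in the rim.
strip-rim : ∀ {p q d e} → WeaklyDecreasing p → WeaklyDecreasing q → Strip p q d e →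
            ∀ i → p (suc i) ≤ suc (q i)
strip-rim {p} {q} {d} {e} w w′ st i with i ℕ.<? d | ℕ.<-cmp i e
... | yes i<d | _ = ℕ.m≤n⇒m≤1+n (ℕ.≤-trans (w i) (ℕ.≤-reflexive (sym (st .above i<d))))
... | no i≮d  | tri< i<e _ _  = ℕ.≤-reflexive (sym (st .along (ℕ.≮⇒≥ i≮d) i<e))
... | no _    | tri≈ _ refl _ = ℕ.m≤n⇒m≤1+n (ℕ.≤-trans (ℕ.≤-reflexive (sym (st .below (ℕ.n<1+n i)))) (w′ i))
... | no _    | tri> _ _ e<i  = ℕ.m≤n⇒m≤1+n (ℕ.≤-trans (w i) (ℕ.≤-reflexive (sym (st .below e<i))))

strip-tail : ∀ {p q e} → Strip p q 0 (suc e) → Strip (p ∘ suc) (q ∘ suc) 0 e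
strip-tail st = strip z≤n (λ ()) (λ _ i<e → st .along z≤n (s<s i<e)) (st .end) (λ e<i → st .below (s<s e<i))

strip-drop : ∀ {p q d e} → Strip p q (suc d) (suc e) → Strip (p ∘ suc) (q ∘ suc) d e
strip-drop st = strip (s≤s⁻¹ (st .d≤e)) (λ i<d → st .above (s<s i<d))
  (λ d≤i i<e → st .along (s≤s d≤i) (s<s i<e)) (st .end) (λ e<i → st .below (s<s e<i))

strip-beads-head : ∀ {n p q e} → Strip p q 0 e → e < suc n → ∃[ xs ] ∃[ zs ]
  beads (suc n) p ≡ p 0 + n ∷ xs ++ zs ×
  beads (suc n) q ≡ xs ++ q e + (n ∸ e) ∷ zs ×
  length xs ≡ e
strip-beads-head {n} {p} {q} {zero} st _ =
  [] , beads n (p ∘ suc) , refl , cong (q 0 + n ∷_) (beads-cong n (λ _ → st .below z<s)) , refl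
strip-beads-head {suc n} {p} {q} {suc e} st (s<s e<n) =
  let xs , zs , eq , eq′ , len = strip-beads-head (strip-tail st) e<n
  in p 1 + n ∷ xs , zs , cong (p 0 + suc n ∷_) eq ,
     cong₂ _∷_ (trans (ℕ.+-suc (q 0) n) (cong (_+ n) (st .along z≤n z<s))) eq′ , cong suc len

-- The field `along` says that bead `i` of `q` is bead `suc i` of `p`. Removing the strip therefore
-- takes out bead `d`, lets the next `e ∸ d` beads each advance by one place, and puts a smaller
-- bead at place `e`.
strip-beads : ∀ {n p q d e} → Strip p q d e → e < n → ∃[ ws ] ∃[ xs ] ∃[ zs ]
  beads n p ≡ ws ++ p d + (n ∸ suc d) ∷ xs ++ zs ×
  beads n q ≡ ws ++ xs ++ q e + (n ∸ suc e) ∷ zs ×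
  length xs ≡ e ∸ d
strip-beads {suc n} {d = zero} st e<n =
  let xs , zs , eqs = strip-beads-head st e<n in [] , xs , zs , eqs
strip-beads {suc n} {d = suc d} {zero} st _ with () ← st .d≤e
strip-beads {suc n} {p} {q} {suc d} {suc e} st (s<s e<n) =
  let ws , xs , zs , eq , eq′ , len = strip-beads (strip-drop st) e<n
  in p 0 + n ∷ ws , xs , zs , cong (p 0 + n ∷_) eq ,
     cong₂ _∷_ (cong (_+ n) (st .above z<s)) eq′ , len

sum-insert : ∀ ws x zs → sum (ws ++ x ∷ zs) ≡ x + sum (ws ++ zs)
sum-insert []       x zs = refl
sum-insert (w ∷ ws) x zs = trans (cong (_+_ w) (sum-insert ws x zs)) (+-exchange w x (sum (ws ++ zs)))

-- Both bead lists arise from `ws ++ xs ++ zs` by inserting one bead, so the size of the strip is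
-- the amount by which that bead is lowered.
strip-sum : ∀ {n p q d e} → Strip p q d e → e < n →
  sum (beads n p) + (q e + (n ∸ suc e)) ≡ p d + (n ∸ suc d) + sum (beads n q)
strip-sum {n} {p} {q} {d} {e} st e<n with strip-beads st e<n
... | ws , xs , zs , eq , eq′ , _ rewrite eq | eq′ = begin
  sum (ws ++ x ∷ xs ++ zs) + y         ≡⟨ cong (_+ y) (sum-insert ws x (xs ++ zs)) ⟩
  x + sum (ws ++ xs ++ zs) + y         ≡⟨ ℕ.+-assoc x _ y ⟩
  x + (sum (ws ++ xs ++ zs) + y)       ≡⟨ cong (_+_ x) (ℕ.+-comm _ y) ⟩
  x + (y + sum (ws ++ xs ++ zs))       ≡⟨ cong (λ l → x + (y + sum l)) (List.++-assoc ws xs zs) ⟨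
  x + (y + sum ((ws ++ xs) ++ zs))     ≡⟨ cong (_+_ x) (sum-insert (ws ++ xs) y zs) ⟨
  x + sum ((ws ++ xs) ++ y ∷ zs)       ≡⟨ cong (λ l → x + sum l) (List.++-assoc ws xs (y ∷ zs)) ⟩
  x + sum (ws ++ xs ++ y ∷ zs)         ∎
  where
  open ≡-Reasoning
  x = p d + (n ∸ suc d)
  y = q e + (n ∸ suc e)

-- The beads of `v` before place `d` are larger than bead `d` of `p`, and those from place `d` on
-- are smaller. This is the hypothesis under which `det-lower` may replace the column.
beads-avoid : ∀ {n p v d} → WeaklyDecreasing p → WeaklyDecreasing v → d < n →
              (∀ {i} → i < d → p i ≤ v i) → v d < p d → All (_≢ p d + (n ∸ suc d)) (beads n v)
beads-avoid {n} {p} {v} {d} wp wv d<n above excess = All.tabulate avoid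
  where
  avoid : ∀ {b} → b ∈ beads n v → b ≢ p d + (n ∸ suc d)
  avoid b∈ with beads-∈ n v b∈
  ... | i , i<n , refl with i ℕ.<? d
  ... | yes i<d = λ e → ℕ.<-irrefl (sym e) (ℕ.+-mono-≤-<
          (ℕ.≤-trans (weaklyDecreasing-≤ {p} wp (ℕ.<⇒≤ i<d)) (above i<d))
          (ℕ.∸-monoʳ-< {n} (s<s i<d) d<n))
  ... | no i≮d = λ e → ℕ.<-irrefl e (ℕ.+-mono-<-≤
          (ℕ.≤-<-trans (weaklyDecreasing-≤ {v} wv (ℕ.≮⇒≥ i≮d)) excess)
          (ℕ.∸-monoʳ-≤ n (s≤s (ℕ.≮⇒≥ i≮d))))

module _ (r : ℕ) .{{_ : NonZero r}} where

  det-strip : ∀ {n p q v d e} → WeaklyDecreasing p → WeaklyDecreasing v → Strip p q d e → e < n →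
    sum (beads n p) ≡ r + sum (beads n q) → (∀ {i} → i < d → p i ≤ v i) → v d < p d →
    det (map (reach r) (beads n v)) (beads n p) ≡
    -1ℤ ℤ.^ (e ∸ d) ⊗ det (map (reach r) (beads n v)) (beads n q)
  det-strip {n} {p} {q} {v} {d} {e} wp wv st e<n sums above excess
    with strip-beads st e<n | beads-avoid wp wv (ℕ.≤-<-trans (st .d≤e) e<n) above excess
  ... | ws , xs , zs , eq , eq′ , len | avoid = begin
    det b (beads n p)                              ≡⟨ cong (det b) (trans eq (cong (λ x → ws ++ x ∷ xs ++ zs) x≡r+y)) ⟩
    det b (ws ++ r + y ∷ xs ++ zs)                 ≡⟨ det-lower r (beads n v) ws y (xs ++ zs) (subst (λ x → All (_≢ x) (beads n v)) x≡r+y avoid) ⟩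
    det b (ws ++ y ∷ xs ++ zs)                     ≡⟨ alternating-move (alternating-++ ws (det-alternating b)) y xs zs ⟩
    -1ℤ ℤ.^ length xs ⊗ det b (ws ++ xs ++ y ∷ zs) ≡⟨ cong₂ (λ k bs → -1ℤ ℤ.^ k ⊗ det b bs) len (sym eq′) ⟩
    -1ℤ ℤ.^ (e ∸ d) ⊗ det b (beads n q)            ∎
    where
    open ≡-Reasoning
    b = map (reach r) (beads n v)
    y = q e + (n ∸ suc e)
    x≡r+y : p d + (n ∸ suc d) ≡ r + y
    x≡r+y = ℕ.+-cancelʳ-≡ (sum (beads n q)) _ _ (begin
      p d + (n ∸ suc d) + sum (beads n q)   ≡⟨ strip-sum st e<n ⟨
      sum (beads n p) + y                   ≡⟨ cong (_+ y) sums ⟩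
      r + sum (beads n q) + y               ≡⟨ lemma r (sum (beads n q)) y ⟩
      r + y + sum (beads n q)               ∎)
      where
      lemma : ∀ a b c → a + b + c ≡ a + c + b
      lemma = ℕS.solve-∀

-- Removing a strip by lowering a bead

consRow : ℕ → (ℕ → ℕ) → ℕ → ℕ
consRow a q zero    = a
consRow a q (suc i) = q i

consRow-WeaklyDecreasing : ∀ {a q} → WeaklyDecreasing q → q 0 ≤ a → WeaklyDecreasing (consRow a q)
consRow-WeaklyDecreasing w q0≤a zero    = q0≤a
consRow-WeaklyDecreasing w q0≤a (suc i) = w i

record Removal (n : ℕ) (p : ℕ → ℕ) (d y : ℕ) : Set where
  constructor removal
  field
    {result}   : ℕ → ℕ
    {bottom}   : ℕ
    isStrip    : Strip p result d bottom
    bottom<n   : bottom < n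
    isWeaklyDecreasing : WeaklyDecreasing result
    newBead    : result bottom + (n ∸ suc bottom) ≡ y

-- This is insertion into a sorted list. The next bead is one less than `p 1 + n`, so the test asks
-- whether it is below `y`. If it is, the strip ends in the first row. Otherwise the next bead takes
-- over the first place, which makes the first row `pred (p 1)`, and `y` is inserted further down.
-- When no beads are left, `p 1` is zero and the first alternative applies.
insertBead : ∀ n p y → WeaklyDecreasing p → (∀ {i} → n < i → p i ≡ 0) → y < p 0 + n →
             y ∉ beads n (p ∘ suc) → Removal (suc n) p 0 y
insertBead n p y w z y< y∉ with p 1 + n ℕ.≤? y
insertBead n p y w z y< y∉ | yes p₁+n≤y = removal
  (strip z≤n (λ ()) (λ _ ()) 
    (ℕ.+-cancelʳ-< n (y ∸ n) (p 0) (subst (_< p 0 + n) (sym (ℕ.m∸n+n≡m (ℕ.m+n≤o⇒n≤o (p 1) p₁+n≤y))) y<))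
    (λ { {suc i} _ → refl }))
  z<s
  (consRow-WeaklyDecreasing (w ∘ suc) (ℕ.m+n≤o⇒m≤o∸n (p 1) p₁+n≤y))
  (ℕ.m∸n+n≡m (ℕ.m+n≤o⇒n≤o (p 1) p₁+n≤y))
insertBead zero p y w z y< y∉ | no p₁+0≰y =
  contradiction (subst (λ a → a + 0 ≤ y) (sym (z z<s)) z≤n) p₁+0≰y
insertBead (suc n) p y w z y< y∉ | no p₁+n≰y
  with insertBead n (p ∘ suc) y (w ∘ suc) (λ n<i → z (s<s n<i)) y<′ (λ y∈ → y∉ (there y∈))
  where
  y<′ : y < p 1 + n
  y<′ = ℕ.≤∧≢⇒< (s≤s⁻¹ (subst (y <_) (ℕ.+-suc (p 1) n) (ℕ.≰⇒> p₁+n≰y))) (λ e → y∉ (here e))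
... | removal {q} {e} st e<n wq new = removal
  (strip z≤n (λ ()) along′ (st .end) (λ { {suc i} (s<s e<i) → st .below e<i }))
  (s<s e<n)
  (consRow-WeaklyDecreasing wq (ℕ.≤-pred (subst (q 0 <_) (sym p₁≡) q₀<p₁)))
  new
  where
  q₀<p₁ : q 0 < p 1
  q₀<p₁ = strip-< (w ∘ suc) st z≤n z≤n
  p₁≡ : suc (pred (p 1)) ≡ p 1
  p₁≡ = ℕ.suc-pred (p 1) {{>-nonZero (ℕ.≤-<-trans z≤n q₀<p₁)}}
  along′ : ∀ {i} → 0 ≤ i → i < suc e → suc (consRow (pred (p 1)) q i) ≡ p (suc i)
  along′ {zero}  _ _         = p₁≡
  along′ {suc i} _ (s<s i<e) = st .along z≤n i<e

removeStrip : ∀ n p d y → WeaklyDecreasing p → (∀ {i} → n ≤ i → p i ≡ 0) → d < n →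
              y < p d + (n ∸ suc d) → y ∉ beads (n ∸ suc d) (λ i → p (suc d + i)) → Removal n p d y
removeStrip (suc n) p zero    y w z _         y< y∉ = insertBead n p y w (λ n<i → z n<i) y< y∉
removeStrip (suc n) p (suc d) y w z (s<s d<n) y< y∉
  with removeStrip n (p ∘ suc) d y (w ∘ suc) (λ n≤i → z (s≤s n≤i)) d<n y< y∉
... | removal {q} {e} st e<n wq new = removal
  (strip (s≤s (st .d≤e)) above′ along′ (st .end) below′)
  (s<s e<n)
  (consRow-WeaklyDecreasing wq (ℕ.≤-trans (strip-≤ (w ∘ suc) st 0) (w 0)))
  new
  where
  above′ : ∀ {i} → i < suc d → consRow (p 0) q i ≡ p i
  above′ {zero}  _         = refl
  above′ {suc i} (s<s i<d) = st .above i<d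
  along′ : ∀ {i} → suc d ≤ i → i < suc e → suc (consRow (p 0) q i) ≡ p (suc i)
  along′ {suc i} (s≤s d≤i) (s<s i<e) = st .along d≤i i<e
  below′ : ∀ {i} → suc e < i → consRow (p 0) q i ≡ p i
  below′ {suc i} (s<s e<i) = st .below e<i

-- Border-strips as lists of boxes

row : (p q : ℕ → ℕ) → ℕ → List Box
row p q i = map (i ,_) (applyUpTo (_+_ (q i)) (p i ∸ q i))

rows : (p q : ℕ → ℕ) → ℕ → List Box
rows p q zero    = []
rows p q (suc N) = row p q N ++ rows p q N

filter-row : ∀ μ i a → filter (λ b → ¬? (b ∈[ μ ]?)) (map (i ,_) (upTo a)) ≡
                       map (i ,_) (applyUpTo (_+_ (part μ i)) (a ∸ part μ i))
filter-row μ i zero rewrite ℕ.0∸n≡0 (part μ i) = refl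
filter-row μ i (suc a) = begin
  filter out? (map (i ,_) (upTo (suc a)))
    ≡⟨ cong (λ l → filter out? (map (i ,_) l)) (List.upTo-∷ʳ a) ⟨
  filter out? (map (i ,_) (upTo a ++ a ∷ []))
    ≡⟨ cong (filter out?) (List.map-++ (i ,_) (upTo a) (a ∷ [])) ⟩
  filter out? (map (i ,_) (upTo a) ++ (i , a) ∷ [])
    ≡⟨ List.filter-++ out? (map (i ,_) (upTo a)) ((i , a) ∷ []) ⟩
  filter out? (map (i ,_) (upTo a)) ++ filter out? ((i , a) ∷ [])
    ≡⟨ cong (_++ filter out? ((i , a) ∷ [])) (filter-row μ i a) ⟩
  map (i ,_) (applyUpTo (_+_ m) (a ∸ m)) ++ filter out? ((i , a) ∷ [])
    ≡⟨ [ inside , outside ]′ (toSum (a ℕ.<? m)) ⟩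
  map (i ,_) (applyUpTo (_+_ m) (suc a ∸ m)) ∎
  where
  open ≡-Reasoning
  m = part μ i
  out? : Decidable (λ b → ¬ (b ∈[ μ ]))
  out? b = ¬? (b ∈[ μ ]?)
  inside : a < m → map (i ,_) (applyUpTo (_+_ m) (a ∸ m)) ++ filter out? ((i , a) ∷ []) ≡
                   map (i ,_) (applyUpTo (_+_ m) (suc a ∸ m))
  inside a<m = begin
    map (i ,_) (applyUpTo (_+_ m) (a ∸ m)) ++ filter out? ((i , a) ∷ [])
      ≡⟨ cong₂ (λ k l → map (i ,_) (applyUpTo (_+_ m) k) ++ l) (ℕ.m≤n⇒m∸n≡0 (ℕ.<⇒≤ a<m))
               (List.filter-reject out? {xs = []} (λ a≮m → a≮m a<m)) ⟩
    []
      ≡⟨ cong (λ k → map (i ,_) (applyUpTo (_+_ m) k)) (ℕ.m≤n⇒m∸n≡0 a<m) ⟨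
    map (i ,_) (applyUpTo (_+_ m) (suc a ∸ m)) ∎
  outside : ¬ (a < m) → map (i ,_) (applyUpTo (_+_ m) (a ∸ m)) ++ filter out? ((i , a) ∷ []) ≡
                        map (i ,_) (applyUpTo (_+_ m) (suc a ∸ m))
  outside a≮m = begin
    map (i ,_) (applyUpTo (_+_ m) (a ∸ m)) ++ filter out? ((i , a) ∷ [])
      ≡⟨ cong (map (i ,_) (applyUpTo (_+_ m) (a ∸ m)) ++_) (List.filter-accept out? {xs = []} a≮m) ⟩
    map (i ,_) (applyUpTo (_+_ m) (a ∸ m)) ++ (i , a) ∷ []
      ≡⟨ cong (λ c → map (i ,_) (applyUpTo (_+_ m) (a ∸ m)) ++ (i , c) ∷ []) (ℕ.m+[n∸m]≡n m≤a) ⟨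
    map (i ,_) (applyUpTo (_+_ m) (a ∸ m)) ++ (i , m + (a ∸ m)) ∷ []
      ≡⟨ List.map-++ (i ,_) (applyUpTo (_+_ m) (a ∸ m)) _ ⟨
    map (i ,_) (applyUpTo (_+_ m) (a ∸ m) ++ m + (a ∸ m) ∷ [])
      ≡⟨ cong (map (i ,_)) (List.applyUpTo-∷ʳ (_+_ m) (a ∸ m)) ⟩
    map (i ,_) (applyUpTo (_+_ m) (suc (a ∸ m)))
      ≡⟨ cong (λ k → map (i ,_) (applyUpTo (_+_ m) k)) (ℕ.+-∸-assoc 1 m≤a) ⟨
    map (i ,_) (applyUpTo (_+_ m) (suc a ∸ m)) ∎
    where
    m≤a : m ≤ a
    m≤a = ℕ.≮⇒≥ a≮m

skewBoxes-rows : ∀ κ μ → skewBoxes κ μ ≡ rows (part κ) (part μ) (length κ)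
skewBoxes-rows κ μ = go (length κ)
  where
  out? : Decidable (λ b → ¬ (b ∈[ μ ]))
  out? b = ¬? (b ∈[ μ ]?)
  go : ∀ N → filter out? (concatMap (λ i → map (i ,_) (upTo (part κ i))) (downFrom N)) ≡
             rows (part κ) (part μ) N
  go zero    = refl
  go (suc N) = trans (List.filter-++ out? (map (N ,_) (upTo (part κ N))) _)
                     (cong₂ _++_ (filter-row μ N (part κ N)) (go N))

part-beyond : ∀ κ {i} → length κ ≤ i → part κ i ≡ 0
part-beyond []      _         = refl
part-beyond (a ∷ κ) (s≤s l≤i) = part-beyond κ l≤i

part>0⇒<length : ∀ κ {i} → 0 < part κ i → i < length κ
part>0⇒<length κ {i} 0<κᵢ with i ℕ.<? length κ
... | yes i<l = i<l
... | no  i≮l = contradiction 0<κᵢ (ℕ.≤⇒≯ (ℕ.≤-reflexive (part-beyond κ (ℕ.≮⇒≥ i≮l))))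

∈-boxes : ∀ μ {i j} → j < part μ i → (i , j) ∈ boxes μ
∈-boxes μ {i} j<μᵢ = ∈-concatMap (λ i → map (i ,_) (upTo (part μ i)))
  (∈-downFrom⁺ (part>0⇒<length μ (ℕ.≤-<-trans z≤n j<μᵢ))) (∈-map⁺ (i ,_) (∈-upTo⁺ j<μᵢ))

⊑⇒≤ : ∀ {μ κ} → μ ⊑ κ → ∀ i → part μ i ≤ part κ i
⊑⇒≤ {μ} {κ} μ⊑κ i with part μ i ℕ.≤? part κ i
... | yes μᵢ≤κᵢ = μᵢ≤κᵢ
... | no  μᵢ≰κᵢ = contradiction (All.lookup μ⊑κ (∈-boxes μ (ℕ.≰⇒> μᵢ≰κᵢ))) (ℕ.<-irrefl refl)

≤⇒⊑ : ∀ {μ κ} → (∀ i → part μ i ≤ part κ i) → μ ⊑ κ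
≤⇒⊑ {μ} {κ} μ≤κ = go (downFrom (length μ))
  where
  go : ∀ is → All (_∈[ κ ]) (concatMap (λ i → map (i ,_) (upTo (part μ i))) is)
  go []       = []
  go (i ∷ is) = All⁺.++⁺ (All⁺.map⁺ (All⁺.applyUpTo⁺₁ id (part μ i) (λ j<μᵢ → ℕ.<-≤-trans j<μᵢ (μ≤κ i)))) (go is)

-- Paths of adjacent boxes and the rows they cross

data Path : Box → Box → List Box → Set where
  single : ∀ {b} → Path b b (b ∷ [])
  cons   : ∀ {b c d bs} → Next b c → Path c d bs → Path b d (b ∷ bs)

path-++ : ∀ {b c d e bs cs} → Path b c bs → Next c d → Path d e cs → Path b e (bs ++ cs)
path-++ single        n q = cons n q
path-++ (cons m p) n q = cons m (path-++ p n q)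

path⇒Linked : ∀ {b c bs} → Path b c bs → Linked Next bs
path⇒Linked single                   = [-]
path⇒Linked (cons n single)          = n ∷ [-]
path⇒Linked (cons n p@(cons _ _)) = n ∷ path⇒Linked p

path-Linked-++ : ∀ {b c d bs cs} → Path b c bs → Linked Next (bs ++ d ∷ cs) → Next c d × Linked Next (d ∷ cs)
path-Linked-++ single                   (n ∷ l) = n , l
path-Linked-++ (cons _ single)          (_ ∷ l) = path-Linked-++ single l
path-Linked-++ (cons _ p@(cons _ _)) (_ ∷ l) = path-Linked-++ p l

-- The local function of height that finds the last box has no name here;
-- unification recovers the height from it as climb b (c ∷ cs) c cs.
mutual
  climb : Box → List Box → Box → List Box → ℕ
  climb = _

  height-climb : ∀ b c cs → height (b ∷ c ∷ cs) ≡ climb b (c ∷ cs) c cs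
  height-climb b c cs with c ∷ cs
  ... | bs = refl

path-height : ∀ {b c bs} → Path b c bs → height bs ≡ proj₁ b ∸ proj₁ c
path-height single = refl
path-height (cons {b} _ p₀@(cons {c} {bs = cs} _ _)) = trans (height-climb b c cs) (climb-path (c ∷ cs) p₀)
  where
  climb-path : ∀ bs {c d cs} → Path c d (c ∷ cs) → climb b bs c cs ≡ proj₁ b ∸ proj₁ d
  climb-path bs single              = refl
  climb-path bs (cons _ p@single)     = climb-path bs p
  climb-path bs (cons _ p@(cons _ _)) = climb-path bs p
path-height (cons _ single) = refl

segment-path : ∀ (i : ℕ) (f : ℕ → ℕ) → (∀ j → f (suc j) ≡ suc (f j)) →
               ∀ k → Path (i , f 0) (i , f k) (map (i ,_) (applyUpTo f (suc k)))
segment-path i f f-suc zero    = single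
segment-path i f f-suc (suc k) =
  cons (inj₁ (cong (i ,_) (f-suc 0))) (segment-path i (f ∘ suc) (f-suc ∘ suc) k)

interval-path : ∀ (i : ℕ) {a b} → a < b →
                Path (i , a) (i , pred b) (map (i ,_) (applyUpTo (_+_ a) (b ∸ a)))
interval-path i {a} a<b with ℕ.m≤n⇒∃[o]m+o≡n a<b
... | k , refl = subst₂ (λ c m → Path (i , c) (i , a + k) (map (i ,_) (applyUpTo (_+_ a) m)))
                   (ℕ.+-identityʳ a)
                   (sym (trans (cong (_∸ a) (sym (ℕ.+-suc a k))) (ℕ.m+n∸m≡n a (suc k))))
                   (segment-path i (_+_ a) (ℕ.+-suc a) k)

row-path : ∀ p q i → q i < p i → Path (i , q i) (i , pred (p i)) (row p q i)
row-path p q i q<p = interval-path i q<p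

row-empty : ∀ p q i → p i ≤ q i → row p q i ≡ []
row-empty p q i p≤q = cong (λ k → map (i ,_) (applyUpTo (_+_ (q i)) k)) (ℕ.m≤n⇒m∸n≡0 p≤q)

rows-stable : ∀ p q M → (∀ i → M ≤ i → p i ≤ q i) → ∀ k → rows p q (k + M) ≡ rows p q M
rows-stable p q M p≤q zero    = refl
rows-stable p q M p≤q (suc k) =
  trans (cong (_++ rows p q (k + M)) (row-empty p q (k + M) (p≤q (k + M) (ℕ.m≤n+m M k))))
        (rows-stable p q M p≤q k)

-- Row `suc i` of the strip ends in column `pred (p (suc i))`, and row `i` begins in column `q i`.
-- By `along` these columns agree, so the walk goes up from the end of one row to the start of the
-- row above.
strip-rows : ∀ {p q d e} → WeaklyDecreasing p → Strip p q d e →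
             Path (e , q e) (d , pred (p d)) (rows p q (suc e))
strip-rows {p} {q} {d} {e} w st =
  subst (λ N → Path (N , q N) (d , pred (p d)) (rows p q (suc N)))
        (ℕ.m∸n+n≡m (st .d≤e))
        (go (e ∸ d) (ℕ.≤-reflexive (ℕ.m∸n+n≡m (st .d≤e))))
  where
  rows-above : ∀ N → N ≤ d → rows p q N ≡ []
  rows-above zero    _   = refl
  rows-above (suc N) N<d rewrite row-empty p q N (ℕ.≤-reflexive (sym (st .above N<d))) =
    rows-above N (ℕ.<⇒≤ N<d)
  go : ∀ k → k + d ≤ e → Path (k + d , q (k + d)) (d , pred (p d)) (rows p q (suc (k + d)))
  go zero d≤e rewrite rows-above d ℕ.≤-refl | List.++-identityʳ (row p q d) =
    row-path p q d (strip-< w st ℕ.≤-refl d≤e)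
  go (suc k) k+d<e = path-++
    (row-path p q (suc k + d) (strip-< w st (ℕ.m≤n+m d (suc k)) k+d<e))
    (inj₂ (cong (suc k + d ,_) (cong pred (st .along (ℕ.m≤n+m d k) k+d<e))))
    (go k (ℕ.<⇒≤ k+d<e))

-- This is what adjacency reveals about the rows with index below `N`; once `N` reaches the number
-- of rows it becomes a `Strip`. The field `boxes≡` exposes the first box met, because that is the
-- box to which the next nonempty row below has to connect.
record LinkedRows (p q : ℕ → ℕ) (d N : ℕ) : Set where
  constructor linkedRows
  field
    {bottom} : ℕ
    {others} : List Box
    top≤     : d ≤ bottom
    <bound   : bottom < N
    joined   : ∀ {i} → d ≤ i → i < bottom → suc (q i) ≡ p (suc i)
    nonempty : q bottom < p bottom
    unmoved  : ∀ {i} → bottom < i → i < N → q i ≡ p i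
    boxes≡   : rows p q N ≡ (bottom , q bottom) ∷ others

path-head : ∀ {b c bs} → Path b c bs → ∃[ cs ] bs ≡ b ∷ cs
path-head single                  = [] , refl
path-head (cons {bs = bs} _ _) = bs , refl

-- Rows are added downwards from `d`. An empty row changes nothing. The last box of a nonempty row
-- must be adjacent to the first box of the current bottom row, which lies higher up; the step is
-- thus vertical, so there is no gap between the two rows and their columns match as `along`
-- requires.
linked⇒LinkedRows : ∀ p q d k → (∀ i → q i ≤ p i) → q d < p d →
                    Linked Next (rows p q (k + suc d)) → LinkedRows p q d (k + suc d)
linked⇒LinkedRows p q d zero q≤p q<p l = linkedRows ℕ.≤-refl (ℕ.n<1+n d)
  (λ d≤i i<d → contradiction d≤i (ℕ.<⇒≱ i<d)) q<p
  (λ d<i i<1+d → contradiction (s≤s⁻¹ i<1+d) (ℕ.≤⇒≯ d<i ∘ s≤s))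
  (cong (_++ rows p q d) (proj₂ (path-head (row-path p q d q<p))))
linked⇒LinkedRows p q d (suc k) q≤p q<p l with ℕ.m≤n⇒m<n∨m≡n (q≤p (k + suc d))
... | inj₂ q≡p = linkedRows top≤ (ℕ.m<n⇒m<1+n <bound) joined nonempty
  (λ b<i i≤N → [ unmoved b<i , (λ { refl → q≡p }) ]′ (ℕ.m≤n⇒m<n∨m≡n (s≤s⁻¹ i≤N)))
  (trans (cong (_++ rows p q N) empty) boxes≡)
  where
  N = k + suc d
  empty : row p q N ≡ []
  empty = row-empty p q N (ℕ.≤-reflexive (sym q≡p))
  open LinkedRows (linked⇒LinkedRows p q d k q≤p q<p (subst (λ bs → Linked Next (bs ++ rows p q N)) empty l))
... | inj₁ q<p′ = linkedRows (ℕ.≤-trans (ℕ.n≤1+n d) (ℕ.m≤n+m (suc d) k)) (ℕ.n<1+n N)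
  joined′ q<p′ (λ N<i i≤N → contradiction (s≤s⁻¹ i≤N) (ℕ.<⇒≱ N<i))
  (cong (_++ rows p q N) (proj₂ (path-head (row-path p q N q<p′))))
  where
  N = k + suc d
  linked-rest : ∀ {bs cs} → Linked Next (bs ++ cs) → Linked Next cs
  linked-rest {[]}                 l       = l
  linked-rest {_ ∷ []} {[]}        l       = []
  linked-rest {_ ∷ []} {_ ∷ _}     (_ ∷ l) = l
  linked-rest {_ ∷ bs@(_ ∷ _)}     (_ ∷ l) = linked-rest {bs} l
  open LinkedRows (linked⇒LinkedRows p q d k q≤p q<p (linked-rest {row p q N} l))
  next : Next (N , pred (p N)) (bottom , q bottom)
  next = proj₁ (path-Linked-++ (row-path p q N q<p′) (subst (λ bs → Linked Next (row p q N ++ bs)) boxes≡ l))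
  positive : suc (pred (p N)) ≡ p N
  positive = ℕ.suc-pred (p N) {{>-nonZero (ℕ.≤-<-trans z≤n q<p′)}}
  last-joined : ∀ {i c} → Next (N , pred (p N)) (i , c) → i < N → suc i ≡ N × suc c ≡ p N
  last-joined (inj₁ refl) i<i = contradiction i<i (ℕ.<-irrefl refl)
  last-joined (inj₂ e)    _   = cong proj₁ e , trans (cong (suc ∘ proj₂) e) positive
  joined′ : ∀ {i} → d ≤ i → i < N → suc (q i) ≡ p (suc i)
  joined′ {i} d≤i i<N with last-joined next <bound
  ... | sb≡N , sq≡p with ℕ.m≤n⇒m<n∨m≡n (s≤s⁻¹ (subst (i <_) (sym sb≡N) i<N))
  ...   | inj₁ i<b  = joined d≤i i<b
  ...   | inj₂ refl = trans sq≡p (cong p (sym sb≡N))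

borderStrip⇒strip : ∀ {s κ μ d} → BorderStrip s κ μ → (∀ {i} → i < d → part μ i ≡ part κ i) →
                    part μ d < part κ d → ∃[ e ] e < length κ × Strip (part κ) (part μ) d e
borderStrip⇒strip {κ = κ} {μ} {d} bs above excess =
  bottom , <bound′ , strip top≤ above joined nonempty below′
  where
  open BorderStrip bs
  μ≤κ : ∀ i → part μ i ≤ part κ i
  μ≤κ = ⊑⇒≤ {μ} {κ} contained
  d<l : d < length κ
  d<l = part>0⇒<length κ (ℕ.≤-<-trans z≤n excess)
  N≡l : (length κ ∸ suc d) + suc d ≡ length κ
  N≡l = ℕ.m∸n+n≡m d<l
  open LinkedRows (linked⇒LinkedRows (part κ) (part μ) d (length κ ∸ suc d) μ≤κ excess
    (subst (Linked Next) (trans (skewBoxes-rows κ μ) (cong (rows (part κ) (part μ)) (sym N≡l))) adjacent))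
  <bound′ : bottom < length κ
  <bound′ = subst (bottom <_) N≡l <bound
  below′ : ∀ {i} → bottom < i → part μ i ≡ part κ i
  below′ {i} b<i with i ℕ.<? length κ
  ... | yes i<l = unmoved b<i (subst (i <_) (sym N≡l) i<l)
  ... | no  i≮l = trans (ℕ.n≤0⇒n≡0 (ℕ.≤-trans (μ≤κ i) (ℕ.≤-reflexive κ≡0))) (sym κ≡0)
    where
    κ≡0 : part κ i ≡ 0
    κ≡0 = part-beyond κ (ℕ.≮⇒≥ i≮l)

strip-path : ∀ {κ μ d e} → WeaklyDecreasing (part κ) → Strip (part κ) (part μ) d e →
             Path (e , part μ e) (d , pred (part κ d)) (skewBoxes κ μ)
strip-path {κ} {μ} {d} {e} w st = subst (Path _ _) (sym boxes≡) (strip-rows w st)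
  where
  e<l : e < length κ
  e<l = part>0⇒<length κ (ℕ.≤-<-trans z≤n (st .end))
  boxes≡ : skewBoxes κ μ ≡ rows (part κ) (part μ) (suc e)
  boxes≡ = trans (skewBoxes-rows κ μ) (trans (cong (rows (part κ) (part μ)) (sym (ℕ.m∸n+n≡m e<l)))
    (rows-stable (part κ) (part μ) (suc e) (λ i e<i → ℕ.≤-reflexive (sym (st .below e<i))) (length κ ∸ suc e)))

sgn-strip : ∀ {κ μ d e} → WeaklyDecreasing (part κ) → Strip (part κ) (part μ) d e →
            sgn κ μ ≡ -1ℤ ℤ.^ (e ∸ d)
sgn-strip {κ} {μ} w st = cong (-1ℤ ℤ.^_) (path-height (strip-path {κ} {μ} w st))

strip⇒borderStrip : ∀ {s κ μ d e} → WeaklyDecreasing (part κ) → WeaklyDecreasing (part μ) →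
                    IsPartition μ → Strip (part κ) (part μ) d e → sum κ ≡ s + sum μ → BorderStrip s κ μ
strip⇒borderStrip {κ = κ} {μ} w w′ isPartition st size =
  borderStrip isPartition (≤⇒⊑ {μ} {κ} (strip-≤ w st)) size
    (subst (All (InRim κ)) (sym (skewBoxes-rows κ μ)) (go (length κ)))
    (path⇒Linked (strip-path {κ} {μ} w st))
  where
  go : ∀ N → All (InRim κ) (rows (part κ) (part μ) N)
  go zero    = []
  go (suc N) = All⁺.++⁺ (All⁺.map⁺ (All⁺.applyUpTo⁺₁ _ (part κ N ∸ part μ N) (λ {k} k< →
      subst (part μ N + k <_) (ℕ.m+[n∸m]≡n (strip-≤ w st N)) (ℕ.+-monoʳ-< (part μ N) k<) ,
      ℕ.≤⇒≯ (ℕ.≤-trans (strip-rim w w′ st N) (s≤s (ℕ.m≤m+n (part μ N) k))))))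
    (go N)

-- The sign as a determinant

partition⇒WeaklyDecreasing : ∀ {κ} → Linked _≥_ κ → WeaklyDecreasing (part κ)
partition⇒WeaklyDecreasing []       i       = z≤n
partition⇒WeaklyDecreasing [-]      i       = z≤n
partition⇒WeaklyDecreasing (ge ∷ l) zero    = ge
partition⇒WeaklyDecreasing (ge ∷ l) (suc i) = partition⇒WeaklyDecreasing l i

length≤ : ∀ {κ} → All (0 <_) κ → ∀ {n} → part κ n ≡ 0 → length κ ≤ n
length≤ []           _ = z≤n
length≤ (0<a ∷ 0<κ) {zero}  refl = contradiction 0<a (ℕ.<-irrefl refl)
length≤ (0<a ∷ 0<κ) {suc n} e    = s≤s (length≤ 0<κ e)

partition-ext : ∀ {κ μ} → All (0 <_) κ → All (0 <_) μ → (∀ i → part κ i ≡ part μ i) → κ ≡ μ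
partition-ext [] [] e = refl
partition-ext [] (0<b ∷ _) e with refl ← e 0 = contradiction 0<b (ℕ.<-irrefl refl)
partition-ext (0<a ∷ _) [] e with refl ← e 0 = contradiction 0<a (ℕ.<-irrefl refl)
partition-ext (_ ∷ 0<κ) (_ ∷ 0<μ) e = cong₂ _∷_ (e 0) (partition-ext 0<κ 0<μ (e ∘ suc))

parts : ℕ → (ℕ → ℕ) → List ℕ
parts zero    q = []
parts (suc n) q with q 0
... | zero  = []
... | suc a = suc a ∷ parts n (q ∘ suc)

part-parts : ∀ n q → WeaklyDecreasing q → (∀ {i} → n ≤ i → q i ≡ 0) → ∀ i → part (parts n q) i ≡ q i
part-parts zero    q w z i = sym (z z≤n)
part-parts (suc n) q w z i with q 0 in q₀≡
... | zero = sym (ℕ.n≤0⇒n≡0 (subst (q i ≤_) q₀≡ (weaklyDecreasing-≤ {q} w z≤n)))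
part-parts (suc n) q w z zero    | suc a = sym q₀≡
part-parts (suc n) q w z (suc i) | suc a = part-parts n (q ∘ suc) (w ∘ suc) (z ∘ s≤s) i

parts-positive : ∀ n q → All (0 <_) (parts n q)
parts-positive zero    q = []
parts-positive (suc n) q with q 0
... | zero  = []
... | suc a = z<s ∷ parts-positive n (q ∘ suc)

weaklyDecreasing⇒Linked : ∀ κ → WeaklyDecreasing (part κ) → Linked _≥_ κ
weaklyDecreasing⇒Linked []          w = []
weaklyDecreasing⇒Linked (a ∷ [])    w = [-]
weaklyDecreasing⇒Linked (a ∷ b ∷ κ) w = w 0 ∷ weaklyDecreasing⇒Linked (b ∷ κ) (w ∘ suc)

parts-isPartition : ∀ n q → WeaklyDecreasing q → (∀ {i} → n ≤ i → q i ≡ 0) → IsPartition (parts n q)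
parts-isPartition n q w z =
  weaklyDecreasing⇒Linked (parts n q)
    (λ i → subst₂ _≤_ (sym (part-parts n q w z (suc i))) (sym (part-parts n q w z i)) (w i)) ,
  parts-positive n q

-- The second summand on the right is 0 + 1 + ... + (n - 1). It is the same for every shape, so it
-- cancels whenever sizes are compared.
sum-beads : ∀ n κ → length κ ≤ n → sum (beads n (part κ)) ≡ sum κ + sum (beads n (λ _ → 0))
sum-beads n       []      _         = refl
sum-beads (suc n) (a ∷ κ) (s≤s l≤n) =
  trans (cong (_+_ (a + n)) (sum-beads n κ l≤n)) (lemma a n (sum κ) _)
  where
  lemma : ∀ a n s t → a + n + (s + t) ≡ a + s + (n + t)
  lemma = ℕS.solve-∀

least : ∀ {R : ℕ → Set} → Decidable R → ∀ n →
        (∃[ d ] d < n × R d × (∀ {e} → e < d → ¬ R e)) ⊎ (∀ {i} → i < n → ¬ R i)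
least R? zero = inj₂ λ ()
least R? (suc n) with least R? n
... | inj₁ (d , d<n , found) = inj₁ (d , ℕ.m<n⇒m<1+n d<n , found)
... | inj₂ none with R? n
...   | yes Rn = inj₁ (n , ℕ.n<1+n n , Rn , none)
...   | no ¬Rn = inj₂ λ i≤n → [ none , (λ { refl → ¬Rn }) ]′ (ℕ.m≤n⇒m<n∨m≡n (s≤s⁻¹ i≤n))

module _ (r : ℕ) .{{_ : NonZero r}} where

  decomposition⇒≤ : ∀ {ν κ} → Decomposition r ν κ → ∀ i → part ν i ≤ part κ i
  decomposition⇒≤ done i = ℕ.≤-refl
  decomposition⇒≤ {κ = κ} (step {μ = μ} fs D) i =
    ℕ.≤-trans (decomposition⇒≤ D i) (⊑⇒≤ {μ} {κ} (BorderStrip.contained (FinalStrip.strip fs)) i)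

  signDet : ℕ → List ℕ → List ℕ → ℤ
  signDet n ν κ = det (map (reach r) (beads n (part ν))) (beads n (part κ))

  sum-beads-step : ∀ n {κ μ} → length κ ≤ n → length μ ≤ n → sum κ ≡ r + sum μ →
                   sum (beads n (part κ)) ≡ r + sum (beads n (part μ))
  sum-beads-step n {κ} {μ} κ≤n μ≤n e = begin
    sum (beads n (part κ))                      ≡⟨ sum-beads n κ κ≤n ⟩
    sum κ + sum (beads n (λ _ → 0))             ≡⟨ cong (_+ _) e ⟩
    r + sum μ + sum (beads n (λ _ → 0))         ≡⟨ ℕ.+-assoc r (sum μ) _ ⟩
    r + (sum μ + sum (beads n (λ _ → 0)))       ≡⟨ cong (_+_ r) (sum-beads n μ μ≤n) ⟨
    r + sum (beads n (part μ))                  ∎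
    where open ≡-Reasoning

  -- Each strip multiplies the determinant by its own sign, by `det-strip`, and at `ν` itself the
  -- determinant is 1. The given decomposition enters only as the path along which this is computed.
  sign-signDet : ∀ n {ν κ} → IsPartition ν → IsPartition κ → length κ ≤ n →
                 (D : Decomposition r ν κ) → signDet n ν κ ≡ sign D
  sign-signDet n {ν} pν pκ κ≤n done =
    det-diagonal r (beads-Decreasing n (partition⇒WeaklyDecreasing (proj₁ pν)))
  sign-signDet n {ν} {κ} pν pκ κ≤n (step {μ = μ} (finalStrip bs ν⊑μ (d , _ , (excess , first) , top)) D) =
    trans (det-strip r wκ (partition⇒WeaklyDecreasing (proj₁ pν)) st (ℕ.<-≤-trans e<l κ≤n)
             (sum-beads-step n {κ} {μ} κ≤n μ≤n size) (λ i<d → ℕ.≮⇒≥ (first i<d)) excess)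
          (cong₂ _⊗_ (sym (sgn-strip {κ} {μ} wκ st)) (sign-signDet n pν isPartition μ≤n D))
    where
    open BorderStrip bs
    wκ = partition⇒WeaklyDecreasing (proj₁ pκ)
    μ≤κ : ∀ i → part μ i ≤ part κ i
    μ≤κ = ⊑⇒≤ {μ} {κ} contained
    -- Above row `d` the shape κ does not exceed ν, while ν lies in μ and μ in κ; so all three agree
    -- there and the strip starts exactly in row `d`.
    above′ : ∀ {i} → i < d → part μ i ≡ part κ i
    above′ {i} i<d = ℕ.≤-antisym (μ≤κ i) (ℕ.≤-trans (ℕ.≮⇒≥ (first i<d)) (⊑⇒≤ {ν} {μ} ν⊑μ i))
    found = borderStrip⇒strip bs above′ top
    e<l = proj₁ (proj₂ found)
    st = proj₂ (proj₂ found)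
    μ≤n : length μ ≤ n
    μ≤n = length≤ (proj₂ isPartition)
      (ℕ.n≤0⇒n≡0 (subst (part μ n ≤_) (part-beyond κ κ≤n) (μ≤κ n)))

  -- Following the determinant instead of the search decides every case. It vanishes if ν is not
  -- inside κ, if the first excess bead `x` is below `r`, or if `x ∸ r` is already occupied. In the
  -- remaining cases either κ equals ν, or there is a final strip to remove and the smaller shape
  -- decides.
  decomposition-or-zero : ∀ n {ν} κ → IsPartition ν → IsPartition κ → length ν ≤ n → length κ ≤ n →
                          Acc _<_ (sum κ) → Decomposition r ν κ ⊎ signDet n ν κ ≡ 0ℤ
  decomposition-or-zero n {ν} κ pν pκ ν≤n κ≤n (acc rec)
    with least (λ i → part κ i ℕ.<? part ν i) n | least (λ i → part ν i ℕ.<? part κ i) n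
  ... | inj₁ (i , i<n , κ<ν , _) | _ = inj₂ (det-Exceeds r
    (beads-Decreasing n (partition⇒WeaklyDecreasing (proj₁ pν)))
    (beads-Decreasing n (partition⇒WeaklyDecreasing (proj₁ pκ)))
    (beads-Exceeds i<n κ<ν))
  ... | inj₂ ν≤κ | inj₂ κ≤ν =
    inj₁ (subst (Decomposition r ν) (partition-ext (proj₂ pν) (proj₂ pκ) equal) done)
    where
    equal : ∀ i → part ν i ≡ part κ i
    equal i with i ℕ.<? n
    ... | yes i<n = ℕ.≤-antisym (ℕ.≮⇒≥ (ν≤κ i<n)) (ℕ.≮⇒≥ (κ≤ν i<n))
    ... | no  i≮n = trans (part-beyond ν (ℕ.≤-trans ν≤n (ℕ.≮⇒≥ i≮n)))
                          (sym (part-beyond κ (ℕ.≤-trans κ≤n (ℕ.≮⇒≥ i≮n))))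
  ... | inj₂ ν≤κ | inj₁ (d , d<n , excess , first) = remove (x ℕ.<? r)
    where
    wκ = partition⇒WeaklyDecreasing (proj₁ pκ)
    wν = partition⇒WeaklyDecreasing (proj₁ pν)
    b = map (reach r) (beads n (part ν))
    x = part κ d + (n ∸ suc d)
    rest = beads (n ∸ suc d) (λ i → part κ (suc d + i))
    ws = proj₁ (beads-split n (part κ) d d<n)
    split : beads n (part κ) ≡ ws ++ x ∷ rest
    split = proj₂ (beads-split n (part κ) d d<n)
    avoid : All (_≢ x) (beads n (part ν))
    avoid = beads-avoid wκ wν d<n (λ i<d → ℕ.≮⇒≥ (first i<d)) excess

    remove : Dec (x < r) → Decomposition r ν κ ⊎ signDet n ν κ ≡ 0ℤ
    remove (yes x<r) = inj₂ (trans (cong (det b) split) (det-small r (beads n (part ν)) ws x rest x<r avoid))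
    -- Searching `rest` is enough, as the beads before `x` are larger than `x` and cannot coincide
    -- with `y`.
    remove (no  x≮r) = lower (any? (y ℕ.≟_) rest)
      where
      y = x ∸ r
      x≡r+y : x ≡ r + y
      x≡r+y = sym (ℕ.m+[n∸m]≡n (ℕ.≮⇒≥ x≮r))
      lower : Dec (y ∈ rest) → Decomposition r ν κ ⊎ signDet n ν κ ≡ 0ℤ
      lower (yes y∈) = inj₂ (begin
        det b (beads n (part κ))     ≡⟨ cong (det b) (trans split (cong (λ x → ws ++ x ∷ rest) x≡r+y)) ⟩
        det b (ws ++ r + y ∷ rest)   ≡⟨ det-lower r (beads n (part ν)) ws y rest (subst (λ x → All (_≢ x) (beads n (part ν))) x≡r+y avoid) ⟩
        det b (ws ++ y ∷ rest)       ≡⟨ alternating-repeat (alternating-++ ws (det-alternating b)) y∈ ⟩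
        0ℤ                           ∎)
        where open ≡-Reasoning
      lower (no y∉) = continue (decomposition-or-zero n μ pν pμ ν≤n μ≤n (rec smaller))
        where
        zero-beyond : ∀ {i} → n ≤ i → part κ i ≡ 0
        zero-beyond n≤i = part-beyond κ (ℕ.≤-trans κ≤n n≤i)
        open Removal (removeStrip n (part κ) d y wκ zero-beyond d<n
          (subst (y <_) (sym x≡r+y) (ℕ.m<n+m y (>-nonZero⁻¹ r))) y∉)
        zero-beyond′ : ∀ {i} → n ≤ i → result i ≡ 0
        zero-beyond′ {i} n≤i = ℕ.n≤0⇒n≡0 (subst (result i ≤_) (zero-beyond n≤i) (strip-≤ wκ isStrip i))
        μ = parts n result
        μ≗ : ∀ i → part μ i ≡ result i
        μ≗ = part-parts n result isWeaklyDecreasing zero-beyond′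
        pμ : IsPartition μ
        pμ = parts-isPartition n result isWeaklyDecreasing zero-beyond′
        μ≤n : length μ ≤ n
        μ≤n = length≤ (proj₂ pμ) (trans (μ≗ n) (zero-beyond′ ℕ.≤-refl))
        st : Strip (part κ) (part μ) d bottom
        st = strip (isStrip .d≤e) (λ i<d → trans (μ≗ _) (isStrip .above i<d))
          (λ d≤i i<e → trans (cong suc (μ≗ _)) (isStrip .along d≤i i<e))
          (subst (_< part κ bottom) (sym (μ≗ bottom)) (isStrip .end))
          (λ e<i → trans (μ≗ _) (isStrip .below e<i))
        sums : sum (beads n (part κ)) ≡ r + sum (beads n (part μ))
        sums = ℕ.+-cancelʳ-≡ y _ _ (begin
          sum (beads n (part κ)) + y                              ≡⟨ cong (_+_ (sum (beads n (part κ)))) (trans (cong (_+ (n ∸ suc bottom)) (μ≗ bottom)) newBead) ⟨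
          sum (beads n (part κ)) + (part μ bottom + (n ∸ suc bottom)) ≡⟨ strip-sum st bottom<n ⟩
          x + sum (beads n (part μ))                              ≡⟨ cong (_+ sum (beads n (part μ))) x≡r+y ⟩
          r + y + sum (beads n (part μ))                          ≡⟨ lemma r y _ ⟩
          r + sum (beads n (part μ)) + y                          ∎)
          where
          open ≡-Reasoning
          lemma : ∀ a b c → a + b + c ≡ a + c + b
          lemma = ℕS.solve-∀
        size : sum κ ≡ r + sum μ
        size = ℕ.+-cancelʳ-≡ (sum (beads n (λ _ → 0))) _ _ (begin
          sum κ + sum (beads n (λ _ → 0))          ≡⟨ sum-beads n κ κ≤n ⟨
          sum (beads n (part κ))                   ≡⟨ sums ⟩
          r + sum (beads n (part μ))               ≡⟨ cong (_+_ r) (sum-beads n μ μ≤n) ⟩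
          r + (sum μ + sum (beads n (λ _ → 0)))    ≡⟨ ℕ.+-assoc r (sum μ) _ ⟨
          r + sum μ + sum (beads n (λ _ → 0))      ∎)
          where open ≡-Reasoning
        smaller : sum μ < sum κ
        smaller = subst (sum μ <_) (sym size) (ℕ.m<n+m (sum μ) (>-nonZero⁻¹ r))
        wμ = partition⇒WeaklyDecreasing (proj₁ pμ)
        continue : Decomposition r ν μ ⊎ signDet n ν μ ≡ 0ℤ → Decomposition r ν κ ⊎ signDet n ν κ ≡ 0ℤ
        continue (inj₁ D) = inj₁ (step (finalStrip
          (strip⇒borderStrip wκ wμ pμ st size)
          (≤⇒⊑ {ν} {μ} (decomposition⇒≤ D))
          (d , part>0⇒<length κ (ℕ.≤-<-trans z≤n excess) , (excess , first) ,
           strip-< wκ st ℕ.≤-refl (st .d≤e))) D)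
        continue (inj₂ z) = inj₂ (trans
          (det-strip r wκ wν st bottom<n sums (λ i<d → ℕ.≮⇒≥ (first i<d)) excess)
          (trans (cong (-1ℤ ℤ.^ (bottom ∸ d) ⊗_) z) (ℤ.*-zeroʳ (-1ℤ ℤ.^ (bottom ∸ d)))))

  sgnʳ-signDet : ∀ n {ν κ} → IsPartition ν → IsPartition κ → length ν ≤ n → length κ ≤ n →
                 sgnʳ r κ ν ≡ signDet n ν κ
  sgnʳ-signDet n {ν} {κ} pν pκ ν≤n κ≤n with decomposable? r ν κ
  ... | yes D = sym (sign-signDet n pν pκ κ≤n D)
  ... | no ¬D = [ (λ D → contradiction D ¬D) , sym ]′
                  (decomposition-or-zero n κ pν pκ ν≤n κ≤n (<-wellFounded (sum κ)))

  sgnʳ-⋢ : ∀ {ν κ i} → part κ i < part ν i → sgnʳ r κ ν ≡ 0ℤ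
  sgnʳ-⋢ {ν} {κ} {i} κ<ν with decomposable? r ν κ
  ... | yes D = contradiction (decomposition⇒≤ D i) (ℕ.<⇒≱ κ<ν)
  ... | no _  = refl

-- Semistandard tableaux

Σ<-from : ∀ {a b} → a ≤ b → (f : ℕ → ℤ) → Σ< b (λ i → 𝟙 (a ℕ.≤? i) ⊗ f i) ≡ I a b f
Σ<-from {a} a≤b f with ℕ.m≤n⇒∃[o]m+o≡n a≤b
... | k , refl = begin
  Σ< (a + k) (λ i → 𝟙 (a ℕ.≤? i) ⊗ f i)
    ≡⟨ Σ<-+ a k (λ i → 𝟙 (a ℕ.≤? i) ⊗ f i) ⟩
  Σ< a (λ i → 𝟙 (a ℕ.≤? i) ⊗ f i) ⊕ Σ< k (λ i → 𝟙 (a ℕ.≤? a + i) ⊗ f (a + i))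
    ≡⟨ cong₂ _⊕_ (Σ<-zero a (λ {i} i<a → 𝟙-⊗-no (a ℕ.≤? i) (ℕ.<⇒≱ i<a)))
                 (Σ<-cong k (λ {i} _ → 𝟙-⊗-yes (a ℕ.≤? a + i) (ℕ.m≤m+n a i))) ⟩
  0ℤ ⊕ Σ< k (λ i → f (a + i))
    ≡⟨ ℤ.+-identityˡ _ ⟩
  Σ< k (λ i → f (a + i))
    ≡⟨ I-segment a k f ⟨
  I a (a + k) f ∎
  where open ≡-Reasoning

rowSum : ℕ → ℕ → ℕ → (List ℕ → ℤ) → ℤ
rowSum n zero    lo f = f []
rowSum n (suc a) lo f = Σ< n λ x → 𝟙 (lo ℕ.≤? x) ⊗ rowSum n a x λ R → f (x ∷ R)

rowSum-linear : ∀ n a lo → Linear (rowSum n a lo)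
rowSum-linear n zero    lo .cong-≗ e = e []
rowSum-linear n zero    lo .add f g = refl
rowSum-linear n zero    lo .scale c f = refl
rowSum-linear n (suc a) lo .cong-≗ e =
  Σ<-cong n (λ {x} _ → cong (𝟙 (lo ℕ.≤? x) ⊗_) (rowSum-linear n a x .cong-≗ (λ R → e (x ∷ R))))
rowSum-linear n (suc a) lo .add f g =
  trans (Σ<-cong n (λ {x} _ → trans (cong (𝟙 (lo ℕ.≤? x) ⊗_) (rowSum-linear n a x .add (f ∘ (x ∷_)) (g ∘ (x ∷_))))
                                    (ℤ.*-distribˡ-+ (𝟙 (lo ℕ.≤? x)) _ _)))
        (Σ<-linear n .add _ _)
rowSum-linear n (suc a) lo .scale c f =
  trans (Σ<-cong n (λ {x} _ → trans (cong (𝟙 (lo ℕ.≤? x) ⊗_) (rowSum-linear n a x .scale c (f ∘ (x ∷_))))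
                                    (⊗-exchange (𝟙 (lo ℕ.≤? x)) c _)))
        (Σ<-linear n .scale c _)

rowSum-cong : ∀ n a lo {f g : List ℕ → ℤ} →
  (∀ {R} → length R ≡ a → All (_< n) R → f R ≡ g R) → rowSum n a lo f ≡ rowSum n a lo g
rowSum-cong n zero    lo e = e refl []
rowSum-cong n (suc a) lo e = Σ<-cong n (λ {x} x<n → cong (𝟙 (lo ℕ.≤? x) ⊗_)
  (rowSum-cong n a x (λ len below → e (cong suc len) (x<n ∷ below))))

∑-rows : ∀ n a lo (f : List ℕ → ℤ) →
  ∑ (choices (replicate a (upTo n))) (λ R → 𝟙 (linked? ℕ._≤?_ (lo ∷ R)) ⊗ f R) ≡ rowSum n a lo f
∑-rows n zero    lo f = trans (ℤ.+-identityʳ _) (ℤ.*-identityˡ (f []))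
∑-rows n (suc a) lo f = begin
  ∑ (choices (replicate (suc a) (upTo n))) (λ R → 𝟙 (linked? ℕ._≤?_ (lo ∷ R)) ⊗ f R)
    ≡⟨ ∑-cartesianProductWith _∷_ (upTo n) (choices (replicate a (upTo n))) _ ⟩
  ∑ (upTo n) (λ x → ∑ (choices (replicate a (upTo n))) (λ R → 𝟙 (linked? ℕ._≤?_ (lo ∷ x ∷ R)) ⊗ f (x ∷ R)))
    ≡⟨ ∑-applyUpTo id n _ ⟩
  Σ< n (λ x → ∑ (choices (replicate a (upTo n))) (λ R → 𝟙 (linked? ℕ._≤?_ (lo ∷ x ∷ R)) ⊗ f (x ∷ R)))
    ≡⟨ Σ<-cong n (λ {x} _ → trans
         (∑-cong-∈ (choices (replicate a (upTo n))) (λ {R} _ → trans (cong (_⊗ f (x ∷ R)) (factor x R)) (ℤ.*-assoc (𝟙 (lo ℕ.≤? x)) _ (f (x ∷ R)))))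
         (∑-linear (choices (replicate a (upTo n))) .scale (𝟙 (lo ℕ.≤? x)) _)) ⟩
  Σ< n (λ x → 𝟙 (lo ℕ.≤? x) ⊗ ∑ (choices (replicate a (upTo n))) (λ R → 𝟙 (linked? ℕ._≤?_ (x ∷ R)) ⊗ f (x ∷ R)))
    ≡⟨ Σ<-cong n (λ {x} _ → cong (𝟙 (lo ℕ.≤? x) ⊗_) (∑-rows n a x (f ∘ (x ∷_)))) ⟩
  rowSum n (suc a) lo f ∎
  where
  open ≡-Reasoning
  factor : ∀ x R → 𝟙 (linked? ℕ._≤?_ (lo ∷ x ∷ R)) ≡ 𝟙 (lo ℕ.≤? x) ⊗ 𝟙 (linked? ℕ._≤?_ (x ∷ R))
  factor x R = trans
    (𝟙-cong (linked? ℕ._≤?_ (lo ∷ x ∷ R)) (lo ℕ.≤? x ×-dec linked? ℕ._≤?_ (x ∷ R))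
      (λ { (p ∷ l) → p , l }) (λ (p , l) → p ∷ l))
    (𝟙-× (lo ℕ.≤? x) (linked? ℕ._≤?_ (x ∷ R)))

-- The largest admissible entry `n` can only fill the end of a weakly increasing row; `k` counts the
-- entries before it.
rowSum-suc : ∀ n a {lo} (f : List ℕ → ℤ) → lo ≤ n →
  rowSum (suc n) a lo f ≡ Σ< (suc a) λ k → rowSum n k lo λ R → f (R ++ replicate (a ∸ k) n)
rowSum-suc n zero    f lo≤n = sym (ℤ.+-identityˡ (f []))
rowSum-suc n (suc a) {lo} f lo≤n = begin
  Σ< n (λ x → 𝟙 (lo ℕ.≤? x) ⊗ rowSum (suc n) a x (f ∘ (x ∷_))) ⊕ 𝟙 (lo ℕ.≤? n) ⊗ rowSum (suc n) a n (f ∘ (n ∷_))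
    ≡⟨ cong₂ _⊕_ smaller (trans (𝟙-⊗-yes (lo ℕ.≤? n) lo≤n) constant) ⟩
  Σ< (suc a) (λ k → rowSum n (suc k) lo (λ R → f (R ++ replicate (a ∸ k) n))) ⊕ f (n ∷ replicate a n)
    ≡⟨ ℤ.+-comm (Σ< (suc a) (λ k → rowSum n (suc k) lo (λ R → f (R ++ replicate (a ∸ k) n)))) _ ⟩
  f (n ∷ replicate a n) ⊕ Σ< (suc a) (λ k → rowSum n (suc k) lo (λ R → f (R ++ replicate (a ∸ k) n)))
    ≡⟨ Σ<-head (suc a) (λ k → rowSum n k lo (λ R → f (R ++ replicate (suc a ∸ k) n))) ⟨
  Σ< (suc (suc a)) (λ k → rowSum n k lo (λ R → f (R ++ replicate (suc a ∸ k) n))) ∎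
  where
  open ≡-Reasoning
  smaller : Σ< n (λ x → 𝟙 (lo ℕ.≤? x) ⊗ rowSum (suc n) a x (f ∘ (x ∷_))) ≡
            Σ< (suc a) (λ k → rowSum n (suc k) lo (λ R → f (R ++ replicate (a ∸ k) n)))
  smaller = trans
    (Σ<-cong n (λ {x} x<n → trans (cong (𝟙 (lo ℕ.≤? x) ⊗_) (rowSum-suc n a (f ∘ (x ∷_)) (ℕ.<⇒≤ x<n)))
      (sym (Σ<-linear (suc a) .scale (𝟙 (lo ℕ.≤? x)) _))))
    (Σ<-swap (Σ<-linear n) (suc a) _)
  constant : rowSum (suc n) a n (f ∘ (n ∷_)) ≡ f (n ∷ replicate a n)
  constant = begin
    rowSum (suc n) a n (f ∘ (n ∷_))
      ≡⟨ rowSum-suc n a (f ∘ (n ∷_)) ℕ.≤-refl ⟩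
    Σ< (suc a) (λ k → rowSum n k n (λ R → f (n ∷ R ++ replicate (a ∸ k) n)))
      ≡⟨ Σ<-head a _ ⟩
    f (n ∷ replicate a n) ⊕ Σ< a (λ k → rowSum n (suc k) n (λ R → f (n ∷ R ++ replicate (a ∸ suc k) n)))
      ≡⟨ ⊕-congˡ (f (n ∷ replicate a n)) (Σ<-zero a (λ _ → Σ<-zero n (λ {x} x<n → 𝟙-⊗-no (n ℕ.≤? x) (ℕ.<⇒≱ x<n)))) ⟩
    f (n ∷ replicate a n) ⊕ 0ℤ
      ≡⟨ ℤ.+-identityʳ _ ⟩
    f (n ∷ replicate a n) ∎

Columns : List ℕ → List ℕ → Set
Columns R S = All (uncurry _<_) (zip R S)

columns? : ∀ R S → Dec (Columns R S)
columns? R S = all? (λ (a , b) → a ℕ.<? b) (zip R S)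

columns-emptyʳ : ∀ R → Columns R []
columns-emptyʳ []      = []
columns-emptyʳ (_ ∷ _) = []

module _ {n : ℕ} where

  -- No entry can stand below an `n`, so the entire lower row, with its own entries `n`, fits under
  -- `R`. The assumption on lengths says that the padded lower row is no longer than the padded
  -- upper one; otherwise `zip` would silently drop the overhang.
  columns-++⁻ : ∀ {R S} p q → All (_< n) R → All (_< n) S → length S + q ≤ length R + p →
    Columns (R ++ replicate p n) (S ++ replicate q n) → length S + q ≤ length R × Columns R S
  columns-++⁻ {[]}    {[]}    p       zero    _ _ _ _ = z≤n , []
  columns-++⁻ {[]}    {[]}    (suc p) (suc q) _ _ _ (n<n ∷ _) = contradiction n<n (ℕ.<-irrefl refl)
  columns-++⁻ {[]}    {_ ∷ _} (suc p) q       _ (y<n ∷ _) _ (n<y ∷ _) = contradiction n<y (ℕ.<-asym y<n)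
  columns-++⁻ {_ ∷ _} {[]}    p       zero    _ _ _ _ = z≤n , []
  columns-++⁻ {_ ∷ R} {[]}    p       (suc q) (_ ∷ R<n) [] (s≤s le) (_ ∷ cs) =
    s≤s (proj₁ (columns-++⁻ {R} {[]} p q R<n [] le cs)) , []
  columns-++⁻ {_ ∷ R} {_ ∷ S} p       q       (_ ∷ R<n) (_ ∷ S<n) (s≤s le) (c ∷ cs) =
    let le′ , cs′ = columns-++⁻ {R} {S} p q R<n S<n le cs in s≤s le′ , c ∷ cs′

  columns-++⁺ : ∀ {R S} p q → All (_< n) R → length S + q ≤ length R → Columns R S →
                Columns (R ++ replicate p n) (S ++ replicate q n)
  columns-++⁺ {R}     {[]}    p zero    _ _ _ = columns-emptyʳ (R ++ replicate p n)
  columns-++⁺ {_ ∷ R} {[]}    p (suc q) (x<n ∷ R<n) (s≤s le) _ =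
    x<n ∷ columns-++⁺ {R} {[]} p q R<n le (columns-emptyʳ R)
  columns-++⁺ {_ ∷ R} {_ ∷ S} p q (_ ∷ R<n) (s≤s le) (c ∷ cs) = c ∷ columns-++⁺ {R} {S} p q R<n le cs

  𝟙-columns-++ : ∀ {R S} p a → All (_< n) R → All (_< n) S → length S ≤ a → a ≤ length R + p →
    𝟙 (columns? (R ++ replicate p n) (S ++ replicate (a ∸ length S) n)) ≡
    𝟙 (a ℕ.≤? length R) ⊗ 𝟙 (columns? R S)
  𝟙-columns-++ {R} {S} p a R<n S<n S≤a a≤ = trans
    (𝟙-cong (columns? _ _) (a ℕ.≤? length R ×-dec columns? R S)
      (λ cs → let le , cs′ = columns-++⁻ p q R<n S<n (subst (_≤ length R + p) (sym a≡) a≤) cs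
              in subst (_≤ length R) a≡ le , cs′)
      (λ (le , cs) → columns-++⁺ p q R<n (subst (_≤ length R) (sym a≡) le) cs))
    (𝟙-× (a ℕ.≤? length R) (columns? R S))
    where
    q = a ∸ length S
    a≡ : length S + q ≡ a
    a≡ = ℕ.m+[n∸m]≡n S≤a

-- The sum over the semistandard tableaux of the given shape with entries
-- below n that remain semistandard when the row prev is put on top.
tabSum : ℕ → List ℕ → List ℕ → (List (List ℕ) → ℤ) → ℤ
tabSum n []      prev g = g []
tabSum n (a ∷ κ) prev g = rowSum n a 0 λ R → 𝟙 (columns? prev R) ⊗ tabSum n κ R λ T → g (R ∷ T)

∑-tableaux : ∀ n κ prev (g : List (List ℕ) → ℤ) →
  ∑ (fillings n κ) (λ T → (𝟙 (all? (linked? ℕ._≤?_) T) ⊗ 𝟙 (linked? columns? (prev ∷ T))) ⊗ g T) ≡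
  tabSum n κ prev g
∑-tableaux n []      prev g = trans (ℤ.+-identityʳ _) (ℤ.*-identityˡ (g []))
∑-tableaux n (a ∷ κ) prev g = begin
  ∑ (fillings n (a ∷ κ)) (λ T → (𝟙 (all? (linked? ℕ._≤?_) T) ⊗ 𝟙 (linked? columns? (prev ∷ T))) ⊗ g T)
    ≡⟨ ∑-cartesianProductWith _∷_ firstRows (fillings n κ) _ ⟩
  ∑ firstRows (λ R → ∑ (fillings n κ) λ T →
    (𝟙 (all? (linked? ℕ._≤?_) (R ∷ T)) ⊗ 𝟙 (linked? columns? (prev ∷ R ∷ T))) ⊗ g (R ∷ T))
    ≡⟨ ∑-cong-∈ firstRows (λ {R} _ → trans
         (∑-cong-∈ (fillings n κ) (λ {T} _ → trans (cong (_⊗ g (R ∷ T)) (cong₂ _⊗_ (rows-factor R T) (columns-factor R T)))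
           (regroup (𝟙 (linked? ℕ._≤?_ (0 ∷ R))) _ (𝟙 (columns? prev R)) _ (g (R ∷ T)))))
         (trans (∑-linear (fillings n κ) .scale (𝟙 (linked? ℕ._≤?_ (0 ∷ R))) _)
           (cong (𝟙 (linked? ℕ._≤?_ (0 ∷ R)) ⊗_) (trans (∑-linear (fillings n κ) .scale (𝟙 (columns? prev R)) _)
             (cong (𝟙 (columns? prev R) ⊗_) (∑-tableaux n κ R (g ∘ (R ∷_)))))))) ⟩
  ∑ firstRows (λ R → 𝟙 (linked? ℕ._≤?_ (0 ∷ R)) ⊗ (𝟙 (columns? prev R) ⊗ tabSum n κ R (g ∘ (R ∷_))))
    ≡⟨ ∑-rows n a 0 _ ⟩
  tabSum n (a ∷ κ) prev g ∎
  where
  open ≡-Reasoning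
  firstRows = choices (replicate a (upTo n))
  regroup : ∀ a b c d e → ((a ⊗ b) ⊗ (c ⊗ d)) ⊗ e ≡ a ⊗ (c ⊗ ((b ⊗ d) ⊗ e))
  regroup = solve-∀
  linked-0 : ∀ {R} → Linked _≤_ R → Linked _≤_ (0 ∷ R)
  linked-0 []      = [-]
  linked-0 [-]     = z≤n ∷ [-]
  linked-0 (p ∷ l) = z≤n ∷ p ∷ l
  linked-0⁻ : ∀ {R} → Linked _≤_ (0 ∷ R) → Linked _≤_ R
  linked-0⁻ [-]     = []
  linked-0⁻ (_ ∷ l) = l
  rows-factor : ∀ R T → 𝟙 (all? (linked? ℕ._≤?_) (R ∷ T)) ≡ 𝟙 (linked? ℕ._≤?_ (0 ∷ R)) ⊗ 𝟙 (all? (linked? ℕ._≤?_) T)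
  rows-factor R T = trans
    (𝟙-cong (all? (linked? ℕ._≤?_) (R ∷ T)) (linked? ℕ._≤?_ (0 ∷ R) ×-dec all? (linked? ℕ._≤?_) T)
      (λ { (l ∷ ls) → linked-0 l , ls }) (λ (l , ls) → linked-0⁻ l ∷ ls))
    (𝟙-× (linked? ℕ._≤?_ (0 ∷ R)) (all? (linked? ℕ._≤?_) T))
  columns-factor : ∀ R T → 𝟙 (linked? columns? (prev ∷ R ∷ T)) ≡ 𝟙 (columns? prev R) ⊗ 𝟙 (linked? columns? (R ∷ T))
  columns-factor R T = trans
    (𝟙-cong (linked? columns? (prev ∷ R ∷ T)) (columns? prev R ×-dec linked? columns? (R ∷ T))
      (λ { (c ∷ l) → c , l }) (λ (c , l) → c ∷ l))
    (𝟙-× (columns? prev R) (linked? columns? (R ∷ T)))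

s-tabSum : ∀ κ α → s κ α ≡ tabSum (length α) κ [] λ T → 𝟙 (content (length α) T ≟ᴸ α)
s-tabSum κ α = begin
  + length (filter counted? (fillings n κ))
    ≡⟨ length-as-∑ (filter counted? (fillings n κ)) ⟩
  ∑ (filter counted? (fillings n κ)) (λ _ → 1ℤ)
    ≡⟨ ∑-filter counted? (fillings n κ) (λ _ → 1ℤ) ⟩
  ∑ (fillings n κ) (λ T → 𝟙 (counted? T) ⊗ 1ℤ)
    ≡⟨ ∑-cong-∈ (fillings n κ) (λ {T} _ → trans (ℤ.*-identityʳ (𝟙 (counted? T)))
         (trans (𝟙-× (semistandard? T) (content n T ≟ᴸ α)) (cong (_⊗ 𝟙 (content n T ≟ᴸ α)) (factor T)))) ⟩
  ∑ (fillings n κ) (λ T → (𝟙 (all? (linked? ℕ._≤?_) T) ⊗ 𝟙 (linked? columns? ([] ∷ T))) ⊗ 𝟙 (content n T ≟ᴸ α))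
    ≡⟨ ∑-tableaux n κ [] _ ⟩
  tabSum n κ [] (λ T → 𝟙 (content n T ≟ᴸ α)) ∎
  where
  open ≡-Reasoning
  n = length α
  counted? : Decidable (λ T → Semistandard T × content n T ≡ α)
  counted? T = semistandard? T ×-dec (content n T ≟ᴸ α)
  linked-[] : ∀ {T} → Linked Columns T → Linked Columns ([] ∷ T)
  linked-[] []      = [-]
  linked-[] [-]     = [] ∷ [-]
  linked-[] (c ∷ l) = [] ∷ c ∷ l
  linked-[]⁻ : ∀ {T} → Linked Columns ([] ∷ T) → Linked Columns T
  linked-[]⁻ [-]     = []
  linked-[]⁻ (_ ∷ l) = l
  factor : ∀ T → 𝟙 (semistandard? T) ≡ 𝟙 (all? (linked? ℕ._≤?_) T) ⊗ 𝟙 (linked? columns? ([] ∷ T))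
  factor T = trans
    (𝟙-cong (semistandard? T) (all? (linked? ℕ._≤?_) T ×-dec linked? columns? ([] ∷ T))
      (λ (r , c) → r , linked-[] c) (λ (r , c) → r , linked-[]⁻ c))
    (𝟙-× (all? (linked? ℕ._≤?_) T) (linked? columns? ([] ∷ T)))

-- The branching rule

-- The sum over all lists with `a₁ ≥ l₁ ≥ a₂ ≥ l₂ ≥ …`, the shapes that remain when a horizontal
-- strip is erased. The argument `k` carries the previous `l`, which bounds the next part from
-- above.
interlacingSum : ℕ → List ℕ → (List ℕ → ℤ) → ℤ
interlacingSum k []      F = F []
interlacingSum k (a ∷ κ) F = 𝟙 (a ℕ.≤? k) ⊗ Σ< (suc a) λ l → interlacingSum l κ λ ls → F (l ∷ ls)

data Interlaced : ℕ → List ℕ → List ℕ → Set where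
  []   : ∀ {k} → Interlaced k [] []
  cons : ∀ {k a l κ ls} → a ≤ k → l ≤ a → Interlaced l κ ls → Interlaced k (a ∷ κ) (l ∷ ls)

interlacingSum-cong : ∀ k κ {F G : List ℕ → ℤ} → (∀ {ls} → Interlaced k κ ls → F ls ≡ G ls) →
                      interlacingSum k κ F ≡ interlacingSum k κ G
interlacingSum-cong k []      e = e []
interlacingSum-cong k (a ∷ κ) e = 𝟙-⊗-cong (a ℕ.≤? k) (λ a≤k → Σ<-cong (suc a) (λ {l} l≤a →
  interlacingSum-cong l κ (λ i → e (cons a≤k (s≤s⁻¹ l≤a) i))))

interlacingSum-swap : {L : (B → ℤ) → ℤ} → Linear L → ∀ k κ (F : List ℕ → B → ℤ) →
  L (λ b → interlacingSum k κ λ ls → F ls b) ≡ interlacingSum k κ λ ls → L (F ls)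
interlacingSum-swap lin k []      F = refl
interlacingSum-swap lin k (a ∷ κ) F = trans (lin .scale (𝟙 (a ℕ.≤? k)) _)
  (cong (𝟙 (a ℕ.≤? k) ⊗_) (trans (Σ<-swap lin (suc a) _)
    (Σ<-cong (suc a) (λ {l} _ → interlacingSum-swap lin l κ (λ ls → F (l ∷ ls))))))

scaling-linear : ∀ c (b : B) → Linear (λ f → c ⊗ f b)
scaling-linear c b .cong-≗ e = cong (c ⊗_) (e b)
scaling-linear c b .add f g = ℤ.*-distribˡ-+ c (f b) (g b)
scaling-linear c b .scale k f = ⊗-exchange c k (f b)

extend : ℕ → List ℕ → List (List ℕ) → List (List ℕ)
extend n (a ∷ κ) (R ∷ T) = (R ++ replicate (a ∸ length R) n) ∷ extend n κ T
extend n _       _       = []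

-- The condition on `prev` is abstracted so that one argument covers the first row, where nothing
-- stands above and `k` is `a`, and the later rows, where `prev` is `R₀` padded with entries `n` and
-- `k` is the length of `R₀`.
tabSum-suc : ∀ n a κ prev R₀ k (g : List (List ℕ) → ℤ) →
  (∀ {R} → All (_< n) R → length R ≤ a →
    𝟙 (columns? prev (R ++ replicate (a ∸ length R) n)) ≡ 𝟙 (a ℕ.≤? k) ⊗ 𝟙 (columns? R₀ R)) →
  Linked _≥_ (a ∷ κ) →
  tabSum (suc n) (a ∷ κ) prev g ≡ interlacingSum k (a ∷ κ) λ ls → tabSum n ls R₀ λ T → g (extend n (a ∷ κ) T)

tabSum-suc-below : ∀ n κ R p (g : List (List ℕ) → ℤ) → All (_< n) R → part κ 0 ≤ length R + p → Linked _≥_ κ →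
  tabSum (suc n) κ (R ++ replicate p n) g ≡ interlacingSum (length R) κ λ ls → tabSum n ls R λ T → g (extend n κ T)

tabSum-suc n a κ prev R₀ k g prev-columns κ≥ = begin
  rowSum (suc n) a 0 (λ R → 𝟙 (columns? prev R) ⊗ tabSum (suc n) κ R (g ∘ (R ∷_)))
    ≡⟨ rowSum-suc n a _ z≤n ⟩
  Σ< (suc a) (λ l → rowSum n l 0 λ R → 𝟙 (columns? prev (R ++ replicate (a ∸ l) n)) ⊗
    tabSum (suc n) κ (R ++ replicate (a ∸ l) n) (g ∘ ((R ++ replicate (a ∸ l) n) ∷_)))
    ≡⟨ Σ<-cong (suc a) (λ {l} l≤a → trans (rowSum-cong n l 0 (term (s≤s⁻¹ l≤a)))
         (trans (rowSum-linear n l 0 .scale (𝟙 (a ℕ.≤? k)) _)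
                (cong (𝟙 (a ℕ.≤? k) ⊗_) (interlacingSum-swap (rowSum-linear n l 0) l κ _)))) ⟩
  Σ< (suc a) (λ l → 𝟙 (a ℕ.≤? k) ⊗ interlacingSum l κ λ ls → tabSum n (l ∷ ls) R₀ λ T → g (extend n (a ∷ κ) T))
    ≡⟨ Σ<-linear (suc a) .scale (𝟙 (a ℕ.≤? k)) _ ⟩
  interlacingSum k (a ∷ κ) (λ ls → tabSum n ls R₀ λ T → g (extend n (a ∷ κ) T)) ∎
  where
  open ≡-Reasoning
  next≤ : ∀ {κ} → Linked _≥_ (a ∷ κ) → part κ 0 ≤ a
  next≤ [-]     = z≤n
  next≤ (b ∷ _) = b
  tail≥ : ∀ {κ} → Linked _≥_ (a ∷ κ) → Linked _≥_ κ
  tail≥ [-]     = []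
  tail≥ (_ ∷ l) = l
  term : ∀ {l R} → l ≤ a → length R ≡ l → All (_< n) R →
    𝟙 (columns? prev (R ++ replicate (a ∸ l) n)) ⊗
      tabSum (suc n) κ (R ++ replicate (a ∸ l) n) (g ∘ ((R ++ replicate (a ∸ l) n) ∷_)) ≡
    𝟙 (a ℕ.≤? k) ⊗ (interlacingSum l κ λ ls → 𝟙 (columns? R₀ R) ⊗ tabSum n ls R λ T → g (extend n (a ∷ κ) (R ∷ T)))
  term {R = R} l≤a refl R<n = begin
    𝟙 (columns? prev (R ++ replicate (a ∸ length R) n)) ⊗
      tabSum (suc n) κ (R ++ replicate (a ∸ length R) n) (g ∘ ((R ++ replicate (a ∸ length R) n) ∷_))
      ≡⟨ cong₂ _⊗_ (prev-columns R<n l≤a)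
           (tabSum-suc-below n κ R (a ∸ length R) _ R<n
             (subst (part κ 0 ≤_) (sym (ℕ.m+[n∸m]≡n l≤a)) (next≤ κ≥)) (tail≥ κ≥)) ⟩
    (𝟙 (a ℕ.≤? k) ⊗ 𝟙 (columns? R₀ R)) ⊗ rest
      ≡⟨ ℤ.*-assoc (𝟙 (a ℕ.≤? k)) (𝟙 (columns? R₀ R)) rest ⟩
    𝟙 (a ℕ.≤? k) ⊗ (𝟙 (columns? R₀ R) ⊗ rest)
      ≡⟨ cong (𝟙 (a ℕ.≤? k) ⊗_) (interlacingSum-swap (scaling-linear (𝟙 (columns? R₀ R)) R) (length R) κ (λ ls _ → tail ls)) ⟩
    𝟙 (a ℕ.≤? k) ⊗ interlacingSum (length R) κ (λ ls → 𝟙 (columns? R₀ R) ⊗ tail ls) ∎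
    where
    tail : List ℕ → ℤ
    tail ls = tabSum n ls R λ T → g (extend n (a ∷ κ) (R ∷ T))
    rest = interlacingSum (length R) κ tail

tabSum-suc-below n []      R p g R<n le κ≥ = refl
tabSum-suc-below n (a ∷ κ) R p g R<n le κ≥ =
  tabSum-suc n a κ (R ++ replicate p n) R (length R) g
    (λ S<n S≤a → 𝟙-columns-++ p a R<n S<n S≤a le) κ≥

data Rows (n : ℕ) : List ℕ → List (List ℕ) → Set where
  []  : Rows n [] []
  _∷_ : ∀ {a κ R T} → length R ≡ a × All (_< n) R → Rows n κ T → Rows n (a ∷ κ) (R ∷ T)

tabSum-cong : ∀ n κ prev {f g : List (List ℕ) → ℤ} → (∀ {T} → Rows n κ T → f T ≡ g T) →
              tabSum n κ prev f ≡ tabSum n κ prev g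
tabSum-cong n []      prev e = e []
tabSum-cong n (a ∷ κ) prev e = rowSum-cong n a 0 (λ {R} len below →
  cong (𝟙 (columns? prev R) ⊗_) (tabSum-cong n κ R (λ rows → e ((len , below) ∷ rows))))

tabSum-scale : ∀ n κ prev c (g : List (List ℕ) → ℤ) →
               tabSum n κ prev (λ T → c ⊗ g T) ≡ c ⊗ tabSum n κ prev g
tabSum-scale n []      prev c g = refl
tabSum-scale n (a ∷ κ) prev c g = trans
  (rowSum-linear n a 0 .cong-≗ (λ R → trans (cong (𝟙 (columns? prev R) ⊗_) (tabSum-scale n κ R c (g ∘ (R ∷_))))
                                            (⊗-exchange (𝟙 (columns? prev R)) c _)))
  (rowSum-linear n a 0 .scale c _)

-- Contents after restoring the largest entries

count : ℕ → List ℕ → ℕ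
count k R = length (filter (k ℕ.≟_) R)

count-++ : ∀ k R S → count k (R ++ S) ≡ count k R + count k S
count-++ k R S = trans (cong length (List.filter-++ (k ℕ.≟_) R S)) (List.length-++ (filter (k ℕ.≟_) R))

count-replicate-≡ : ∀ n p → count n (replicate p n) ≡ p
count-replicate-≡ n zero    = refl
count-replicate-≡ n (suc p) = trans (cong length (List.filter-accept (n ℕ.≟_) {xs = replicate p n} refl))
                                    (cong suc (count-replicate-≡ n p))

count-replicate-≢ : ∀ {k n} p → k ≢ n → count k (replicate p n) ≡ 0
count-replicate-≢         zero    k≢n = refl
count-replicate-≢ {k} {n} (suc p) k≢n = trans (cong length (List.filter-reject (k ℕ.≟_) {xs = replicate p n} k≢n))
                                              (count-replicate-≢ p k≢n)

count-below : ∀ {n R} → All (_< n) R → count n R ≡ 0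
count-below     []        = refl
count-below {n} {_ ∷ R} (x<n ∷ R<n) = trans (cong length (List.filter-reject (n ℕ.≟_) {xs = R} (ℕ.>⇒≢ x<n)))
                                            (count-below R<n)

count-extend-< : ∀ {k n κ ls T} → k < n → length κ ≡ length ls → Rows n ls T →
                 count k (concat (extend n κ T)) ≡ count k (concat T)
count-extend-< {κ = []}    k<n _ [] = refl
count-extend-< {k} {n} {a ∷ κ} {T = R ∷ T} k<n len (_ ∷ rows) = begin
  count k ((R ++ replicate q n) ++ concat (extend n κ T))
    ≡⟨ count-++ k (R ++ replicate q n) _ ⟩
  count k (R ++ replicate q n) + count k (concat (extend n κ T))
    ≡⟨ cong₂ _+_ (trans (count-++ k R (replicate q n))
                   (trans (cong (_+_ (count k R)) (count-replicate-≢ q (ℕ.<⇒≢ k<n))) (ℕ.+-identityʳ _)))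
                 (count-extend-< {κ = κ} k<n (ℕ.suc-injective len) rows) ⟩
  count k R + count k (concat T)
    ≡⟨ count-++ k R (concat T) ⟨
  count k (R ++ concat T) ∎
  where
  open ≡-Reasoning
  q = a ∸ length R

count-extend-≡ : ∀ {j n κ ls T} → Interlaced j κ ls → Rows n ls T →
                 count n (concat (extend n κ T)) + sum ls ≡ sum κ
count-extend-≡ [] [] = refl
count-extend-≡ {n = n} {a ∷ κ} {l ∷ ls} {R ∷ T} (cons _ l≤a i) ((refl , R<n) ∷ rows) = begin
  count n ((R ++ replicate q n) ++ concat (extend n κ T)) + (l + sum ls)
    ≡⟨ cong (_+ (l + sum ls)) (count-++ n (R ++ replicate q n) _) ⟩
  count n (R ++ replicate q n) + c + (l + sum ls)
    ≡⟨ cong (λ u → u + c + (l + sum ls)) (trans (count-++ n R (replicate q n))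
         (cong₂ _+_ (count-below R<n) (count-replicate-≡ n q))) ⟩
  q + c + (l + sum ls)
    ≡⟨ lemma q c l (sum ls) ⟩
  q + l + (c + sum ls)
    ≡⟨ cong₂ _+_ (ℕ.m∸n+n≡m l≤a) (count-extend-≡ i rows) ⟩
  a + sum κ ∎
  where
  open ≡-Reasoning
  q = a ∸ l
  c = count n (concat (extend n κ T))
  lemma : ∀ a b c d → a + b + (c + d) ≡ a + c + (b + d)
  lemma = ℕS.solve-∀

interlaced-length : ∀ {k κ ls} → Interlaced k κ ls → length κ ≡ length ls
interlaced-length []           = refl
interlaced-length (cons _ _ i) = cong suc (interlaced-length i)

content-extend : ∀ {j n κ ls T} → Interlaced j κ ls → Rows n ls T →
                 content (suc n) (extend n κ T) ≡ content n T ∷ʳ count n (concat (extend n κ T))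
content-extend {n = n} {κ} {ls} {T} i rows = begin
  map (λ k → count k (concat (extend n κ T))) (upTo (suc n))
    ≡⟨ cong (map (λ k → count k (concat (extend n κ T)))) (List.upTo-∷ʳ n) ⟨
  map (λ k → count k (concat (extend n κ T))) (upTo n ∷ʳ n)
    ≡⟨ List.map-++ _ (upTo n) (n ∷ []) ⟩
  map (λ k → count k (concat (extend n κ T))) (upTo n) ∷ʳ count n (concat (extend n κ T))
    ≡⟨ cong (_∷ʳ count n (concat (extend n κ T))) (List.map-cong-local
         (All⁺.applyUpTo⁺₁ id n (λ k<n → count-extend-< {κ = κ} k<n (interlaced-length i) rows))) ⟩
  content n T ∷ʳ count n (concat (extend n κ T)) ∎
  where open ≡-Reasoning

-- The last variable is the one to split off, since its entries are the largest and sit at the ends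
-- of the rows. This is why `S` reads the content backwards. The exponent `a` counts the erased
-- boxes.
s-branching : ∀ {κ} → Linked _≥_ κ → ∀ α a →
  s κ (α ∷ʳ a) ≡ interlacingSum (part κ 0) κ λ ls → 𝟙 (sum κ ℕ.≟ sum ls + a) ⊗ s ls α
s-branching {κ} κ≥ α a = begin
  s κ (α ∷ʳ a)
    ≡⟨ s-tabSum κ (α ∷ʳ a) ⟩
  tabSum (length (α ∷ʳ a)) κ [] (λ T → 𝟙 (content (length (α ∷ʳ a)) T ≟ᴸ (α ∷ʳ a)))
    ≡⟨ cong (λ n → tabSum n κ [] (λ T → 𝟙 (content n T ≟ᴸ (α ∷ʳ a)))) (trans (List.length-++ α) (ℕ.+-comm n 1)) ⟩
  tabSum (suc n) κ [] (λ T → 𝟙 (content (suc n) T ≟ᴸ (α ∷ʳ a)))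
    ≡⟨ branch κ≥ ⟩
  interlacingSum (part κ 0) κ (λ ls → tabSum n ls [] (λ T → 𝟙 (content (suc n) (extend n κ T) ≟ᴸ (α ∷ʳ a))))
    ≡⟨ interlacingSum-cong (part κ 0) κ (λ {ls} i → trans (tabSum-cong n ls [] (term i))
         (trans (tabSum-scale n ls [] (𝟙 (sum κ ℕ.≟ sum ls + a)) _)
                (cong (𝟙 (sum κ ℕ.≟ sum ls + a) ⊗_) (sym (s-tabSum ls α))))) ⟩
  interlacingSum (part κ 0) κ (λ ls → 𝟙 (sum κ ℕ.≟ sum ls + a) ⊗ s ls α) ∎
  where
  open ≡-Reasoning
  n = length α
  branch : ∀ {κ} {g : List (List ℕ) → ℤ} → Linked _≥_ κ →
    tabSum (suc n) κ [] g ≡ interlacingSum (part κ 0) κ λ ls → tabSum n ls [] λ T → g (extend n κ T)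
  branch {[]}    _  = refl
  branch {b ∷ κ} {g} κ≥ = tabSum-suc n b κ [] [] b g
    (λ {R} _ _ → sym (trans (cong (_⊗ 1ℤ) (𝟙-yes (b ℕ.≤? b) ℕ.≤-refl)) refl)) κ≥
  term : ∀ {ls T} → Interlaced (part κ 0) κ ls → Rows n ls T →
    𝟙 (content (suc n) (extend n κ T) ≟ᴸ (α ∷ʳ a)) ≡ 𝟙 (sum κ ℕ.≟ sum ls + a) ⊗ 𝟙 (content n T ≟ᴸ α)
  term {ls} {T} i rows = trans
    (𝟙-cong (content (suc n) (extend n κ T) ≟ᴸ (α ∷ʳ a)) (sum κ ℕ.≟ sum ls + a ×-dec content n T ≟ᴸ α) to from)
    (𝟙-× (sum κ ℕ.≟ sum ls + a) (content n T ≟ᴸ α))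
    where
    c = count n (concat (extend n κ T))
    to : content (suc n) (extend n κ T) ≡ α ∷ʳ a → sum κ ≡ sum ls + a × content n T ≡ α
    to e with List.∷ʳ-injective (content n T) α (trans (sym (content-extend i rows)) e)
    ... | e₁ , e₂ = trans (sym (count-extend-≡ i rows)) (trans (cong (_+ sum ls) e₂) (ℕ.+-comm a (sum ls))) , e₁
    from : sum κ ≡ sum ls + a × content n T ≡ α → content (suc n) (extend n κ T) ≡ α ∷ʳ a
    from (e₁ , e₂) = trans (content-extend i rows) (cong₂ _∷ʳ_ e₂ (ℕ.+-cancelʳ-≡ (sum ls) c a
      (trans (count-extend-≡ i rows) (trans e₁ (ℕ.+-comm (sum ls) a)))))

-- Schur functions in terms of beads

interlaced-≥ : ∀ {k κ ls} → Interlaced k κ ls → Linked _≥_ ls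
interlaced-≥ []                                    = []
interlaced-≥ (cons _ _ [])                         = [-]
interlaced-≥ (cons _ _ i@(cons b≤l l′≤b _)) = ℕ.≤-trans l′≤b b≤l ∷ interlaced-≥ i

interlaced-part : ∀ {k κ ls} → Interlaced k κ ls → ∀ i → part κ (suc i) ≤ part ls i
interlaced-part []                          i       = z≤n
interlaced-part (cons _ _ [])               i       = z≤n
interlaced-part (cons _ _ (cons b≤l _ _))   zero    = b≤l
interlaced-part (cons _ _ il@(cons _ _ _)) (suc i) = interlaced-part il i

interlacingSum-zero : ∀ k κ {F : List ℕ → ℤ} → (∀ {ls} → Interlaced k κ ls → F ls ≡ 0ℤ) →
                      interlacingSum k κ F ≡ 0ℤ
interlacingSum-zero k κ z = trans (interlacingSum-cong k κ z) (go k κ)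
  where
  go : ∀ k κ → interlacingSum k κ (λ _ → 0ℤ) ≡ 0ℤ
  go k []      = refl
  go k (a ∷ κ) = trans (cong (𝟙 (a ℕ.≤? k) ⊗_) (Σ<-zero (suc a) (λ {l} _ → go l κ))) (ℤ.*-zeroʳ (𝟙 (a ℕ.≤? k)))

-- By `interlaced-part`, erasing one variable shortens the shape by at most one row. A row is
-- therefore still left when the variables run out, and it cannot be filled.
s-too-long : ∀ ρ {κ} → Linked _≥_ κ → 0 < part κ (length ρ) → s κ (reverse ρ) ≡ 0ℤ
s-too-long []      {suc a ∷ κ} κ≥ _     = s-tabSum (suc a ∷ κ) []
s-too-long (a ∷ ρ) {κ}         κ≥ 0<κ = begin
  s κ (reverse (a ∷ ρ))
    ≡⟨ cong (s κ) (List.unfold-reverse a ρ) ⟩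
  s κ (reverse ρ ∷ʳ a)
    ≡⟨ s-branching κ≥ (reverse ρ) a ⟩
  interlacingSum (part κ 0) κ (λ ls → 𝟙 (sum κ ℕ.≟ sum ls + a) ⊗ s ls (reverse ρ))
    ≡⟨ interlacingSum-zero (part κ 0) κ (λ {ls} i → trans
         (cong (𝟙 (sum κ ℕ.≟ sum ls + a) ⊗_)
           (s-too-long ρ (interlaced-≥ i) (ℕ.<-≤-trans 0<κ (interlaced-part i (length ρ)))))
         (ℤ.*-zeroʳ (𝟙 (sum κ ℕ.≟ sum ls + a)))) ⟩
  0ℤ ∎
  where open ≡-Reasoning

-- Bead lists have one entry per variable, so shapes have to be padded with zero parts, and
-- interlacing lists may end in zeros as well.
s-trailing-zero : ∀ κ α → s (κ ∷ʳ 0) α ≡ s κ α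
s-trailing-zero κ α = begin
  s (κ ∷ʳ 0) α
    ≡⟨ s-tabSum (κ ∷ʳ 0) α ⟩
  tabSum n (κ ∷ʳ 0) [] (λ T → 𝟙 (content n T ≟ᴸ α))
    ≡⟨ tabSum-empty-row κ [] ⟩
  tabSum n κ [] (λ T → 𝟙 (content n (T ∷ʳ []) ≟ᴸ α))
    ≡⟨ tabSum-cong n κ [] (λ {T} _ → cong (λ R → 𝟙 (map (λ k → count k R) (upTo n) ≟ᴸ α))
         (trans (sym (List.concat-++ T ([] ∷ []))) (List.++-identityʳ (concat T)))) ⟩
  tabSum n κ [] (λ T → 𝟙 (content n T ≟ᴸ α))
    ≡⟨ s-tabSum κ α ⟨
  s κ α ∎
  where
  open ≡-Reasoning
  n = length α
  tabSum-empty-row : ∀ κ prev {g} → tabSum n (κ ∷ʳ 0) prev g ≡ tabSum n κ prev (λ T → g (T ∷ʳ []))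
  tabSum-empty-row []      prev = 𝟙-⊗-yes (columns? prev []) (columns-emptyʳ prev)
  tabSum-empty-row (a ∷ κ) prev = rowSum-linear n a 0 .cong-≗ (λ R →
    cong (𝟙 (columns? prev R) ⊗_) (tabSum-empty-row κ R))

-- An interlacing list has as many parts as the shape, but only one variable fewer is left. A
-- positive last part thus makes the shape too long for it, and the last part is dropped as zero. In
-- terms of beads the weak inequalities `a ≤ l ≤ b` become the half-open interval from
-- `a + length κ` to `b + suc (length κ)`.
interlacingSum-J : ∀ b κ (F : List ℕ → ℤ) {φ : List ℕ → ℤ} → Linked _≥_ (b ∷ κ) →
  (∀ ls → Interlaced b (b ∷ κ) (ls ∷ʳ 0) → F (ls ∷ʳ 0) ≡ φ (beads (length κ) (part ls))) →
  (∀ ls x → Interlaced b (b ∷ κ) (ls ∷ʳ suc x) → F (ls ∷ʳ suc x) ≡ 0ℤ) →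
  interlacingSum b (b ∷ κ) F ≡ J (beads (suc (length κ)) (part (b ∷ κ))) φ
interlacingSum-J b [] F {φ} κ≥ last-zero last-suc = begin
  𝟙 (b ℕ.≤? b) ⊗ Σ< (suc b) (λ l → F (l ∷ []))
    ≡⟨ 𝟙-⊗-yes (b ℕ.≤? b) ℕ.≤-refl ⟩
  Σ< (suc b) (λ l → F (l ∷ []))
    ≡⟨ Σ<-head b (λ l → F (l ∷ [])) ⟩
  F (0 ∷ []) ⊕ Σ< b (λ l → F (suc l ∷ []))
    ≡⟨ cong₂ _⊕_ (last-zero [] (cons ℕ.≤-refl z≤n [])) (Σ<-zero b (λ {l} l<b → last-suc [] l (cons ℕ.≤-refl l<b []))) ⟩
  φ [] ⊕ 0ℤ
    ≡⟨ ℤ.+-identityʳ (φ []) ⟩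
  φ [] ∎
  where open ≡-Reasoning
interlacingSum-J b (a ∷ κ) F {φ} (a≤b ∷ κ≥) last-zero last-suc = begin
  𝟙 (b ℕ.≤? b) ⊗ Σ< (suc b) (λ l → interlacingSum l (a ∷ κ) (F ∘ (l ∷_)))
    ≡⟨ 𝟙-⊗-yes (b ℕ.≤? b) ℕ.≤-refl ⟩
  Σ< (suc b) (λ l → interlacingSum l (a ∷ κ) (F ∘ (l ∷_)))
    ≡⟨ Σ<-cong (suc b) (λ {l} l≤b → 𝟙-⊗-cong (a ℕ.≤? l) (λ a≤l → trans
         (sym (𝟙-⊗-yes (a ℕ.≤? a) ℕ.≤-refl))
         (interlacingSum-J a κ (F ∘ (l ∷_)) κ≥
           (λ ls i → last-zero (l ∷ ls) (cons ℕ.≤-refl (s≤s⁻¹ l≤b) (widen a≤l i)))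
           (λ ls x i → last-suc (l ∷ ls) x (cons ℕ.≤-refl (s≤s⁻¹ l≤b) (widen a≤l i)))))) ⟩
  Σ< (suc b) (λ l → 𝟙 (a ℕ.≤? l) ⊗ H (l + length κ))
    ≡⟨ Σ<-from (ℕ.m≤n⇒m≤1+n a≤b) (λ l → H (l + length κ)) ⟩
  I a (suc b) (λ l → H (l + length κ))
    ≡⟨ I-translate a (suc b) (length κ) H ⟨
  I (a + length κ) (suc b + length κ) H
    ≡⟨ cong (λ c → I (a + length κ) c H) (ℕ.+-suc b (length κ)) ⟨
  I (a + length κ) (b + suc (length κ)) H ∎
  where
  open ≡-Reasoning
  H : ℕ → ℤ
  H c = J (beads (suc (length κ)) (part (a ∷ κ))) (φ ∘ (c ∷_))
  widen : ∀ {k l ls} → a ≤ l → Interlaced k (a ∷ κ) ls → Interlaced l (a ∷ κ) ls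
  widen a≤l (cons _ l≤a i) = cons a≤l l≤a i

s≡S : ∀ ρ {κ} → Linked _≥_ κ → length κ ≡ length ρ →
      s κ (reverse ρ) ≡ S (beads (length ρ) (part κ)) (map +_ ρ)
s≡S []      {[]}    κ≥ len = refl
s≡S (a ∷ ρ) {b ∷ κ} κ≥ len = begin
  s (b ∷ κ) (reverse (a ∷ ρ))
    ≡⟨ cong (s (b ∷ κ)) (List.unfold-reverse a ρ) ⟩
  s (b ∷ κ) (reverse ρ ∷ʳ a)
    ≡⟨ s-branching κ≥ (reverse ρ) a ⟩
  interlacingSum b (b ∷ κ) F
    ≡⟨ interlacingSum-J b κ F κ≥ last-zero last-suc ⟩
  J (beads (suc (length κ)) (part (b ∷ κ))) φ
    ≡⟨ cong (λ n → J (beads (suc n) (part (b ∷ κ))) φ) len′ ⟩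
  J (beads (suc n) (part (b ∷ κ))) φ ∎
  where
  open ≡-Reasoning
  n = length ρ
  len′ : length κ ≡ n
  len′ = ℕ.suc-injective len
  F φ : List ℕ → ℤ
  F ls = 𝟙 (sum (b ∷ κ) ℕ.≟ sum ls + a) ⊗ s ls (reverse ρ)
  φ c = 𝟙 (+ sum (beads (suc n) (part (b ∷ κ))) ℤ.≟ + (sum c + length c) ⊕ + a) ⊗ S c (map +_ ρ)
  length-∷ʳ : ∀ ls x → Interlaced b (b ∷ κ) (ls ∷ʳ x) → length ls ≡ n
  length-∷ʳ ls x i = ℕ.suc-injective (trans (trans (ℕ.+-comm 1 (length ls)) (sym (List.length-++ ls)))
    (trans (sym (interlaced-length i)) len))
  sum-∷ʳ-0 : ∀ ls → sum (ls ∷ʳ 0) ≡ sum ls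
  sum-∷ʳ-0 ls = trans (sum-insert ls 0 []) (cong sum (List.++-identityʳ ls))
  part-∷ʳ : ∀ ls x → part (ls ∷ʳ x) (length ls) ≡ x
  part-∷ʳ []       x = refl
  part-∷ʳ (_ ∷ ls) x = part-∷ʳ ls x
  init-≥ : ∀ ls {x} → Linked _≥_ (ls ∷ʳ x) → Linked _≥_ ls
  init-≥ []           l       = []
  init-≥ (_ ∷ [])     l       = [-]
  init-≥ (_ ∷ m ∷ ls) (p ∷ l) = p ∷ init-≥ (m ∷ ls) l
  last-suc : ∀ ls x → Interlaced b (b ∷ κ) (ls ∷ʳ suc x) → F (ls ∷ʳ suc x) ≡ 0ℤ
  last-suc ls x i = trans (cong (𝟙 (sum (b ∷ κ) ℕ.≟ sum (ls ∷ʳ suc x) + a) ⊗_)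
    (s-too-long ρ (interlaced-≥ i)
      (subst (λ m → 0 < part (ls ∷ʳ suc x) m) (length-∷ʳ ls (suc x) i) (subst (0 <_) (sym (part-∷ʳ ls (suc x))) z<s))))
    (ℤ.*-zeroʳ (𝟙 (sum (b ∷ κ) ℕ.≟ sum (ls ∷ʳ suc x) + a)))
  last-zero : ∀ ls → Interlaced b (b ∷ κ) (ls ∷ʳ 0) → F (ls ∷ʳ 0) ≡ φ (beads (length κ) (part ls))
  last-zero ls i = cong₂ _⊗_
    -- The beads of `b ∷ κ` exceed its parts by `n + t` in total, those of `ls` only by `t`. The
    -- summand `length c` in the definition of `S` makes up the difference `n`, so both degree
    -- conditions say the same.
    (𝟙-cong (sum (b ∷ κ) ℕ.≟ sum (ls ∷ʳ 0) + a) (+ m ℤ.≟ + (sum c + length c) ⊕ + a)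
      (λ e → cong +_ (trans m≡ (trans (cong (_+ (n + t)) e) (sym c≡))))
      (λ e → ℕ.+-cancelʳ-≡ (n + t) _ _ (trans (sym m≡) (trans (ℤ.+-injective e) c≡))))
    (trans (s-trailing-zero ls (reverse ρ))
      (trans (s≡S ρ (init-≥ ls (interlaced-≥ i)) lenˡ) (cong (λ n → S (beads n (part ls)) (map +_ ρ)) (sym len′))))
    where
    lenˡ : length ls ≡ n
    lenˡ = length-∷ʳ ls 0 i
    c = beads (length κ) (part ls)
    m = sum (beads (suc n) (part (b ∷ κ)))
    t = sum (beads n (λ _ → 0))
    m≡ : m ≡ sum (b ∷ κ) + (n + t)
    m≡ = sum-beads (suc n) (b ∷ κ) (ℕ.≤-reflexive len)
    c≡ : sum c + length c + a ≡ sum (ls ∷ʳ 0) + a + (n + t)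
    c≡ = begin
      sum c + length c + a
        ≡⟨ cong₂ (λ u v → u + v + a)
             (trans (cong (λ n → sum (beads n (part ls))) len′) (sum-beads n ls (ℕ.≤-reflexive lenˡ)))
             (trans (length-beads (length κ) (part ls)) len′) ⟩
      sum ls + t + n + a
        ≡⟨ lemma (sum ls) t n a ⟩
      sum ls + a + (n + t)
        ≡⟨ cong (λ u → u + a + (n + t)) (sum-∷ʳ-0 ls) ⟨
      sum (ls ∷ʳ 0) + a + (n + t) ∎
      where
      lemma : ∀ s t n a → s + t + n + a ≡ s + a + (n + t)
      lemma = ℕS.solve-∀

-- For strictly decreasing `b` the sum runs over genuine interlacing lists. These are strictly
-- decreasing, and each of their entries is below the corresponding entry of `b`, which gives the
-- bound on the sum.
J-zero : ∀ {b φ} → Decreasing b → (∀ {c} → Decreasing c → sum c + length c ≤ sum b → φ c ≡ 0ℤ) → J b φ ≡ 0ℤ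
J-zero {b} db z = go db (λ {c} _ → z {c})
  where
  go : ∀ {b φ} → Decreasing b →
       (∀ {c} → All (λ x → Any (x <_) b) c → Decreasing c → sum c + length c ≤ sum b → φ c ≡ 0ℤ) → J b φ ≡ 0ℤ
  go {[]} _ z = refl
  go {b ∷ []} _ z = z [] [] z≤n
  go {b ∷ b′ ∷ bs} {φ} ((b′<b ∷ _) ∷ db) z with ℕ.m≤n⇒∃[o]m+o≡n (ℕ.<⇒≤ b′<b)
  ... | k , refl = trans (I-segment b′ k _) (Σ<-zero k (λ {i} i<k → go db (λ {c} below dc le →
    z (here (ℕ.+-monoʳ-< b′ i<k) ∷ All.map there below)
      (All.map (λ x<bs → ℕ.<-≤-trans (bounded db x<bs) (ℕ.m≤m+n b′ i)) below ∷ dc)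
      (bound (b′ + i) (sum c) (length c) (ℕ.+-monoʳ-< b′ i<k) le))))
    where
    bounded : ∀ {b bs x} → Decreasing (b ∷ bs) → Any (x <_) (b ∷ bs) → x < b
    bounded _        (here x<b)  = x<b
    bounded (d ∷ ds) (there any) = go′ d any
      where
      go′ : ∀ {b bs x} → All (b >_) bs → Any (x <_) bs → x < b
      go′ (y<b ∷ _) (here x<y) = ℕ.<-trans x<y y<b
      go′ (_ ∷ d)   (there p)  = go′ d p
    bound : ∀ x s l {b t} → x < b → s + l ≤ t → x + s + suc l ≤ b + t
    bound x s l x<b le = ℕ.≤-trans (ℕ.≤-reflexive (lemma x s l)) (ℕ.+-mono-≤ x<b le)
      where
      lemma : ∀ x s l → x + s + suc l ≡ suc x + (s + l)
      lemma = ℕS.solve-∀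

-- A negative exponent would force `sum c + length c` above `sum b`, which no interlacing list
-- allows. This disposes of the shifts that move an exponent below zero and so belong to no
-- factorisation of the monomial.
S-negative : ∀ ρ {b} → Decreasing b → Any (ℤ._< 0ℤ) ρ → S b ρ ≡ 0ℤ
S-negative (a ∷ ρ) {b} db neg = trans (S-∷ b a ρ) (J-zero db (zero-term neg))
  where
  zero-term : Any (ℤ._< 0ℤ) (a ∷ ρ) → ∀ {c} → Decreasing c → sum c + length c ≤ sum b →
              𝟙 (+ sum b ℤ.≟ + (sum c + length c) ⊕ a) ⊗ S c ρ ≡ 0ℤ
  zero-term (here a<0) {c} _ le = 𝟙-⊗-no (+ sum b ℤ.≟ + (sum c + length c) ⊕ a) (λ e →
    ℤ.<-irrefl (sym e) (ℤ.<-≤-trans (ℤ.+-monoʳ-< (+ (sum c + length c)) a<0)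
      (ℤ.≤-trans (ℤ.≤-reflexive (ℤ.+-identityʳ _)) (ℤ.+≤+ le))))
  zero-term (there neg) {c} dc _ = trans (cong (𝟙 (+ sum b ℤ.≟ + (sum c + length c) ⊕ a) ⊗_) (S-negative ρ dc neg))
    (ℤ.*-zeroʳ (𝟙 (+ sum b ℤ.≟ + (sum c + length c) ⊕ a)))

-- Complete homogeneous symmetric functions and their plethysms

-- For a single row the branching sum runs over `l ≤ m`, and by induction only `l` equal to `sum ρ`
-- contributes.
h-coefficient : ∀ m ρ → h m (reverse ρ) ≡ 𝟙 (sum ρ ℕ.≟ m)
h-coefficient zero    []      = refl
h-coefficient (suc m) []      = s-tabSum (suc m ∷ []) []
h-coefficient m       (a ∷ ρ) = begin
  s (m ∷ []) (reverse (a ∷ ρ))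
    ≡⟨ cong (s (m ∷ [])) (List.unfold-reverse a ρ) ⟩
  s (m ∷ []) (reverse ρ ∷ʳ a)
    ≡⟨ s-branching {m ∷ []} [-] (reverse ρ) a ⟩
  𝟙 (m ℕ.≤? m) ⊗ Σ< (suc m) (λ l → 𝟙 (m + 0 ℕ.≟ l + 0 + a) ⊗ s (l ∷ []) (reverse ρ))
    ≡⟨ 𝟙-⊗-yes (m ℕ.≤? m) ℕ.≤-refl ⟩
  Σ< (suc m) (λ l → 𝟙 (m + 0 ℕ.≟ l + 0 + a) ⊗ s (l ∷ []) (reverse ρ))
    ≡⟨ Σ<-cong (suc m) (λ {l} _ → trans (cong (𝟙 (m + 0 ℕ.≟ l + 0 + a) ⊗_)
         (trans (h-coefficient l ρ) (𝟙-cong (sum ρ ℕ.≟ l) (l ℕ.≟ sum ρ) sym sym)))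
         (ℤ.*-comm (𝟙 (m + 0 ℕ.≟ l + 0 + a)) _)) ⟩
  Σ< (suc m) (λ l → 𝟙 (l ℕ.≟ sum ρ) ⊗ 𝟙 (m + 0 ℕ.≟ l + 0 + a))
    ≡⟨ Σ<-𝟙≟ (suc m) (sum ρ) (λ l → 𝟙 (m + 0 ℕ.≟ l + 0 + a)) (λ m<ρ → 𝟙-no (m + 0 ℕ.≟ sum ρ + 0 + a)
         (λ e → ℕ.<⇒≱ m<ρ (subst (sum ρ ≤_) (sym (from e)) (ℕ.m≤n+m (sum ρ) a)))) ⟩
  𝟙 (m + 0 ℕ.≟ sum ρ + 0 + a)
    ≡⟨ 𝟙-cong (m + 0 ℕ.≟ sum ρ + 0 + a) (a + sum ρ ℕ.≟ m) (sym ∘ from)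
         (λ e → trans (ℕ.+-identityʳ m) (trans (sym e) (sym total))) ⟩
  𝟙 (a + sum ρ ℕ.≟ m) ∎
  where
  open ≡-Reasoning
  total : sum ρ + 0 + a ≡ a + sum ρ
  total = trans (cong (_+ a) (ℕ.+-identityʳ (sum ρ))) (ℕ.+-comm (sum ρ) a)
  from : m + 0 ≡ sum ρ + 0 + a → m ≡ a + sum ρ
  from e = trans (sym (ℕ.+-identityʳ m)) (trans e total)

sum-reverse : ∀ xs → sum (reverse xs) ≡ sum xs
sum-reverse []       = refl
sum-reverse (x ∷ xs) = begin
  sum (reverse (x ∷ xs))         ≡⟨ cong sum (List.unfold-reverse x xs) ⟩
  sum (reverse xs ∷ʳ x)          ≡⟨ sum-insert (reverse xs) x [] ⟩
  x + sum (reverse xs ++ [])     ≡⟨ cong (λ l → x + sum l) (List.++-identityʳ (reverse xs)) ⟩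
  x + sum (reverse xs)           ≡⟨ cong (_+_ x) (sum-reverse xs) ⟩
  x + sum xs                     ∎
  where open ≡-Reasoning

∑-splittings-cong : ∀ α {f g : List ℕ × List ℕ → ℤ} →
  (∀ β γ → length β ≡ length α → f (β , γ) ≡ g (β , γ)) → ∑ (splittings α) f ≡ ∑ (splittings α) g
∑-splittings-cong []      e = cong (_⊕ 0ℤ) (e [] [] refl)
∑-splittings-cong (a ∷ α) {f} {g} e = trans
  (∑-cartesianProductWith _ (upTo (suc a)) (splittings α) f)
  (trans (∑-cong-∈ (upTo (suc a)) (λ _ → ∑-splittings-cong α (λ β γ len → e _ _ (cong suc len))))
         (sym (∑-cartesianProductWith _ (upTo (suc a)) (splittings α) g)))

shifts-∷ʳ : (_◃_ : A → ℕ → A) (M : ℕ) (xs : List A) (x : A) (F : List A → ℕ → ℤ) →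
  shifts _◃_ M (xs ∷ʳ x) F ≡ shifts _◃_ M xs λ ys t → Σ< M λ g → F (ys ∷ʳ (x ◃ g)) (t + g)
shifts-∷ʳ _◃_ M []       x F = Σ<-cong M (λ {g} _ → cong (F (x ◃ g ∷ [])) (ℕ.+-identityʳ g))
shifts-∷ʳ _◃_ M (y ∷ xs) x F = Σ<-cong M (λ {g} _ → trans
  (shifts-∷ʳ _◃_ M xs x (λ ys t → F (y ◃ g ∷ ys) (g + t)))
  (shifts-cong _◃_ M xs (λ ys t → Σ<-cong M (λ {g′} _ →
    cong (F (y ◃ g ∷ ys ∷ʳ (x ◃ g′))) (sym (ℕ.+-assoc g t g′))))))

-- The variables are met in their order by `splittings`, but from the last to the first by `S`. As
-- the entries move independently and only their total is recorded, the order may be reversed.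
shifts-reverse : (_◃_ : A → ℕ → A) (M : ℕ) (xs : List A) (F : List A → ℕ → ℤ) →
  shifts _◃_ M xs (λ ys t → F (reverse ys) t) ≡ shifts _◃_ M (reverse xs) F
shifts-reverse _◃_ M []       F = refl
shifts-reverse _◃_ M (x ∷ xs) F = begin
  Σ< M (λ g → shifts _◃_ M xs λ ys t → F (reverse (x ◃ g ∷ ys)) (g + t))
    ≡⟨ Σ<-cong M (λ {g} _ → shifts-cong _◃_ M xs (λ ys t → cong (λ l → F l (g + t)) (List.unfold-reverse (x ◃ g) ys))) ⟩
  Σ< M (λ g → shifts _◃_ M xs λ ys t → F (reverse ys ∷ʳ (x ◃ g)) (g + t))
    ≡⟨ Σ<-cong M (λ {g} _ → shifts-reverse _◃_ M xs (λ ys t → F (ys ∷ʳ (x ◃ g)) (g + t))) ⟩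
  Σ< M (λ g → shifts _◃_ M (reverse xs) λ ys t → F (ys ∷ʳ (x ◃ g)) (g + t))
    ≡⟨ Σ<-swap (shifts-linear _◃_ M (reverse xs)) M (λ g (ys , t) → F (ys ∷ʳ (x ◃ g)) (g + t)) ⟨
  shifts _◃_ M (reverse xs) (λ ys t → Σ< M λ g → F (ys ∷ʳ (x ◃ g)) (g + t))
    ≡⟨ shifts-cong _◃_ M (reverse xs) (λ ys t → Σ<-cong M (λ {g} _ → cong (F (ys ∷ʳ (x ◃ g))) (ℕ.+-comm g t))) ⟩
  shifts _◃_ M (reverse xs) (λ ys t → Σ< M λ g → F (ys ∷ʳ (x ◃ g)) (t + g))
    ≡⟨ shifts-∷ʳ _◃_ M (reverse xs) x F ⟨
  shifts _◃_ M (reverse xs ∷ʳ x) F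
    ≡⟨ cong (λ l → shifts _◃_ M l F) (List.unfold-reverse x xs) ⟨
  shifts _◃_ M (reverse (x ∷ xs)) F ∎
  where open ≡-Reasoning

module _ (r : ℕ) .{{_ : NonZero r}} where

  plethysm-coefficient : ∀ m γ → (p[ r ]∘ h m) γ ≡ 𝟙 (all? (r ∣?_) γ) ⊗ 𝟙 (sum (map (_/ r) γ) ℕ.≟ m)
  plethysm-coefficient m γ with does (all? (r ∣?_) γ)
  ... | false = refl
  ... | true  = begin
    h m γ′                              ≡⟨ cong (h m) (List.reverse-involutive γ′) ⟨
    h m (reverse (reverse γ′))          ≡⟨ h-coefficient m (reverse γ′) ⟩
    𝟙 (sum (reverse γ′) ℕ.≟ m)          ≡⟨ cong (λ n → 𝟙 (n ℕ.≟ m)) (sum-reverse γ′) ⟩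
    𝟙 (sum γ′ ℕ.≟ m)                    ≡⟨ ℤ.*-identityˡ _ ⟨
    1ℤ ⊗ 𝟙 (sum γ′ ℕ.≟ m)               ∎
    where
    open ≡-Reasoning
    γ′ = map (_/ r) γ

  -- A splitting of `α` whose second half is divisible by `r` is a way of lowering the exponents by
  -- multiples of `r`. The right side also contains shifts that lower an exponent below zero; there
  -- `Φ` vanishes by hypothesis.
  ∑-splittings : ∀ M α (Φ : List ℤ → ℕ → ℤ) → All (_< M) α →
    (∀ {ρ} t → Any (ℤ._< 0ℤ) ρ → Φ ρ t ≡ 0ℤ) →
    ∑ (splittings α) (λ (β , γ) → 𝟙 (all? (r ∣?_) γ) ⊗ Φ (map +_ β) (sum (map (_/ r) γ))) ≡
    shifts (down r) M (map +_ α) Φ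
  ∑-splittings M []      Φ _           z = trans (ℤ.+-identityʳ _) (ℤ.*-identityˡ (Φ [] 0))
  ∑-splittings M (a ∷ α) Φ (a<M ∷ α<M) z = begin
    ∑ (splittings (a ∷ α)) (λ (β , γ) → 𝟙 (all? (r ∣?_) γ) ⊗ Φ (map +_ β) (sum (map (_/ r) γ)))
      ≡⟨ ∑-cartesianProductWith _ (upTo (suc a)) (splittings α) _ ⟩
    ∑ (upTo (suc a)) (λ k → ∑ (splittings α) λ (β , γ) →
      𝟙 (all? (r ∣?_) (a ∸ k ∷ γ)) ⊗ Φ (+ k ∷ map +_ β) ((a ∸ k) / r + sum (map (_/ r) γ)))
      ≡⟨ ∑-applyUpTo id (suc a) _ ⟩
    Σ< (suc a) (λ k → ∑ (splittings α) λ (β , γ) →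
      𝟙 (all? (r ∣?_) (a ∸ k ∷ γ)) ⊗ Φ (+ k ∷ map +_ β) ((a ∸ k) / r + sum (map (_/ r) γ)))
      ≡⟨ Σ<-cong (suc a) (λ {k} k≤a → trans
           (∑-cong-∈ (splittings α) (λ {(β , γ)} _ → trans (cong (_⊗ Φ (+ k ∷ map +_ β) ((a ∸ k) / r + sum (map (_/ r) γ))) (factor (a ∸ k) γ))
             (ℤ.*-assoc (𝟙 (r ∣? (a ∸ k))) _ _)))
           (trans (∑-linear (splittings α) .scale (𝟙 (r ∣? (a ∸ k))) _)
             (cong (𝟙 (r ∣? (a ∸ k)) ⊗_)
               (trans (∑-splittings M α (λ ρ t → Φ (+ k ∷ ρ) ((a ∸ k) / r + t)) α<M (λ t neg → z _ (there neg)))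
                      (cong (λ c → G c ((a ∸ k) / r)) (position (s≤s⁻¹ k≤a))))))) ⟩
    Σ< (suc a) (λ k → 𝟙 (r ∣? (a ∸ k)) ⊗ F (a ∸ k))
      ≡⟨ Σ<-reverse a (λ j → 𝟙 (r ∣? j) ⊗ F j) ⟩
    Σ< (suc a) (λ j → 𝟙 (r ∣? j) ⊗ F j)
      ≡⟨ Σ<-cong (suc a) (λ {j} _ → cong (_⊗ F j)
           (𝟙-cong (r ∣? j) (0 ℕ.≤? j ×-dec r ∣? j) (z≤n ,_) proj₂)) ⟩
    Σ< (suc a) (λ j → reach r 0 j ⊗ F j)
      ≡⟨ enlarge ⟩
    Σ< M (λ j → reach r 0 j ⊗ F j)
      ≡⟨ Σ<-reach r M 0 F (λ j M≤j → F-zero (ℕ.<-≤-trans a<M M≤j)) ⟨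
    Σ< M (λ g → F (r * g))
      ≡⟨ Σ<-cong M (λ {g} _ → cong (G (down r (+ a) g)) (trans (cong (_/ r) (ℕ.*-comm r g)) (m*n/n≡m g r))) ⟩
    Σ< M (λ g → G (down r (+ a) g) g) ∎
    where
    open ≡-Reasoning
    G : ℤ → ℕ → ℤ
    G c q = shifts (down r) M (map +_ α) λ ρ t → Φ (c ∷ ρ) (q + t)
    F : ℕ → ℤ
    F j = G (+ a ⊝ + j) (j / r)
    factor : ∀ j γ → 𝟙 (all? (r ∣?_) (j ∷ γ)) ≡ 𝟙 (r ∣? j) ⊗ 𝟙 (all? (r ∣?_) γ)
    factor j γ = trans
      (𝟙-cong (all? (r ∣?_) (j ∷ γ)) (r ∣? j ×-dec all? (r ∣?_) γ) (λ { (d ∷ ds) → d , ds }) (λ (d , ds) → d ∷ ds))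
      (𝟙-× (r ∣? j) (all? (r ∣?_) γ))
    position : ∀ {k} → k ≤ a → + k ≡ + a ⊝ + (a ∸ k)
    position {k} k≤a = trans (cong +_ (sym (ℕ.m∸[m∸n]≡n k≤a)))
      (trans (sym (ℤ.⊖-≥ (ℕ.m∸n≤m a k))) (sym (ℤ.m-n≡m⊖n a (a ∸ k))))
    F-zero : ∀ {j} → a < j → F j ≡ 0ℤ
    F-zero {j} a<j = vanish (shifts-linear (down r) M (map +_ α)) {f = λ (ρ , t) → Φ (+ a ⊝ + j ∷ ρ) (j / r + t)}
      (λ _ → z _ (here (subst (+ a ⊝ + j ℤ.<_) (ℤ.+-inverseʳ (+ j)) (ℤ.+-monoˡ-< (- + j) (ℤ.+<+ a<j)))))
    enlarge : Σ< (suc a) (λ j → reach r 0 j ⊗ F j) ≡ Σ< M (λ j → reach r 0 j ⊗ F j)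
    enlarge with ℕ.m≤n⇒∃[o]m+o≡n a<M
    ... | k , refl = sym (trans (Σ<-+ (suc a) k (λ j → reach r 0 j ⊗ F j))
      (trans (⊕-congˡ (Σ< (suc a) (λ j → reach r 0 j ⊗ F j))
        (Σ<-zero k (λ {i} _ → trans (cong (reach r 0 (suc a + i) ⊗_) (F-zero (s≤s (ℕ.m≤m+n a i)))) (ℤ.*-zeroʳ (reach r 0 (suc a + i))))))
        (ℤ.+-identityʳ _)))

s-beads : ∀ ρ {κ} → Linked _≥_ κ → length κ ≤ length ρ →
          s κ (reverse ρ) ≡ S (beads (length ρ) (part κ)) (map +_ ρ)
s-beads ρ {κ} κ≥ κ≤n = go (length ρ ∸ length κ) κ κ≥ (ℕ.m+[n∸m]≡n κ≤n)
  where
  part-∷ʳ-0 : ∀ κ i → part (κ ∷ʳ 0) i ≡ part κ i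
  part-∷ʳ-0 []      zero    = refl
  part-∷ʳ-0 []      (suc i) = refl
  part-∷ʳ-0 (_ ∷ κ) zero    = refl
  part-∷ʳ-0 (_ ∷ κ) (suc i) = part-∷ʳ-0 κ i
  go : ∀ k κ → Linked _≥_ κ → length κ + k ≡ length ρ →
       s κ (reverse ρ) ≡ S (beads (length ρ) (part κ)) (map +_ ρ)
  go zero    κ κ≥ e = s≡S ρ κ≥ (trans (sym (ℕ.+-identityʳ (length κ))) e)
  go (suc k) κ κ≥ e = trans (sym (s-trailing-zero κ (reverse ρ))) (trans
    (go k (κ ∷ʳ 0)
      (weaklyDecreasing⇒Linked (κ ∷ʳ 0) (λ i → subst₂ _≤_ (sym (part-∷ʳ-0 κ (suc i))) (sym (part-∷ʳ-0 κ i))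
        (partition⇒WeaklyDecreasing κ≥ i)))
      (trans (cong (_+ k) (List.length-++ κ)) (trans (ℕ.+-assoc (length κ) 1 k) e)))
    (cong (λ b → S b (map +_ ρ)) (beads-cong (length ρ) (λ {i} _ → part-∷ʳ-0 κ i))))

-- Partitions and strictly decreasing lists

compositions-sound : ∀ n → All (λ c → All (0 <_) c × sum c ≡ n) (compositions n)
compositions-sound zero    = ([] , refl) ∷ []
compositions-sound (suc n) = All⁺.concat⁺ (All⁺.map⁺ (All.map
  (λ { {[]}    (_ , e)            → (z<s ∷ [] , cong suc e) ∷ []
     ; {_ ∷ _} (0<b ∷ 0<c , e) → (z<s ∷ 0<b ∷ 0<c , cong suc e) ∷ (z<s ∷ 0<c , cong suc e) ∷ [] })
  (compositions-sound n)))

-- The sum in the theorem runs over a list, so it matters that no partition is listed twice. A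
-- composition of `suc n` determines the composition of `n` from which it was built, according to
-- whether its first part is 1.
∑-compositions-𝟙 : ∀ n {κ} → All (0 <_) κ → sum κ ≡ n → ∑ (compositions n) (λ c → 𝟙 (c ≟ᴸ κ)) ≡ 1ℤ
∑-compositions-𝟙 zero    {[]}         _          _  = refl
∑-compositions-𝟙 zero    {suc _ ∷ _}  _          ()
∑-compositions-𝟙 zero    {zero ∷ _}   (() ∷ _)
∑-compositions-𝟙 (suc n) {zero ∷ _}   (() ∷ _)
∑-compositions-𝟙 (suc n) {suc zero ∷ []} _ e with refl ← e = refl
∑-compositions-𝟙 (suc n) {suc zero ∷ a ∷ κ} (_ ∷ 0<κ) e = trans
  (∑-concatMap _ (compositions n) _)
  (trans (∑-cong-∈ (compositions n) (λ {c} c∈ → predecessor c (proj₁ (All.lookup (compositions-sound n) c∈))))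
         (∑-compositions-𝟙 n 0<κ (ℕ.suc-injective e)))
  where
  predecessor : ∀ c → All (0 <_) c → _
  predecessor [] _ = refl
  predecessor (b ∷ c) (0<b ∷ _) = trans
    (cong₂ (λ u v → u ⊕ (v ⊕ 0ℤ))
      (𝟙-cong ((1 ∷ b ∷ c) ≟ᴸ (1 ∷ a ∷ κ)) ((b ∷ c) ≟ᴸ (a ∷ κ)) List.∷-injectiveʳ (cong (1 ∷_)))
      (𝟙-no ((suc b ∷ c) ≟ᴸ (1 ∷ a ∷ κ)) (λ eq →
        ℕ.<-irrefl (sym (ℕ.suc-injective (List.∷-injectiveˡ eq))) 0<b)))
    (ℤ.+-identityʳ (𝟙 ((b ∷ c) ≟ᴸ (a ∷ κ))))
∑-compositions-𝟙 (suc n) {suc (suc a) ∷ κ} (_ ∷ 0<κ) e = trans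
  (∑-concatMap _ (compositions n) _)
  (trans (∑-cong-∈ (compositions n) (λ {c} _ → predecessor c))
         (∑-compositions-𝟙 n (z<s ∷ 0<κ) (ℕ.suc-injective e)))
  where
  predecessor : ∀ c → _
  predecessor []      = refl
  predecessor (b ∷ c) = trans
    (cong₂ (λ u v → u ⊕ (v ⊕ 0ℤ))
      (𝟙-no ((1 ∷ b ∷ c) ≟ᴸ (suc (suc a) ∷ κ)) (λ ()))
      (𝟙-cong ((suc b ∷ c) ≟ᴸ (suc (suc a) ∷ κ)) ((b ∷ c) ≟ᴸ (suc a ∷ κ))
        (λ eq → cong₂ _∷_ (ℕ.suc-injective (List.∷-injectiveˡ eq)) (List.∷-injectiveʳ eq))
        (λ eq → cong₂ _∷_ (cong suc (List.∷-injectiveˡ eq)) (List.∷-injectiveʳ eq))))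
    (trans (ℤ.+-identityˡ _) (ℤ.+-identityʳ (𝟙 ((b ∷ c) ≟ᴸ (suc a ∷ κ)))))

∑-partitions-𝟙 : ∀ {κ} n → IsPartition κ → sum κ ≡ n → ∑ (partitions n) (λ c → 𝟙 (c ≟ᴸ κ)) ≡ 1ℤ
∑-partitions-𝟙 {κ} n pκ e = begin
  ∑ (partitions n) (λ c → 𝟙 (c ≟ᴸ κ))
    ≡⟨ ∑-filter isPartition? (compositions n) _ ⟩
  ∑ (compositions n) (λ c → 𝟙 (isPartition? c) ⊗ 𝟙 (c ≟ᴸ κ))
    ≡⟨ ∑-cong-∈ (compositions n) (λ {c} _ → trans (ℤ.*-comm (𝟙 (isPartition? c)) _)
         (trans (𝟙-⊗-cong (c ≟ᴸ κ) (λ { refl → 𝟙-yes (isPartition? c) pκ })) (ℤ.*-identityʳ _))) ⟩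
  ∑ (compositions n) (λ c → 𝟙 (c ≟ᴸ κ))
    ≡⟨ ∑-compositions-𝟙 n (proj₂ pκ) e ⟩
  1ℤ ∎
  where open ≡-Reasoning

partitions-sound : ∀ {n κ} → κ ∈ partitions n → IsPartition κ × sum κ ≡ n
partitions-sound {n} κ∈ =
  let κ∈compositions , pκ = ∈-filter⁻ isPartition? κ∈
  in pκ , proj₂ (All.lookup (compositions-sound n) κ∈compositions)

DecreasingBelow : ℕ → ℕ → List ℕ → Set
DecreasingBelow n Y xs = Decreasing xs × length xs ≡ n × All (_< Y) xs

decreasing-sound : ∀ n Y → All (DecreasingBelow n Y) (decreasing n Y)
decreasing-sound zero    Y       = ([] , refl , []) ∷ []
decreasing-sound (suc n) zero    = []
decreasing-sound (suc n) (suc Y) = All⁺.++⁺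
  (All⁺.map⁺ (All.map (λ (d , len , below) → below ∷ d , cong suc len , ℕ.n<1+n Y ∷ All.map ℕ.m<n⇒m<1+n below)
    (decreasing-sound n Y)))
  (All.map (λ (d , len , below) → d , len , All.map ℕ.m<n⇒m<1+n below) (decreasing-sound (suc n) Y))

∑-decreasing-𝟙 : ∀ n Y {ys} (H : List ℕ → ℤ) → DecreasingBelow n Y ys →
                 ∑ (decreasing n Y) (λ xs → 𝟙 (xs ≟ᴸ ys) ⊗ H xs) ≡ H ys
∑-decreasing-𝟙 zero    Y       {[]}     H _ = trans (ℤ.+-identityʳ _) (ℤ.*-identityˡ (H []))
∑-decreasing-𝟙 (suc n) zero    {_ ∷ _}  H (_ , _ , () ∷ _)
∑-decreasing-𝟙 (suc n) (suc Y) {y ∷ ys} H (d ∷ ds , len , y≤Y ∷ ys<Y) = begin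
  ∑ (decreasing (suc n) (suc Y)) (λ xs → 𝟙 (xs ≟ᴸ (y ∷ ys)) ⊗ H xs)
    ≡⟨ ∑-++ (map (Y ∷_) (decreasing n Y)) (decreasing (suc n) Y) _ ⟩
  ∑ (map (Y ∷_) (decreasing n Y)) (λ xs → 𝟙 (xs ≟ᴸ (y ∷ ys)) ⊗ H xs) ⊕ without
    ≡⟨ ⊕-congʳ without (∑-map (Y ∷_) (decreasing n Y) _) ⟩
  with-Y ⊕ without
    ≡⟨ [ smaller , (λ { refl → equal }) ]′ (ℕ.m≤n⇒m<n∨m≡n (s≤s⁻¹ y≤Y)) ⟩
  H (y ∷ ys) ∎
  where
  open ≡-Reasoning
  with-Y without : ℤ
  with-Y = ∑ (decreasing n Y) (λ xs → 𝟙 ((Y ∷ xs) ≟ᴸ (y ∷ ys)) ⊗ H (Y ∷ xs))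
  without = ∑ (decreasing (suc n) Y) (λ xs → 𝟙 (xs ≟ᴸ (y ∷ ys)) ⊗ H xs)
  smaller : y < Y → with-Y ⊕ without ≡ H (y ∷ ys)
  smaller y<Y = trans (cong₂ _⊕_
    (∑-zero (decreasing n Y) (λ {xs} _ → 𝟙-⊗-no ((Y ∷ xs) ≟ᴸ (y ∷ ys)) (λ e → ℕ.<⇒≢ y<Y (sym (List.∷-injectiveˡ e)))))
    (∑-decreasing-𝟙 (suc n) Y H (d ∷ ds , len , y<Y ∷ All.map (λ x<y → ℕ.<-trans x<y y<Y) d)))
    (ℤ.+-identityˡ (H (y ∷ ys)))
  equal : ∑ (decreasing n y) (λ xs → 𝟙 ((y ∷ xs) ≟ᴸ (y ∷ ys)) ⊗ H (y ∷ xs)) ⊕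
          ∑ (decreasing (suc n) y) (λ xs → 𝟙 (xs ≟ᴸ (y ∷ ys)) ⊗ H xs) ≡ H (y ∷ ys)
  equal = trans (cong₂ _⊕_
    (trans (∑-cong-∈ (decreasing n y) (λ {xs} _ → cong (_⊗ H (y ∷ xs))
             (𝟙-cong ((y ∷ xs) ≟ᴸ (y ∷ ys)) (xs ≟ᴸ ys) List.∷-injectiveʳ (cong (y ∷_)))))
           (∑-decreasing-𝟙 n y (H ∘ (y ∷_)) (ds , ℕ.suc-injective len , d)))
    (∑-zero (decreasing (suc n) y) (λ {xs} xs∈ → 𝟙-⊗-no (xs ≟ᴸ (y ∷ ys)) (λ { refl →
      ℕ.<-irrefl refl (All.head (proj₂ (proj₂ (All.lookup (decreasing-sound (suc n) y) xs∈)))) }))))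
    (ℤ.+-identityʳ (H (y ∷ ys)))

unbeads : List ℕ → ℕ → ℕ
unbeads []       = λ _ → 0
unbeads (x ∷ xs) = consRow (x ∸ length xs) (unbeads xs)

unbeads-beads : ∀ n p {i} → i < n → unbeads (beads n p) i ≡ p i
unbeads-beads (suc n) p {zero}  _         =
  trans (cong (p 0 + n ∸_) (length-beads n (p ∘ suc))) (ℕ.m+n∸n≡m (p 0) n)
unbeads-beads (suc n) p {suc i} (s<s i<n) = unbeads-beads n (p ∘ suc) i<n

unbeads-beyond : ∀ xs {i} → length xs ≤ i → unbeads xs i ≡ 0
unbeads-beyond []       _         = refl
unbeads-beyond (x ∷ xs) {suc i} (s≤s l≤i) = unbeads-beyond xs l≤i

-- This makes the truncated subtraction in `unbeads` exact.
length≤head : ∀ {x xs} → Decreasing (x ∷ xs) → length xs ≤ x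
length≤head {xs = []}     _                 = z≤n
length≤head {xs = y ∷ xs} ((y<x ∷ _) ∷ ds) = ℕ.≤-<-trans (length≤head ds) y<x

beads-unbeads : ∀ {xs} → Decreasing xs → beads (length xs) (unbeads xs) ≡ xs
beads-unbeads {[]}     _           = refl
beads-unbeads {x ∷ xs} ds@(_ ∷ ds′) = cong₂ _∷_ (ℕ.m∸n+n≡m (length≤head ds)) (beads-unbeads ds′)

unbeads-WeaklyDecreasing : ∀ {xs} → Decreasing xs → WeaklyDecreasing (unbeads xs)
unbeads-WeaklyDecreasing {[]}         _ i = z≤n
unbeads-WeaklyDecreasing {x ∷ []}     _ = consRow-WeaklyDecreasing (λ _ → z≤n) z≤n
unbeads-WeaklyDecreasing {x ∷ y ∷ xs} ((y<x ∷ _) ∷ ds) =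
  consRow-WeaklyDecreasing (unbeads-WeaklyDecreasing ds)
    (ℕ.∸-monoˡ-≤ (suc (length xs)) y<x)

length-parts : ∀ n q → length (parts n q) ≤ n
length-parts zero    q = z≤n
length-parts (suc n) q with q 0
... | zero  = z≤n
... | suc _ = s≤s (length-parts n (q ∘ suc))

-- Partitions of `N` with at most `n` parts correspond to strictly decreasing lists of length `n`
-- and sum `N + t`. The correspondence is used through a double sum over pairs `κ`, `xs` with `κ`
-- the shape of `xs`, summed in both orders. Longer partitions contribute nothing, and the bound on
-- `Y` ensures that every bead list is enumerated.
∑-partitions-beads : ∀ n N Y (g G : List ℕ → ℤ) → let t = sum (beads n (λ _ → 0)) in
  N + t < Y →
  (∀ {κ} → IsPartition κ → sum κ ≡ N → length κ ≤ n → g κ ≡ G (beads n (part κ))) →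
  (∀ {κ} → IsPartition κ → n < length κ → g κ ≡ 0ℤ) →
  ∑ (partitions N) g ≡ ∑ (decreasing n Y) λ xs → 𝟙 (sum xs ℕ.≟ N + t) ⊗ G xs
∑-partitions-beads n N Y g G N+t<Y g≡G g≡0 = begin
  ∑ (partitions N) g
    ≡⟨ ∑-cong-∈ (partitions N) (λ κ∈ → let pκ , e = partitions-sound κ∈ in
         [ expand pκ e , expand-zero pκ ]′ (ℕ.≤-<-connex _ n)) ⟩
  ∑ (partitions N) (λ κ → ∑ (decreasing n Y) λ xs → 𝟙 (κ ≟ᴸ shape xs) ⊗ H xs)
    ≡⟨ ∑-swap (∑-linear (partitions N)) (decreasing n Y) (λ xs κ → 𝟙 (κ ≟ᴸ shape xs) ⊗ H xs) ⟩
  ∑ (decreasing n Y) (λ xs → ∑ (partitions N) λ κ → 𝟙 (κ ≟ᴸ shape xs) ⊗ H xs)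
    ≡⟨ ∑-cong-∈ (decreasing n Y) (λ xs∈ → once (All.lookup (decreasing-sound n Y) xs∈)) ⟩
  ∑ (decreasing n Y) H ∎
  where
  open ≡-Reasoning
  t = sum (beads n (λ _ → 0))
  H : List ℕ → ℤ
  H xs = 𝟙 (sum xs ℕ.≟ N + t) ⊗ G xs
  shape : List ℕ → List ℕ
  shape xs = parts n (unbeads xs)

  part-shape : ∀ {xs} → Decreasing xs → length xs ≡ n → ∀ i → part (shape xs) i ≡ unbeads xs i
  part-shape {xs} d refl = part-parts n (unbeads xs) (unbeads-WeaklyDecreasing d) (unbeads-beyond xs)

  beads-shape : ∀ {xs} → Decreasing xs → length xs ≡ n → beads n (part (shape xs)) ≡ xs
  beads-shape d refl = trans (beads-cong n (λ {i} _ → part-shape d refl i)) (beads-unbeads d)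

  shape-isPartition : ∀ {xs} → Decreasing xs → length xs ≡ n → IsPartition (shape xs)
  shape-isPartition {xs} d refl =
    parts-isPartition n (unbeads xs) (unbeads-WeaklyDecreasing d) (unbeads-beyond xs)

  shape-beads : ∀ {κ} → IsPartition κ → length κ ≤ n → κ ≡ shape (beads n (part κ))
  shape-beads {κ} pκ κ≤n = partition-ext (proj₂ pκ) (proj₂ (shape-isPartition d len)) equal
    where
    d = beads-Decreasing n (partition⇒WeaklyDecreasing (proj₁ pκ))
    len = length-beads n (part κ)
    equal : ∀ i → part κ i ≡ part (shape (beads n (part κ))) i
    equal i = trans (value (i ℕ.<? n)) (sym (part-shape d len i))
      where
      value : Dec (i < n) → part κ i ≡ unbeads (beads n (part κ)) i
      value (yes i<n) = sym (unbeads-beads n (part κ) i<n)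
      value (no  i≮n) = trans (part-beyond κ (ℕ.≤-trans κ≤n (ℕ.≮⇒≥ i≮n)))
        (sym (unbeads-beyond (beads n (part κ)) (subst (_≤ i) (sym len) (ℕ.≮⇒≥ i≮n))))

  expand : ∀ {κ} → IsPartition κ → sum κ ≡ N → length κ ≤ n →
           g κ ≡ ∑ (decreasing n Y) λ xs → 𝟙 (κ ≟ᴸ shape xs) ⊗ H xs
  expand {κ} pκ e κ≤n = sym (begin
    ∑ (decreasing n Y) (λ xs → 𝟙 (κ ≟ᴸ shape xs) ⊗ H xs)
      ≡⟨ ∑-cong-∈ (decreasing n Y) (λ {xs} xs∈ → let d , len , _ = All.lookup (decreasing-sound n Y) xs∈ in
           cong (_⊗ H xs) (𝟙-cong (κ ≟ᴸ shape xs) (xs ≟ᴸ bs)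
             (λ e → trans (sym (beads-shape d len)) (cong (λ κ → beads n (part κ)) (sym e)))
             (λ e → trans (shape-beads pκ κ≤n) (cong shape (sym e))))) ⟩
    ∑ (decreasing n Y) (λ xs → 𝟙 (xs ≟ᴸ bs) ⊗ H xs)
      ≡⟨ ∑-decreasing-𝟙 n Y H
           (beads-Decreasing n (partition⇒WeaklyDecreasing (proj₁ pκ)) , length-beads n (part κ) , entries<Y) ⟩
    H bs
      ≡⟨ 𝟙-⊗-yes (sum bs ℕ.≟ N + t) total ⟩
    G bs
      ≡⟨ g≡G pκ e κ≤n ⟨
    g κ ∎)
    where
    bs = beads n (part κ)
    total : sum bs ≡ N + t
    total = trans (sum-beads n κ κ≤n) (cong (_+ t) e)
    entries<Y : All (_< Y) bs
    entries<Y = All.tabulate (λ {b} b∈ → ℕ.≤-<-trans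
      (entry≤sum (Any.map (λ { refl → ℕ.≤-refl }) b∈))
      (subst (_< Y) (sym total) N+t<Y))

  expand-zero : ∀ {κ} → IsPartition κ → n < length κ →
                g κ ≡ ∑ (decreasing n Y) λ xs → 𝟙 (κ ≟ᴸ shape xs) ⊗ H xs
  expand-zero {κ} pκ n<κ = trans (g≡0 pκ n<κ) (sym (∑-zero (decreasing n Y) (λ {xs} _ →
    𝟙-⊗-no (κ ≟ᴸ shape xs) (λ e → ℕ.<⇒≱ n<κ (subst (λ κ → length κ ≤ n) (sym e) (length-parts n (unbeads xs)))))))

  once : ∀ {xs} → DecreasingBelow n Y xs → ∑ (partitions N) (λ κ → 𝟙 (κ ≟ᴸ shape xs) ⊗ H xs) ≡ H xs
  once {xs} (d , len , _) = begin
    ∑ (partitions N) (λ κ → 𝟙 (κ ≟ᴸ shape xs) ⊗ H xs)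
      ≡⟨ scaleʳ (∑-linear (partitions N)) (H xs) _ ⟩
    ∑ (partitions N) (λ κ → 𝟙 (κ ≟ᴸ shape xs)) ⊗ H xs
      ≡⟨ ⊗-exchange (∑ (partitions N) (λ κ → 𝟙 (κ ≟ᴸ shape xs))) (𝟙 (sum xs ℕ.≟ N + t)) (G xs) ⟩
    𝟙 (sum xs ℕ.≟ N + t) ⊗ (∑ (partitions N) (λ κ → 𝟙 (κ ≟ᴸ shape xs)) ⊗ G xs)
      ≡⟨ 𝟙-⊗-cong (sum xs ℕ.≟ N + t) (λ e → trans
           (cong (_⊗ G xs) (∑-partitions-𝟙 N (shape-isPartition d len) (size e))) (ℤ.*-identityˡ (G xs))) ⟩
    𝟙 (sum xs ℕ.≟ N + t) ⊗ G xs ∎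
    where
    size : sum xs ≡ N + t → sum (shape xs) ≡ N
    size e = ℕ.+-cancelʳ-≡ t _ _ (trans (sym (sum-beads n (shape xs) (length-parts n (unbeads xs))))
      (trans (cong sum (beads-shape d len)) e))

-- Comparison of the coefficients at a monomial

mainTheorem1 : (ν : List ℕ) → IsPartition ν →
    (r m : ℕ) .{{_ : NonZero r}} .{{_ : NonZero m}} →
    s ν ⊛ (p[ r ]∘ h m) ≈ ∑[ κ ∈ partitions (r * m + sum ν) ] sgnʳ r κ ν · s κ
-- The coefficient at `α` involves only `n` variables, and `n` beads can represent ν only if it has
-- at most `n` parts. Otherwise both sides are zero.
mainTheorem1 ν pν r m α = [ short , long ]′ (ℕ.≤-<-connex (length ν) n)
  where
  open ≡-Reasoning
  n = length α
  N = r * m + sum ν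
  ρ = reverse α
  len : length ρ ≡ n
  len = List.length-reverse α

  s-reverse : ∀ κ {β} → s κ β ≡ s κ (reverse (reverse β))
  s-reverse κ {β} = cong (s κ) (sym (List.reverse-involutive β))

  tooLong : ∀ {κ β} → IsPartition κ → 0 < part κ n → length β ≡ n → s κ β ≡ 0ℤ
  tooLong {κ} {β} pκ 0<κₙ e = trans (s-reverse κ)
    (s-too-long (reverse β) (proj₁ pκ) (subst (λ k → 0 < part κ k) (sym (trans (List.length-reverse β) e)) 0<κₙ))

  beyond : ∀ {κ} → IsPartition κ → n < length κ → 0 < part κ n
  beyond pκ n<κ = ℕ.n≢0⇒n>0 (λ e → ℕ.<⇒≱ n<κ (length≤ (proj₂ pκ) e))

  long : n < length ν → (s ν ⊛ (p[ r ]∘ h m)) α ≡ ∑ (partitions N) (λ κ → sgnʳ r κ ν ⊗ s κ α)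
  long n<ν = trans
    (trans (∑-splittings-cong α (λ β γ e → cong (_⊗ (p[ r ]∘ h m) γ) (tooLong pν 0<ν e)))
           (vanish (∑-linear (splittings α)) (λ _ → refl)))
    (sym (∑-zero (partitions N) (λ {κ} κ∈ → zero-term κ (proj₁ (partitions-sound {N} κ∈)) (part κ n ℕ.<? part ν n))))
    where
    0<ν = beyond pν n<ν
    -- If row `n` of ν sticks out of κ, the sign is zero. If not, κ too has more rows than there are
    -- variables.
    zero-term : ∀ κ → IsPartition κ → Dec (part κ n < part ν n) → sgnʳ r κ ν ⊗ s κ α ≡ 0ℤ
    zero-term κ pκ (yes κ<ν) = cong (_⊗ s κ α) (sgnʳ-⋢ r {ν} {κ} κ<ν)
    zero-term κ pκ (no  κ≮ν) = trans
      (cong (sgnʳ r κ ν ⊗_) (tooLong pκ (ℕ.<-≤-trans 0<ν (ℕ.≮⇒≥ κ≮ν)) refl)) (ℤ.*-zeroʳ (sgnʳ r κ ν))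

  short : length ν ≤ n → (s ν ⊛ (p[ r ]∘ h m)) α ≡ ∑ (partitions N) (λ κ → sgnʳ r κ ν ⊗ s κ α)
  short ν≤n = begin
    ∑ (splittings α) (λ (β , γ) → s ν β ⊗ (p[ r ]∘ h m) γ)
      ≡⟨ ∑-splittings-cong α term ⟩
    ∑ (splittings α) (λ (β , γ) → 𝟙 (all? (r ∣?_) γ) ⊗ Φ (map +_ β) (sum (map (_/ r) γ)))
      ≡⟨ ∑-splittings r Y α Φ α<Y Φ-negative ⟩
    shifts (down r) Y (map +_ α) Φ
      ≡⟨ shifts-reverse (down r) Y (map +_ α) (λ ρ t → 𝟙 (t ℕ.≟ m) ⊗ S b ρ) ⟩
    shifts (down r) Y (reverse (map +_ α)) (λ ρ t → 𝟙 (t ℕ.≟ m) ⊗ S b ρ)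
      ≡⟨ cong (λ l → shifts (down r) Y l (λ ρ t → 𝟙 (t ℕ.≟ m) ⊗ S b ρ)) (List.reverse-map +_ α) ⟨
    shifts (down r) Y (map +_ ρ) (λ ρ t → 𝟙 (t ℕ.≟ m) ⊗ S b ρ)
      ≡⟨ shifts-S r Y (map +_ ρ) b (λ t → 𝟙 (t ℕ.≟ m)) ⟨
    shifts (up r) Y b (λ b′ t → 𝟙 (t ℕ.≟ m) ⊗ S b′ (map +_ ρ))
      ≡⟨ shifts-det r Y m b (S-alternating (map +_ ρ)) (s≤s (ℕ.m≤m+n total (sum α))) ⟩
    ∑ (decreasing (length b) Y) (λ xs → D xs ⊗ (𝟙 (sum xs ℕ.≟ total) ⊗ S xs (map +_ ρ)))
      ≡⟨ cong (λ k → ∑ (decreasing k Y) (λ xs → D xs ⊗ (𝟙 (sum xs ℕ.≟ total) ⊗ S xs (map +_ ρ)))) (length-beads n (part ν)) ⟩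
    ∑ (decreasing n Y) (λ xs → D xs ⊗ (𝟙 (sum xs ℕ.≟ total) ⊗ S xs (map +_ ρ)))
      ≡⟨ ∑-cong-∈ (decreasing n Y) (λ {xs} _ → trans (⊗-exchange (D xs) (𝟙 (sum xs ℕ.≟ total)) (S xs (map +_ ρ)))
           (cong (λ k → 𝟙 (sum xs ℕ.≟ k) ⊗ (D xs ⊗ S xs (map +_ ρ))) total≡)) ⟩
    ∑ (decreasing n Y) (λ xs → 𝟙 (sum xs ℕ.≟ N + t) ⊗ (D xs ⊗ S xs (map +_ ρ)))
      ≡⟨ ∑-partitions-beads n N Y (λ κ → sgnʳ r κ ν ⊗ s κ α) (λ xs → D xs ⊗ S xs (map +_ ρ))
           (subst (_< Y) total≡ (s≤s (ℕ.m≤m+n total (sum α))))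
           (λ {κ} pκ _ κ≤n → cong₂ _⊗_ (sgnʳ-signDet r n pν pκ ν≤n κ≤n) (s-beads′ (proj₁ pκ) refl κ≤n))
           (λ {κ} pκ n<κ → trans (cong (sgnʳ r κ ν ⊗_) (tooLong pκ (beyond pκ n<κ) refl)) (ℤ.*-zeroʳ (sgnʳ r κ ν))) ⟨
    ∑ (partitions N) (λ κ → sgnʳ r κ ν ⊗ s κ α) ∎
    where
    b = beads n (part ν)
    t = sum (beads n (λ _ → 0))
    total = sum b + r * m
    -- This exceeds `total`, hence all entries of the moved bead lists, and also every exponent in
    -- `α`, as `∑-splittings` requires.
    Y = suc (total + sum α)
    D : List ℕ → ℤ
    D = det (map (reach r) b)
    α<Y : All (_< Y) α
    α<Y = All.tabulate (λ a∈ → s≤s (ℕ.≤-trans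
      (entry≤sum (Any.map (λ { refl → ℕ.≤-refl }) a∈)) (ℕ.m≤n+m (sum α) total)))
    Φ : List ℤ → ℕ → ℤ
    Φ ρ t = 𝟙 (t ℕ.≟ m) ⊗ S b (reverse ρ)
    total≡ : total ≡ N + t
    total≡ = trans (cong (_+ r * m) (sum-beads n ν ν≤n)) (lemma (sum ν) t (r * m))
      where
      lemma : ∀ x y z → x + y + z ≡ z + x + y
      lemma = ℕS.solve-∀
    s-beads′ : ∀ {κ β} → Linked _≥_ κ → length β ≡ n → length κ ≤ n →
               s κ β ≡ S (beads n (part κ)) (map +_ (reverse β))
    s-beads′ {κ} {β} κ≥ e κ≤n = trans (s-reverse κ)
      (trans (s-beads (reverse β) κ≥ (subst (length κ ≤_) (sym e′) κ≤n))
             (cong (λ n → S (beads n (part κ)) (map +_ (reverse β))) e′))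
      where
      e′ : length (reverse β) ≡ n
      e′ = trans (List.length-reverse β) e
    term : ∀ β γ → length β ≡ n →
      s ν β ⊗ (p[ r ]∘ h m) γ ≡ 𝟙 (all? (r ∣?_) γ) ⊗ Φ (map +_ β) (sum (map (_/ r) γ))
    term β γ e = trans
      (cong₂ _⊗_ (trans (s-beads′ (proj₁ pν) e ν≤n) (cong (S b) (List.reverse-map +_ β))) (plethysm-coefficient r m γ))
      (rearrange (S b (reverse (map +_ β))) (𝟙 (all? (r ∣?_) γ)) _)
      where
      rearrange : ∀ x y z → x ⊗ (y ⊗ z) ≡ y ⊗ (z ⊗ x)
      rearrange = solve-∀
    Φ-negative : ∀ {ρ} t → Any (ℤ._< 0ℤ) ρ → Φ ρ t ≡ 0ℤ
    Φ-negative {ρ} t neg = trans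
      (cong (𝟙 (t ℕ.≟ m) ⊗_) (S-negative (reverse ρ)
        (beads-Decreasing n (partition⇒WeaklyDecreasing (proj₁ pν))) (Any⁺.reverse⁺ neg)))
      (ℤ.*-zeroʳ (𝟙 (t ℕ.≟ m)))
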